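{- For $m \geq 2$, we have $$ 4m^2 - O(\log m) \leq \mathsf{D} (\{ -m,\dots,m\}^2) \leq \frac{5 \pi}{2} m^2 + O(m). $$
   Context: For a subset $X$ of an abelian group, $\mathsf{D}(X)$ (the Davenport constant of $X$) is the largest length $n$ of a sequence $x_1,\dots,x_n$ of elements of $X$ with $\sum_{i=1}^n x_i=0$ and $\sum_{i\in I}x_i\neq 0$ for every non-empty proper subset $I$ of $\{1,\dots,n\}$. $\{ -m,\dots,m\}$ denotes the set of integers $i$ with $-m\le i\le m$. -}

module Defs where

open import Data.Nat as ℕ using (ℕ; zero; suc)
open import Data.Integer as ℤ using (ℤ; +_; -_)
open import Data.Rational as ℚ using (ℚ; 0ℚ; 1ℚ)
open import Data.Product using (_×_; _,_; Σ; ∃; ∃-syntax)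
open import Data.Fin using (Fin; zero; suc)
open import Data.Fin.Subset using (Subset; Side; inside; outside; ⊤; Nonempty)
open import Data.Vec using ([]; _∷_)
open import Relation.Binary.PropositionalEquality using (_≡_; _≢_)

Pt : Set
Pt = ℤ × ℤ

0p : Pt
0p = (+ 0 , + 0)

_⊕_ : Pt → Pt → Pt
(a , b) ⊕ (c , d) = (a ℤ.+ c , b ℤ.+ d)

subSum : ∀ {n} → (Fin n → Pt) → Subset n → Pt
subSum {zero} x [] = 0p
subSum {suc n} x (inside ∷ I) = x zero ⊕ subSum (λ i → x (suc i)) I
subSum {suc n} x (outside ∷ I) = subSum (λ i → x (suc i)) I

MinZeroSum : ∀ {n} → (Fin n → Pt) → Set
MinZeroSum {n} x =
  subSum x ⊤ ≡ 0p × (∀ (I : Subset n) → Nonempty I → I ≢ ⊤ → subSum x I ≢ 0p)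

IsDavenport : (Pt → Set) → ℕ → Set
IsDavenport X d =
  (Σ (Fin d → Pt) λ x → (∀ i → X (x i)) × MinZeroSum x)
  × (∀ (n : ℕ) (x : Fin n → Pt) → (∀ i → X (x i)) → MinZeroSum x → n ℕ.≤ d)

Box : ℕ → Pt → Set
Box m (a , b) = ((- (+ m)) ℤ.≤ a × a ℤ.≤ + m) × ((- (+ m)) ℤ.≤ b × b ℤ.≤ + m)

alt : ℕ → ℚ
alt zero = 1ℚ
alt (suc k) = ℚ.- alt k

leibniz : ℕ → ℚ
leibniz zero = 0ℚ
leibniz (suc k) = leibniz k ℚ.+ alt k ℚ.* (+ 1 ℚ./ suc (k ℕ.+ k))

-- 4·(partial sum with 2n+1 terms): strictly decreasing in n with limit π,
-- all strictly greater than π.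
piUpper : ℕ → ℚ
piUpper n = (+ 4 ℚ./ 1) ℚ.* leibniz (suc (n ℕ.+ n))

π<_ : ℚ → Set
π< q = ∃[ n ] (piUpper n ℚ.< q)

{-# OPTIONS --safe #-}

-- Upper bound.  Let A consist of the terms with x₁ > 0 and B of the others, and let v = (L , h) be the
-- sum over A; interchanging the coordinates if necessary, |h| ≤ L.  For any orders of A and of B, a
-- prefix sum of A plus (or minus) a prefix sum of B is, by minimality, determined modulo v only by
-- one pair of prefixes.  Hence |A| |B| is at most the number of lattice points in a strip of the
-- cylinder ℤ² / ⟨v⟩, which is small if the heights Y = L x₂ - h x₁ of the prefix sums are small.
-- To choose the order of A, tile a circle by the up-steps u and also by the down-steps w of Y, rotate
-- one tiling, and take the steps as the midpoints of their tiles occur.  On average over the rotations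
-- the mean square height is Σ (u + w)³ / 12 Σ (u + w), over all pairs of an up- and a down-step, while
-- the mean of x₁ is the average with weights u + w of the abscissa at which the chord joining the two
-- steps crosses the axis.  A cubic inequality for each chord bounds the two together, and the counts
-- give 5 n ≤ 32 m² + 24 m + 4 for a sequence of length n, where 32 / 5 < (5 / 2) (8 / 3) and π > 8 / 3.
--
-- Lower bound.  Three vectors spanning a triangle of doubled area 4m² - u in the box satisfy a relation
-- with coefficient sum 4m² - u, which is primitive if u ≥ 2 is the least integer coprime to m.  All of
-- 1, …, u - 1 divide m (y!)² with y = ⌊√(u-1)⌋, whereas a common multiple of 1, …, k is at least 2^(k-1);
-- so u = O(log m).

module Submission where

open import Defs
open import Data.Nat as ℕ using (ℕ; zero; suc; z≤n; s≤s; _∸_; _!; _^_)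
import Data.Nat.Properties as ℕₚ
open import Data.Nat.DivMod using (_%_; m<n⇒m%n≡m; [m+kn]%n≡m%n)
open import Data.Nat.Divisibility using (_∣_; divides; _∣?_; ∣-refl; ∣-trans; ∣⇒≤; ∣m+n∣m⇒∣n; ∣m⇒∣m*n; ∣n⇒∣m*n; m∣m*n; *-pres-∣; m≤n⇒m!∣n!; 1∣_; ∣1⇒≡1; 0∣⇒≡0)
open import Data.Nat.GCD using (gcd; gcd[m,n]∣m; gcd[m,n]∣n; gcd-greatest; c*gcd[m,n]≡gcd[cm,cn])
open import Data.Nat.Coprimality using (Coprime; coprime?; coprime-divisor)
open import Data.Nat.Logarithm using (⌊log₂_⌋; ⌊log₂⌋-mono-≤; ⌊log₂[2^n]⌋≡n)
import Data.Nat.Tactic.RingSolver as ℕR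
open import Data.Integer as ℤ using (ℤ; +_; -_; _+_; _*_; _-_; _≤_; _<_; +≤+; +<+; -[1+_])
import Data.Integer.Properties as ℤₚ
open import Data.Integer.DivMod using (_/ℕ_; _%ℕ_; n%ℕd<d; a≡a%ℕn+[a/ℕn]*n)
open import Data.Integer.Tactic.RingSolver using (solve-∀)
open import Data.Rational as ℚ using (ℚ; 0ℚ; 1ℚ)
import Data.Rational.Properties as ℚₚ
import Data.Rational.Unnormalised as ℚᵘ
import Data.Rational.Unnormalised.Properties as ℚᵘₚ
open import Data.Rational.Solver using (module +-*-Solver)
open import Data.Bool using (true; false)
import Data.Bool.Properties as Boolₚ
open import Data.Fin as Fin using (Fin; zero; suc; toℕ; _↑ˡ_; _↑ʳ_; combine; remQuot)
import Data.Fin.Properties as Finₚ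
open import Data.Fin.Subset using (Subset; ⊤; inside; outside; Nonempty)
import Data.Fin.Subset.Properties as Subsetₚ
open import Data.Vec using ([]; _∷_; tabulate; lookup)
import Data.Vec.Properties as Vecₚ
open import Data.Product using (_×_; _,_; Σ; ∃-syntax; proj₁; proj₂)
import Data.Product.Properties as Productₚ
open import Data.Sum using (_⊎_; inj₁; inj₂; [_,_]′; fromInj₁)
open import Data.Empty using (⊥; ⊥-elim)
open import Function using (_∘_)
open import Relation.Nullary using (Dec; yes; no; ¬_; does)
open import Relation.Nullary.Decidable using (_×-dec_; _⊎-dec_; ¬?; map′; dec-true)
open import Relation.Binary.Definitions using (tri<; tri≈; tri>)
open import Relation.Binary.PropositionalEquality
open import Algebra.Properties.AbelianGroup ℤₚ.+-0-abelianGroup using (∙-cancelʳ)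
open import Algebra.Properties.Semiring.Sum ℤₚ.+-*-semiring using (sum; sum-cong-≗; ∑-distrib-+; ∑-comm; *-distribˡ-sum; *-distribʳ-sum; sum-replicate-zero)

-- The orders control only the mean square of the heights, not their maximum. So a pair of prefixes
-- with recentred height Y gets the weight R² - Y², where R = 2mL; only pairs inside the strip |Y| ≤
-- R can have positive weight. The height of a pair is a sum or a difference of a height on A and a
-- height on B, about whose correlation nothing is known; counting both signs removes it. On each
-- side the sum of the squared heights is at most R²/2 per term, less a saving that is a fixed
-- multiple of m L³. Hence the terms in |A| |B| cancel (in the scaled integers below, 3 · 64 = 96 +
-- 96), and what remains is linear in |A| + |B|. In 4 ℓ³ + 80 m L² g ≤ 96 m² L² ℓ, the inequality
-- for a chord of length ℓ and moment g, the coefficient 80 of the saving is the largest that goes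
-- with 4 and 96: equality holds at ℓ = 2mL, g = 2m²L. Heights are scaled by 4 and tiles have even
-- length, so that midpoints and recentred heights are integers.

-- Integer inequalities by an explicit nonnegative difference

≤-from-gap : ∀ {a b} c → + 0 ≤ c → b ≡ a + c → a ≤ b
≤-from-gap {a} c 0≤c refl = subst (_≤ a + c) (ℤₚ.+-identityʳ a) (ℤₚ.+-monoʳ-≤ a 0≤c)

0≤+ : ∀ n → + 0 ≤ + n
0≤+ n = +≤+ z≤n

0≤a+b : ∀ {a b} → + 0 ≤ a → + 0 ≤ b → + 0 ≤ a + b
0≤a+b = ℤₚ.+-mono-≤

0≤a*b : ∀ {a b} → + 0 ≤ a → + 0 ≤ b → + 0 ≤ a * b
0≤a*b {+ m} {+ n} _ _ = subst (+ 0 ≤_) (ℤₚ.pos-* m n) (+≤+ z≤n)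

0≤b-a : ∀ {a b} → a ≤ b → + 0 ≤ b - a
0≤b-a = ℤₚ.i≤j⇒0≤j-i

0≤a² : ∀ a → + 0 ≤ a * a
0≤a² (+ n) = 0≤a*b (0≤+ n) (0≤+ n)
0≤a² -[1+ n ] = +≤+ z≤n

*-monoˡ-≤-0≤ : ∀ {a b c} → + 0 ≤ c → a ≤ b → c * a ≤ c * b
*-monoˡ-≤-0≤ {c = + n} _ a≤b = ℤₚ.*-monoˡ-≤-nonNeg (+ n) a≤b

*-cancelˡ-≤-0< : ∀ {a b} c → + 0 < c → c * a ≤ c * b → a ≤ b
*-cancelˡ-≤-0< {a} {b} (+ suc n) _ h = ℤₚ.*-cancelˡ-≤-pos a b (+ suc n) h
*-cancelˡ-≤-0< (+ zero) (+<+ ()) h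
*-cancelˡ-≤-0< -[1+ n ] () h

-- Finite sums and indicators

𝟙 : ∀ {P : Set} → Dec P → ℤ
𝟙 (yes _) = + 1
𝟙 (no _) = + 0

𝟙-yes : ∀ {P : Set} (d : Dec P) → P → 𝟙 d ≡ + 1
𝟙-yes (yes _) p = refl
𝟙-yes (no ¬p) p = ⊥-elim (¬p p)

𝟙-no : ∀ {P : Set} (d : Dec P) → ¬ P → 𝟙 d ≡ + 0
𝟙-no (yes p) ¬p = ⊥-elim (¬p p)
𝟙-no (no _) ¬p = refl

𝟙-cong : ∀ {P Q : Set} (d : Dec P) (e : Dec Q) → (P → Q) → (Q → P) → 𝟙 d ≡ 𝟙 e
𝟙-cong (yes p) e f g = sym (𝟙-yes e (f p))
𝟙-cong (no ¬p) e f g = sym (𝟙-no e (¬p ∘ g))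

0≤𝟙 : ∀ {P : Set} (d : Dec P) → + 0 ≤ 𝟙 d
0≤𝟙 (yes _) = +≤+ z≤n
0≤𝟙 (no _) = +≤+ z≤n

sum-0 : ∀ {n} (f : Fin n → ℤ) → (∀ i → f i ≡ + 0) → sum f ≡ + 0
sum-0 {n} f h = trans (sum-cong-≗ h) (sum-replicate-zero n)

sum-mono : ∀ {n} {f g : Fin n → ℤ} → (∀ i → f i ≤ g i) → sum f ≤ sum g
sum-mono {zero} h = ℤₚ.≤-refl
sum-mono {suc n} h = ℤₚ.+-mono-≤ (h zero) (sum-mono (h ∘ suc))

0≤sum : ∀ {n} {f : Fin n → ℤ} → (∀ i → + 0 ≤ f i) → + 0 ≤ sum f
0≤sum {zero} h = ℤₚ.≤-refl
0≤sum {suc n} h = 0≤a+b (h zero) (0≤sum (h ∘ suc))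

term≤sum : ∀ {n} (f : Fin n → ℤ) → (∀ i → + 0 ≤ f i) → ∀ i → f i ≤ sum f
term≤sum {suc n} f h zero = ≤-from-gap _ (0≤sum (h ∘ suc)) refl
term≤sum {suc n} f h (suc i) = ℤₚ.≤-trans (term≤sum (f ∘ suc) (h ∘ suc) i) (≤-from-gap (f zero) (h zero) (ℤₚ.+-comm (f zero) (sum (f ∘ suc))))

*-sumˡ : ∀ {n} c (f : Fin n → ℤ) → sum (λ i → c * f i) ≡ c * sum f
*-sumˡ c f = sym (*-distribˡ-sum c f)

*-sumʳ : ∀ {n} (f : Fin n → ℤ) c → sum (λ i → f i * c) ≡ sum f * c
*-sumʳ f c = sym (*-distribʳ-sum c f)

sum-+ : ∀ {n} (f g : Fin n → ℤ) → sum (λ i → f i + g i) ≡ sum f + sum g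
sum-+ = ∑-distrib-+

sum-+₃ : ∀ {n} (f g h : Fin n → ℤ) → sum (λ i → f i + g i + h i) ≡ sum f + sum g + sum h
sum-+₃ f g h = trans (sum-+ (λ i → f i + g i) h) (cong (_+ sum h) (sum-+ f g))

sum-+₄ : ∀ {n} (f g h k : Fin n → ℤ) → sum (λ i → f i + g i + h i + k i) ≡ sum f + sum g + sum h + sum k
sum-+₄ f g h k = trans (sum-+ (λ i → f i + g i + h i) k) (cong (_+ sum k) (sum-+₃ f g h))

cong₃ : ∀ {a b c a′ b′ c′ : ℤ} (f : ℤ → ℤ → ℤ → ℤ) → a ≡ a′ → b ≡ b′ → c ≡ c′ → f a b c ≡ f a′ b′ c′
cong₃ f refl refl refl = refl

cong₄ : ∀ {a b c d a′ b′ c′ d′ : ℤ} (f : ℤ → ℤ → ℤ → ℤ → ℤ) → a ≡ a′ → b ≡ b′ → c ≡ c′ → d ≡ d′ → f a b c d ≡ f a′ b′ c′ d′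
cong₄ f refl refl refl refl = refl

sum-- : ∀ {n} (f g : Fin n → ℤ) → sum (λ i → f i - g i) ≡ sum f - sum g
sum-- f g = trans (sum-+ f (λ i → - g i)) (cong (λ z → sum f + z) (lem g))
  where
  lem : ∀ {n} (g : Fin n → ℤ) → sum (λ i → - g i) ≡ - sum g
  lem {zero} g = refl
  lem {suc n} g = trans (cong (λ z → - g zero + z) (lem (g ∘ suc))) (sym (ℤₚ.neg-distrib-+ (g zero) _))

sum-const : ∀ n c → sum {n} (λ _ → c) ≡ + n * c
sum-const zero c = sym (ℤₚ.*-zeroˡ c)
sum-const (suc n) c = trans (cong (λ z → c + z) (sum-const n c)) (trans (cong (λ z → z + + n * c) (sym (ℤₚ.*-identityˡ c))) (sym (ℤₚ.*-distribʳ-+ c (+ 1) (+ n))))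

sum-sum-mono : ∀ {n k} {f g : Fin n → Fin k → ℤ} → (∀ i j → f i j ≤ g i j) →
  sum (λ i → sum (f i)) ≤ sum (λ i → sum (g i))
sum-sum-mono h = sum-mono (λ i → sum-mono (h i))

sum-sum-cong : ∀ {n k} {f g : Fin n → Fin k → ℤ} → (∀ i j → f i j ≡ g i j) →
  sum (λ i → sum (f i)) ≡ sum (λ i → sum (g i))
sum-sum-cong h = sum-cong-≗ (λ i → sum-cong-≗ (h i))

sum-sum-*ˡ : ∀ {n k} c (f : Fin n → Fin k → ℤ) → sum (λ i → sum (λ j → c * f i j)) ≡ c * sum (λ i → sum (f i))
sum-sum-*ˡ c f = trans (sum-cong-≗ (λ i → *-sumˡ c (f i))) (*-sumˡ c (λ i → sum (f i)))

sum-sum-+ : ∀ {n k} (f g : Fin n → Fin k → ℤ) →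
  sum (λ i → sum (λ j → f i j + g i j)) ≡ sum (λ i → sum (f i)) + sum (λ i → sum (g i))
sum-sum-+ f g = trans (sum-cong-≗ (λ i → sum-+ (f i) (g i))) (sum-+ (λ i → sum (f i)) (λ i → sum (g i)))

sum-split : ∀ a b (f : ℕ → ℤ) → sum {a ℕ.+ b} (f ∘ toℕ) ≡ sum {a} (f ∘ toℕ) + sum {b} (λ t → f (a ℕ.+ toℕ t))
sum-split zero b f = sym (ℤₚ.+-identityˡ _)
sum-split (suc a) b f = trans (cong (λ z → f 0 + z) (sum-split a b (f ∘ suc))) (sym (ℤₚ.+-assoc (f 0) _ _))

sum-𝟙-unique : ∀ {n} {P : Fin n → Set} (P? : ∀ i → Dec (P i)) → (∀ i j → P i → P j → i ≡ j) →
  sum (λ i → 𝟙 (P? i)) ≤ + 1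
sum-𝟙-unique {zero} P? u = +≤+ z≤n
sum-𝟙-unique {suc n} P? u with P? zero
... | no _ = subst (_≤ + 1) (sym (ℤₚ.+-identityˡ _)) (sum-𝟙-unique (P? ∘ suc) (λ i j p q → Finₚ.suc-injective (u _ _ p q)))
... | yes p = ℤₚ.≤-reflexive (cong (λ z → + 1 + z) (sum-0 (λ i → 𝟙 (P? (suc i))) (λ i → 𝟙-no (P? (suc i)) (λ q → case (u _ _ p q)))))
  where
  case : ∀ {n} {i : Fin n} → Fin.zero ≡ Fin.suc i → ⊥
  case ()

sum-sum-𝟙-unique : ∀ {n k} {P : Fin n → Fin k → Set} (P? : ∀ i j → Dec (P i j)) →
  (∀ i j i′ j′ → P i j → P i′ j′ → i ≡ i′ × j ≡ j′) → sum (λ i → sum (λ j → 𝟙 (P? i j))) ≤ + 1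
sum-sum-𝟙-unique {n} {k} {P} P? u = ℤₚ.≤-trans (sum-mono row) (sum-𝟙-unique Q? (λ i i′ (j , p) (j′ , q) → proj₁ (u i j i′ j′ p q)))
  where
  Q? : ∀ i → Dec (∃[ j ] P i j)
  Q? i = Finₚ.any? (P? i)
  row : ∀ i → sum (λ j → 𝟙 (P? i j)) ≤ 𝟙 (Q? i)
  row i with Q? i
  ... | yes _ = sum-𝟙-unique (P? i) (λ j j′ p q → proj₂ (u i j i j′ p q))
  ... | no ¬q = ℤₚ.≤-reflexive (sum-0 (λ j → 𝟙 (P? i j)) (λ j → 𝟙-no (P? i j) (λ p → ¬q (j , p))))

-- P i j c is read: the pair (i , j) has code c.
sum-sum-pigeonhole : ∀ {n k K} {P : Fin n → Fin k → Fin K → Set} (P? : ∀ i j c → Dec (P i j c)) →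
  (∀ i j i′ j′ c → P i j c → P i′ j′ c → i ≡ i′ × j ≡ j′) →
  (g : Fin K → ℤ) → (∀ c → + 0 ≤ g c) → (f : Fin n → Fin k → ℤ) →
  (∀ i j → f i j ≤ + 0 ⊎ (∃[ c ] P i j c × f i j ≤ g c)) →
  sum (λ i → sum (f i)) ≤ sum g
sum-sum-pigeonhole {n} {k} {K} P? inj g 0≤g f h = begin
  sum (λ i → sum (f i)) ≤⟨ sum-sum-mono below ⟩
  sum (λ i → sum (λ j → sum (λ c → 𝟙 (P? i j c) * g c))) ≡⟨ sum-cong-≗ (λ i → ∑-comm (λ j c → 𝟙 (P? i j c) * g c)) ⟩
  sum (λ i → sum (λ c → sum (λ j → 𝟙 (P? i j c) * g c))) ≡⟨ ∑-comm (λ i c → sum (λ j → 𝟙 (P? i j c) * g c)) ⟩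
  sum (λ c → sum (λ i → sum (λ j → 𝟙 (P? i j c) * g c))) ≡⟨ sum-cong-≗ (λ c → trans (sum-cong-≗ (λ i → *-sumʳ (λ j → 𝟙 (P? i j c)) (g c))) (*-sumʳ (λ i → sum (λ j → 𝟙 (P? i j c))) (g c))) ⟩
  sum (λ c → sum (λ i → sum (λ j → 𝟙 (P? i j c))) * g c) ≤⟨ sum-mono once ⟩
  sum g ∎
  where
  open ℤₚ.≤-Reasoning
  below : ∀ i j → f i j ≤ sum (λ c → 𝟙 (P? i j c) * g c)
  below i j with h i j
  ... | inj₁ f≤0 = ℤₚ.≤-trans f≤0 (0≤sum (λ c → 0≤a*b (0≤𝟙 (P? i j c)) (0≤g c)))
  ... | inj₂ (c , p , f≤g) = ℤₚ.≤-trans f≤g (ℤₚ.≤-trans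
          (ℤₚ.≤-reflexive (sym (trans (cong (λ z → z * g c) (𝟙-yes (P? i j c) p)) (ℤₚ.*-identityˡ (g c)))))
          (term≤sum (λ c → 𝟙 (P? i j c) * g c) (λ c → 0≤a*b (0≤𝟙 (P? i j c)) (0≤g c)) c))
  once : ∀ c → sum (λ i → sum (λ j → 𝟙 (P? i j c))) * g c ≤ g c
  once c = subst₂ _≤_ (ℤₚ.*-comm (g c) _) (ℤₚ.*-identityʳ (g c))
    (*-monoˡ-≤-0≤ (0≤g c) (sum-sum-𝟙-unique (λ i j → P? i j c) (λ i j i′ j′ → inj i j i′ j′ c)))

-- The two-index pigeonhole with a one-element second index. It turns an average over rotations into
-- an average over one period of a saw.
sum-injective : ∀ {n} (c : ℕ → ℕ) → (∀ s → s ℕ.< n → c s ℕ.< n) →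
  (∀ s t → s ℕ.< n → t ℕ.< n → c s ≡ c t → s ≡ t) →
  (g : ℕ → ℤ) → (∀ t → + 0 ≤ g t) → sum {n} (λ s → g (c (toℕ s))) ≤ sum {n} (g ∘ toℕ)
sum-injective {n} c c< c-inj g 0≤g = subst (_≤ sum {n} (g ∘ toℕ)) (sum-cong-≗ {n} {λ s → g (c (toℕ s)) + + 0} {λ s → g (c (toℕ s))} (λ s → ℤₚ.+-identityʳ _))
  (sum-sum-pigeonhole {n} {1} {n} (λ s _ t → c (toℕ s) ℕₚ.≟ toℕ t)
    (λ { i zero i′ zero t p q → Finₚ.toℕ-injective (c-inj _ _ (Finₚ.toℕ<n i) (Finₚ.toℕ<n i′) (trans p (sym q))) , refl })
    (g ∘ toℕ) (λ t → 0≤g (toℕ t)) (λ s _ → g (c (toℕ s)))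
    (λ s _ → inj₂ (Fin.fromℕ< (c< _ (Finₚ.toℕ<n s)) , sym (Finₚ.toℕ-fromℕ< _) , ℤₚ.≤-reflexive (cong g (sym (Finₚ.toℕ-fromℕ< _))))))

∃-below-average : ∀ n → 0 ℕ.< n → (g : ℕ → ℤ) → ∃[ s ] (s ℕ.< n × + n * g s ≤ sum {n} (g ∘ toℕ))
∃-below-average n 0<n g with min n 0<n g
  where
  min : ∀ n → 0 ℕ.< n → (g : ℕ → ℤ) → ∃[ s ] (s ℕ.< n × (∀ t → t ℕ.< n → g s ≤ g t))
  min (suc zero) _ g = 0 , s≤s z≤n , λ { zero _ → ℤₚ.≤-refl ; (suc t) (s≤s ()) }
  min (suc (suc n)) _ g with min (suc n) (s≤s z≤n) (g ∘ suc)
  ... | s , s< , h with ℤₚ.≤-total (g 0) (g (suc s))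
  ...   | inj₁ le = 0 , s≤s z≤n , λ { zero _ → ℤₚ.≤-refl ; (suc t) (s≤s t<) → ℤₚ.≤-trans le (h t t<) }
  ...   | inj₂ ge = suc s , s≤s s< , λ { zero _ → ge ; (suc t) (s≤s t<) → h t t< }
... | s , s< , h = s , s< , subst (_≤ sum {n} (g ∘ toℕ)) (sum-const n (g s)) (sum-mono (λ i → h (toℕ i) (Finₚ.toℕ<n i)))

-- Balanced orders of integers with sum zero

total : ∀ {n} → (Fin n → ℕ) → ℕ
total {zero} u = 0
total {suc n} u = u zero ℕ.+ total (u ∘ suc)

-- Tile a line by consecutive cells of lengths 2 u 0, 2 u 1, …; this is the midpoint of cell i.
centre : ∀ {n} → (Fin n → ℕ) → Fin n → ℕ
centre u zero = u zero
centre u (suc i) = u zero ℕ.+ u zero ℕ.+ centre (u ∘ suc) i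

cumulative : ∀ {n} → (Fin n → ℕ) → ℕ → ℤ
cumulative u t = sum (λ e → 𝟙 (centre u e ℕ.≤? t) * + u e)

-- Four times the discrepancy between the jumps at the centres and a uniform flow.
saw : ∀ {n} → (Fin n → ℕ) → ℕ → ℤ
saw u t = + 4 * cumulative u t - (+ 2 * + t + + 1)

total-sum : ∀ {n} (u : Fin n → ℕ) → + total u ≡ sum (λ i → + u i)
total-sum {zero} u = refl
total-sum {suc n} u = cong (λ z → + u zero + z) (total-sum (u ∘ suc))

u≤centre : ∀ {n} (u : Fin n → ℕ) i → u i ℕ.≤ centre u i
u≤centre u zero = ℕₚ.≤-refl
u≤centre u (suc i) = ℕₚ.≤-trans (u≤centre (u ∘ suc) i) (ℕₚ.m≤n+m _ (u zero ℕ.+ u zero))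

centre+u≤ : ∀ {n} (u : Fin n → ℕ) i → centre u i ℕ.+ u i ℕ.≤ total u ℕ.+ total u
centre+u≤ u zero = ℕₚ.+-mono-≤ (ℕₚ.m≤m+n (u zero) _) (ℕₚ.m≤m+n (u zero) _)
centre+u≤ {suc n} u (suc i) = begin
  a ℕ.+ a ℕ.+ centre (u ∘ suc) i ℕ.+ u (suc i) ≡⟨ ℕₚ.+-assoc (a ℕ.+ a) _ _ ⟩
  a ℕ.+ a ℕ.+ (centre (u ∘ suc) i ℕ.+ u (suc i)) ≤⟨ ℕₚ.+-monoʳ-≤ (a ℕ.+ a) (centre+u≤ (u ∘ suc) i) ⟩
  a ℕ.+ a ℕ.+ (b ℕ.+ b) ≡⟨ double-+ a b ⟩
  a ℕ.+ b ℕ.+ (a ℕ.+ b) ∎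
  where
  open ℕₚ.≤-Reasoning
  a = u zero
  b = total (u ∘ suc)
  double-+ : ∀ a b → a ℕ.+ a ℕ.+ (b ℕ.+ b) ≡ a ℕ.+ b ℕ.+ (a ℕ.+ b)
  double-+ = ℕR.solve-∀

centre-injective : ∀ {n} (u : Fin n → ℕ) e i → 0 ℕ.< u e → centre u e ≡ centre u i → e ≡ i
centre-injective u zero zero _ _ = refl
centre-injective u zero (suc i) 0<u eq = ⊥-elim (ℕₚ.<-irrefl eq
  (ℕₚ.<-≤-trans (ℕₚ.m<m+n (u zero) 0<u) (ℕₚ.m≤m+n _ _)))
centre-injective u (suc e) zero 0<u eq = ⊥-elim (ℕₚ.<-irrefl (sym eq)
  (ℕₚ.≤-<-trans (ℕₚ.m≤m+n (u zero) (u zero)) (ℕₚ.m<m+n _ (ℕₚ.<-≤-trans 0<u (u≤centre (u ∘ suc) e)))))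
centre-injective u (suc e) (suc i) 0<u eq =
  cong suc (centre-injective (u ∘ suc) e i 0<u (ℕₚ.+-cancelˡ-≡ (u zero ℕ.+ u zero) _ _ eq))

-- Every later centre is at least twice `u zero`, so before that time only the first jump can have
-- occurred.
cumulative-low : ∀ {n} (u : Fin (suc n) → ℕ) t → t ℕ.< u zero ℕ.+ u zero →
  cumulative u t ≡ 𝟙 (u zero ℕ.≤? t) * + u zero
cumulative-low u t t< = trans (cong (λ z → 𝟙 (u zero ℕ.≤? t) * + u zero + z)
  (sum-0 _ (λ i → trans (cong (_* + u (suc i)) (𝟙-no (centre u (suc i) ℕ.≤? t)
    (λ c≤t → ℕₚ.<-irrefl refl (ℕₚ.<-≤-trans t< (ℕₚ.≤-trans (ℕₚ.m≤m+n _ _) c≤t))))) (ℤₚ.*-zeroˡ (+ u (suc i))))))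
  (ℤₚ.+-identityʳ _)

cumulative-high : ∀ {n} (u : Fin (suc n) → ℕ) t →
  cumulative u (u zero ℕ.+ u zero ℕ.+ t) ≡ + u zero + cumulative (u ∘ suc) t
cumulative-high u t = cong₂ _+_
  (trans (cong (_* + u zero) (𝟙-yes (u zero ℕ.≤? _) (ℕₚ.≤-trans (ℕₚ.m≤m+n (u zero) (u zero)) (ℕₚ.m≤m+n _ t)))) (ℤₚ.*-identityˡ _))
  (sum-cong-≗ (λ i → cong (_* + u (suc i)) (𝟙-cong (centre u (suc i) ℕ.≤? _) (centre (u ∘ suc) i ℕ.≤? t)
    (ℕₚ.+-cancelˡ-≤ (u zero ℕ.+ u zero) _ _) (ℕₚ.+-monoʳ-≤ (u zero ℕ.+ u zero)))))

-- A uniform flow has passed half of the cell's own jump at its midpoint, while the cumulative sum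
-- already contains all of it; the excess is half of `u i`.
cumulative-centre : ∀ {n} (u : Fin n → ℕ) i → + 4 * cumulative u (centre u i) ≡ + 2 * + centre u i + + 2 * + u i
cumulative-centre {suc n} u zero = trans (cong (+ 4 *_) (cong₂ _+_
    (trans (cong (_* + u zero) (𝟙-yes (u zero ℕ.≤? u zero) ℕₚ.≤-refl)) (ℤₚ.*-identityˡ _))
    (sum-0 (λ i → 𝟙 (centre u (suc i) ℕ.≤? u zero) * + u (suc i)) zeros))) (arith (+ u zero))
  where
  arith : ∀ x → + 4 * (x + + 0) ≡ + 2 * x + + 2 * x
  arith = solve-∀
  -- A later centre can be as early as `u zero` only if its own jump is zero.
  zeros : ∀ i → 𝟙 (centre u (suc i) ℕ.≤? u zero) * + u (suc i) ≡ + 0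
  zeros i with centre u (suc i) ℕ.≤? u zero
  ... | no _ = ℤₚ.*-zeroˡ (+ u (suc i))
  ... | yes c≤ = cong (λ z → + 1 * + z) (ℕₚ.n≤0⇒n≡0 (ℕₚ.+-cancelˡ-≤ (u zero) _ _ (ℕₚ.≤-trans
      (ℕₚ.+-mono-≤ (ℕₚ.m≤m+n (u zero) (u zero)) (u≤centre (u ∘ suc) i)) (ℕₚ.≤-trans c≤ (ℕₚ.m≤m+n (u zero) 0)))))
cumulative-centre u (suc i) = trans (cong (+ 4 *_) (cumulative-high u (centre (u ∘ suc) i)))
  (trans (ℤₚ.*-distribˡ-+ (+ 4) (+ u zero) _) (trans (cong (λ z → + 4 * + u zero + z) (cumulative-centre (u ∘ suc) i))
   (arith (+ u zero) (+ centre (u ∘ suc) i) (+ u (suc i)))))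
  where
  arith : ∀ a c v → + 4 * a + (+ 2 * c + + 2 * v) ≡ + 2 * (a + a + c) + + 2 * v
  arith = solve-∀

saw-centre : ∀ {n} (u : Fin n → ℕ) i → saw u (centre u i) ≡ + 2 * + u i - + 1
saw-centre u i = trans (cong (λ z → z - (+ 2 * + centre u i + + 1)) (cumulative-centre u i)) (arith (+ centre u i) (+ u i))
  where
  arith : ∀ c v → + 2 * c + + 2 * v - (+ 2 * c + + 1) ≡ + 2 * v - + 1
  arith = solve-∀

-- Removing the first term replaces `K` by `K - 2`, so the induction has to run over all `K` at
-- once.
odd-squares : ∀ j K → + 3 * sum {j} (λ t → (K - (+ 2 * + toℕ t + + 1)) * (K - (+ 2 * + toℕ t + + 1))) ≡
  + 3 * + j * K * K - + 6 * K * + j * + j + + 4 * + j * + j * + j - + j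
odd-squares zero K = arith K
  where
  arith : ∀ K → + 0 ≡ + 3 * + 0 * K * K - + 6 * K * + 0 * + 0 + + 4 * + 0 * + 0 * + 0 - + 0
  arith = solve-∀
odd-squares (suc j) K = begin
  + 3 * ((K - + 1) * (K - + 1) + sum {j} (λ t → O K (suc (toℕ t))))
    ≡⟨ cong (λ z → + 3 * ((K - + 1) * (K - + 1) + z)) (sum-cong-≗ {j} (λ t → shift (+ toℕ t) K)) ⟩
  + 3 * ((K - + 1) * (K - + 1) + sum {j} (λ t → O (K - + 2) (toℕ t)))
    ≡⟨ ℤₚ.*-distribˡ-+ (+ 3) ((K - + 1) * (K - + 1)) (sum {j} (λ t → O (K - + 2) (toℕ t))) ⟩
  + 3 * ((K - + 1) * (K - + 1)) + + 3 * sum {j} (λ t → O (K - + 2) (toℕ t))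
    ≡⟨ cong (λ z → + 3 * ((K - + 1) * (K - + 1)) + z) (odd-squares j (K - + 2)) ⟩
  + 3 * ((K - + 1) * (K - + 1)) + (+ 3 * + j * (K - + 2) * (K - + 2) - + 6 * (K - + 2) * + j * + j + + 4 * + j * + j * + j - + j)
    ≡⟨ arith (+ j) K ⟩
  + 3 * (+ 1 + + j) * K * K - + 6 * K * (+ 1 + + j) * (+ 1 + + j) + + 4 * (+ 1 + + j) * (+ 1 + + j) * (+ 1 + + j) - (+ 1 + + j) ∎
  where
  open ≡-Reasoning
  O : ℤ → ℕ → ℤ
  O K t = (K - (+ 2 * + t + + 1)) * (K - (+ 2 * + t + + 1))
  shift : ∀ t K → (K - (+ 2 * (+ 1 + t) + + 1)) * (K - (+ 2 * (+ 1 + t) + + 1)) ≡ (K - + 2 - (+ 2 * t + + 1)) * (K - + 2 - (+ 2 * t + + 1))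
  shift = solve-∀
  arith : ∀ j K → + 3 * ((K - + 1) * (K - + 1)) + (+ 3 * j * (K - + 2) * (K - + 2) - + 6 * (K - + 2) * j * j + + 4 * j * j * j - j) ≡
    + 3 * (+ 1 + j) * K * K - + 6 * K * (+ 1 + j) * (+ 1 + j) + + 4 * (+ 1 + j) * (+ 1 + j) * (+ 1 + j) - (+ 1 + j)
  arith = solve-∀

-- Over one period the saw takes in each cell of length 2 v the odd values in (-2v , 2v), each once.
saw-squares : ∀ {n} (u : Fin n → ℕ) k → + 3 * sum {total u ℕ.+ total u} (λ t → (k + saw u (toℕ t)) * (k + saw u (toℕ t))) ≤
  + 6 * + total u * k * k + + 8 * sum (λ i → + u i * + u i * + u i)
saw-squares {zero} u k = ℤₚ.≤-reflexive (arith k)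
  where
  arith : ∀ k → + 3 * + 0 ≡ + 6 * + 0 * k * k + + 8 * + 0
  arith = solve-∀
saw-squares {suc n} u k = begin
  + 3 * sum {U ℕ.+ U} (F ∘ toℕ) ≡⟨ cong (λ N → + 3 * sum {N} (F ∘ toℕ)) (regroup a V) ⟩
  + 3 * sum {a ℕ.+ a ℕ.+ (V ℕ.+ V)} (F ∘ toℕ) ≡⟨ cong (+ 3 *_) (trans (sum-split (a ℕ.+ a) (V ℕ.+ V) F) (cong (_+ sum {V ℕ.+ V} (λ t → F (a ℕ.+ a ℕ.+ toℕ t))) (sum-split a a F))) ⟩
  + 3 * (sum {a} (F ∘ toℕ) + sum {a} (λ t → F (a ℕ.+ toℕ t)) + sum {V ℕ.+ V} (λ t → F (a ℕ.+ a ℕ.+ toℕ t)))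
    -- The first cell is cut at its centre: the saw runs through -1, -3, ... before the jump and
    -- through 2a - 1, 2a - 3, ... after it; beyond the cell it is the saw of the remaining tiles.
    ≡⟨ cong (+ 3 *_) (cong₂ _+_ (cong₂ _+_ (sum-cong-≗ {a} part₁) (sum-cong-≗ {a} part₂)) (sum-cong-≗ {V ℕ.+ V} part₃)) ⟩
  + 3 * (sum {a} (λ t → O k (toℕ t)) + sum {a} (λ t → O (k + + 2 * + a) (toℕ t)) + sum {V ℕ.+ V} (G ∘ toℕ))
    ≡⟨ distrib (sum {a} (λ t → O k (toℕ t))) _ _ ⟩
  + 3 * sum {a} (λ t → O k (toℕ t)) + + 3 * sum {a} (λ t → O (k + + 2 * + a) (toℕ t)) + + 3 * sum {V ℕ.+ V} (G ∘ toℕ)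
    ≡⟨ cong₂ (λ y z → y + z + + 3 * sum {V ℕ.+ V} (G ∘ toℕ)) (odd-squares a k) (odd-squares a (k + + 2 * + a)) ⟩
  P k + P (k + + 2 * + a) + + 3 * sum {V ℕ.+ V} (G ∘ toℕ) ≤⟨ ℤₚ.+-monoʳ-≤ (P k + P (k + + 2 * + a)) (saw-squares (u ∘ suc) k) ⟩
  -- The two halves add up to 6 a k² + 8 a³ - 2 a, the part linear in `k` cancelling by symmetry;
  -- the - 2 a is given away.
  P k + P (k + + 2 * + a) + (+ 6 * + V * k * k + + 8 * C) ≤⟨ ≤-from-gap (+ 2 * + a) (0≤a*b (0≤+ 2) (0≤+ a)) (arith (+ a) (+ V) k C) ⟩
  + 6 * (+ a + + V) * k * k + + 8 * (+ a * + a * + a + C) ∎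
  where
  open ℤₚ.≤-Reasoning
  a = u zero
  V = total (u ∘ suc)
  U = total u
  C = sum (λ i → + u (suc i) * + u (suc i) * + u (suc i))
  F G : ℕ → ℤ
  F t = (k + saw u t) * (k + saw u t)
  G t = (k + saw (u ∘ suc) t) * (k + saw (u ∘ suc) t)
  O : ℤ → ℕ → ℤ
  O K t = (K - (+ 2 * + t + + 1)) * (K - (+ 2 * + t + + 1))
  P : ℤ → ℤ
  P K = + 3 * + a * K * K - + 6 * K * + a * + a + + 4 * + a * + a * + a - + a
  regroup : ∀ a b → a ℕ.+ b ℕ.+ (a ℕ.+ b) ≡ a ℕ.+ a ℕ.+ (b ℕ.+ b)
  regroup = ℕR.solve-∀
  distrib : ∀ x y z → + 3 * (x + y + z) ≡ + 3 * x + + 3 * y + + 3 * z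
  distrib = solve-∀
  arith : ∀ a V k C → + 6 * (a + V) * k * k + + 8 * (a * a * a + C) ≡
    (+ 3 * a * k * k - + 6 * k * a * a + + 4 * a * a * a - a) +
    (+ 3 * a * (k + + 2 * a) * (k + + 2 * a) - + 6 * (k + + 2 * a) * a * a + + 4 * a * a * a - a) +
    (+ 6 * V * k * k + + 8 * C) + + 2 * a
  arith = solve-∀
  part₁ : ∀ (t : Fin a) → F (toℕ t) ≡ O k (toℕ t)
  part₁ t = trans (cong (λ z → (k + (+ 4 * z - (+ 2 * + toℕ t + + 1))) * (k + (+ 4 * z - (+ 2 * + toℕ t + + 1))))
      (trans (cumulative-low u (toℕ t) (ℕₚ.<-≤-trans (Finₚ.toℕ<n t) (ℕₚ.m≤m+n a a))) (trans (cong (_* + a) (𝟙-no (a ℕ.≤? toℕ t) (ℕₚ.<⇒≱ (Finₚ.toℕ<n t)))) (ℤₚ.*-zeroˡ (+ a)))))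
      (lem k (+ toℕ t))
    where
    lem : ∀ k t → (k + (+ 4 * + 0 - (+ 2 * t + + 1))) * (k + (+ 4 * + 0 - (+ 2 * t + + 1))) ≡ (k - (+ 2 * t + + 1)) * (k - (+ 2 * t + + 1))
    lem = solve-∀
  part₂ : ∀ (t : Fin a) → F (a ℕ.+ toℕ t) ≡ O (k + + 2 * + a) (toℕ t)
  part₂ t = trans (cong (λ z → (k + (+ 4 * z - (+ 2 * (+ a + + toℕ t) + + 1))) * (k + (+ 4 * z - (+ 2 * (+ a + + toℕ t) + + 1))))
      (trans (cumulative-low u (a ℕ.+ toℕ t) (ℕₚ.+-monoʳ-< a (Finₚ.toℕ<n t))) (trans (cong (_* + a) (𝟙-yes (a ℕ.≤? a ℕ.+ toℕ t) (ℕₚ.m≤m+n a _))) (ℤₚ.*-identityˡ (+ a)))))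
      (lem k (+ a) (+ toℕ t))
    where
    lem : ∀ k a t → (k + (+ 4 * a - (+ 2 * (a + t) + + 1))) * (k + (+ 4 * a - (+ 2 * (a + t) + + 1))) ≡ (k + + 2 * a - (+ 2 * t + + 1)) * (k + + 2 * a - (+ 2 * t + + 1))
    lem = solve-∀
  part₃ : ∀ (t : Fin (V ℕ.+ V)) → F (a ℕ.+ a ℕ.+ toℕ t) ≡ G (toℕ t)
  part₃ t = trans (cong (λ z → (k + (+ 4 * z - (+ 2 * (+ a + + a + + toℕ t) + + 1))) * (k + (+ 4 * z - (+ 2 * (+ a + + a + + toℕ t) + + 1))))
      (cumulative-high u (toℕ t)))
      (lem k (+ a) (+ toℕ t) (cumulative (u ∘ suc) (toℕ t)))
    where
    lem : ∀ k a t c → (k + (+ 4 * (a + c) - (+ 2 * (a + a + t) + + 1))) * (k + (+ 4 * (a + c) - (+ 2 * (a + a + t) + + 1))) ≡ (k + (+ 4 * c - (+ 2 * t + + 1))) * (k + (+ 4 * c - (+ 2 * t + + 1)))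
    lem = solve-∀

-- Cells of length zero may tie with others or lie at the very end of the circle; as their weight is
-- zero, the two conditions need only agree for positive weight.
𝟙-*-cong : ∀ {P Q : Set} (d : Dec P) (e : Dec Q) v → (0 ℕ.< v → P → Q) → (0 ℕ.< v → Q → P) → 𝟙 d * + v ≡ 𝟙 e * + v
𝟙-*-cong d e zero f g = trans (ℤₚ.*-zeroʳ (𝟙 d)) (sym (ℤₚ.*-zeroʳ (𝟙 e)))
𝟙-*-cong d e (suc v) f g = cong (_* + suc v) (𝟙-cong d e (f (s≤s z≤n)) (g (s≤s z≤n)))

-- Rotating a tiling of the circle

wrap : ℕ → ℕ → ℕ
wrap M z with z ℕ.<? M
... | yes _ = z
... | no _ = z ∸ M

wrap-cases : ∀ M z → (z ℕ.< M × wrap M z ≡ z) ⊎ (M ℕ.≤ z × wrap M z ℕ.+ M ≡ z)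
wrap-cases M z with z ℕ.<? M
... | yes z<M = inj₁ (z<M , refl)
... | no z≮M = inj₂ (ℕₚ.≮⇒≥ z≮M , ℕₚ.m∸n+n≡m (ℕₚ.≮⇒≥ z≮M))

wrap-< : ∀ M z → z ℕ.< M ℕ.+ M → wrap M z ℕ.< M
wrap-< M z z< with wrap-cases M z
... | inj₁ (z<M , eq) = subst (ℕ._< M) (sym eq) z<M
... | inj₂ (_ , eq) = ℕₚ.+-cancelʳ-< M _ _ (subst (ℕ._< M ℕ.+ M) (sym eq) z<)

wrap-injective : ∀ M c s t → s ℕ.< M → t ℕ.< M → wrap M (c ℕ.+ s) ≡ wrap M (c ℕ.+ t) → s ≡ t
wrap-injective M c s t s< t< eq with wrap-cases M (c ℕ.+ s) | wrap-cases M (c ℕ.+ t)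
... | inj₁ (_ , p) | inj₁ (_ , q) = ℕₚ.+-cancelˡ-≡ c _ _ (trans (sym p) (trans eq q))
... | inj₂ (_ , p) | inj₂ (_ , q) = ℕₚ.+-cancelˡ-≡ c _ _ (trans (sym p) (trans (cong (ℕ._+ M) eq) q))
... | inj₁ (_ , p) | inj₂ (_ , q) = ⊥-elim (ℕₚ.<⇒≱ t< (ℕₚ.≤-trans (ℕₚ.m≤n+m M s)
        (ℕₚ.≤-reflexive (ℕₚ.+-cancelˡ-≡ c _ _ (trans (sym (ℕₚ.+-assoc c s M)) (trans (cong (ℕ._+ M) (trans (sym p) eq)) q))))))
... | inj₂ (_ , p) | inj₁ (_ , q) = ⊥-elim (ℕₚ.<⇒≱ s< (ℕₚ.≤-trans (ℕₚ.m≤n+m M t)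
        (ℕₚ.≤-reflexive (ℕₚ.+-cancelˡ-≡ c _ _ (trans (sym (ℕₚ.+-assoc c t M)) (trans (cong (ℕ._+ M) (trans (sym q) (sym eq))) p))))))

rotated : ∀ {n} → (Fin n → ℕ) → ℕ → ℕ → Fin n → ℕ
rotated w M s q = wrap M (centre w q ℕ.+ s)

module _ {M s r : ℕ} (M≡ : s ℕ.+ suc r ≡ M) where

  -- Since `M = s + r + 1`, `r` stands for `- s - 1` modulo `M`: a strict inequality after rotation
  -- by `s` is a weak one with `r`.
  shift-≤ : ∀ {a b} → a ℕ.+ s ℕ.< b ℕ.+ M → a ℕ.≤ b ℕ.+ r
  shift-≤ {a} {b} h = ℕ.s≤s⁻¹ (ℕₚ.+-cancelʳ-< s a (suc (b ℕ.+ r))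
    (subst (a ℕ.+ s ℕ.<_) (trans (cong (b ℕ.+_) (sym M≡)) (lem b s r)) h))
    where
    lem : ∀ b s r → b ℕ.+ (s ℕ.+ suc r) ≡ suc (b ℕ.+ r) ℕ.+ s
    lem b s r = trans (cong (b ℕ.+_) (trans (ℕₚ.+-comm s (suc r)) refl)) (trans (sym (ℕₚ.+-assoc b (suc r) s)) (cong (ℕ._+ s) (ℕₚ.+-suc b r)))

  shift-< : ∀ {a b} → a ℕ.≤ b ℕ.+ r → a ℕ.+ s ℕ.< b ℕ.+ M
  shift-< {a} {b} h = subst (suc (a ℕ.+ s) ℕ.≤_) (trans (lem b r s) (cong (b ℕ.+_) M≡)) (s≤s (ℕₚ.+-monoˡ-≤ s h))
    where
    lem : ∀ b r s → suc (b ℕ.+ r ℕ.+ s) ≡ b ℕ.+ (s ℕ.+ suc r)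
    lem b r s = trans (cong suc (trans (ℕₚ.+-assoc b r s) (cong (b ℕ.+_) (ℕₚ.+-comm r s)))) (trans (sym (ℕₚ.+-suc b (s ℕ.+ r))) (cong (b ℕ.+_) (sym (ℕₚ.+-suc s r))))

  -- The points that the rotation carries into [0 , x) are those of the arc from `r` (excluded) to
  -- `x + r` (included) modulo `M`. Here this arc does not pass the end of the period.
  rotated-count-low : ∀ c x → c ℕ.< M → x ℕ.+ r ℕ.< M →
    𝟙 (wrap M (c ℕ.+ s) ℕ.<? x) ≡ 𝟙 (c ℕ.≤? x ℕ.+ r) - 𝟙 (c ℕ.≤? r)
  rotated-count-low c x c<M x+r<M with wrap-cases M (c ℕ.+ s)
  ... | inj₁ (c+s<M , eq) = trans (𝟙-no (_ ℕ.<? x) (λ h → ℕₚ.<-irrefl refl (ℕₚ.<-≤-trans (subst (ℕ._< x) eq h) (ℕₚ.≤-trans x≤s (ℕₚ.m≤n+m s c)))))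
        (sym (cong₂ _-_ (𝟙-yes (c ℕ.≤? _) (ℕₚ.≤-trans c≤r (ℕₚ.m≤n+m r x))) (𝟙-yes (c ℕ.≤? r) c≤r)))
    where
    c≤r = shift-≤ {c} {0} c+s<M
    x≤s : x ℕ.≤ s
    x≤s = ℕₚ.+-cancelʳ-≤ (suc r) x s (subst₂ ℕ._≤_ (sym (ℕₚ.+-suc x r)) (sym M≡) x+r<M)
  ... | inj₂ (M≤c+s , eq) = trans (𝟙-cong (_ ℕ.<? x) (c ℕ.≤? x ℕ.+ r)
            (λ h → shift-≤ (subst (ℕ._< x ℕ.+ M) eq (ℕₚ.+-monoˡ-< M h)))
            (λ h → ℕₚ.+-cancelʳ-< M _ _ (subst (ℕ._< x ℕ.+ M) (sym eq) (shift-< h))))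
        (sym (trans (cong (λ z → 𝟙 (c ℕ.≤? x ℕ.+ r) - z) (𝟙-no (c ℕ.≤? r) (λ c≤r → ℕₚ.<⇒≱ (shift-< {c} {0} c≤r) M≤c+s))) (ℤₚ.+-identityʳ _)))

  -- Now the arc passes the end of the period and stops at `t`; the summand 1 is the full turn.
  rotated-count-high : ∀ c x t → c ℕ.< M → x ℕ.≤ M → t ℕ.+ M ≡ x ℕ.+ r →
    𝟙 (wrap M (c ℕ.+ s) ℕ.<? x) ≡ 𝟙 (c ℕ.≤? t) + + 1 - 𝟙 (c ℕ.≤? r)
  rotated-count-high c x t c<M x≤M t+M≡ with wrap-cases M (c ℕ.+ s)
  ... | inj₁ (c+s<M , eq) = trans (𝟙-cong (_ ℕ.<? x) (c ℕ.≤? t)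
            (λ h → ℕₚ.+-cancelʳ-≤ M c t (subst (c ℕ.+ M ℕ.≤_) (sym t+M≡) (to (subst (ℕ._< x) eq h))))
            (λ h → subst (ℕ._< x) (sym eq) (from (subst (c ℕ.+ M ℕ.≤_) t+M≡ (ℕₚ.+-monoˡ-≤ M h)))))
        (sym (trans (cong (λ z → 𝟙 (c ℕ.≤? t) + + 1 - z) (𝟙-yes (c ℕ.≤? r) (shift-≤ {c} {0} c+s<M))) (lem (𝟙 (c ℕ.≤? t)))))
    where
    lem : ∀ z → z + + 1 - + 1 ≡ z
    lem = solve-∀
    assoc : c ℕ.+ M ≡ suc (c ℕ.+ s) ℕ.+ r
    assoc = trans (cong (c ℕ.+_) (sym M≡)) (trans (sym (ℕₚ.+-assoc c s (suc r))) (ℕₚ.+-suc (c ℕ.+ s) r))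
    to : c ℕ.+ s ℕ.< x → c ℕ.+ M ℕ.≤ x ℕ.+ r
    to h = subst (ℕ._≤ x ℕ.+ r) (sym assoc) (ℕₚ.+-monoˡ-≤ r h)
    from : c ℕ.+ M ℕ.≤ x ℕ.+ r → c ℕ.+ s ℕ.< x
    from h = ℕₚ.+-cancelʳ-≤ r _ _ (subst (ℕ._≤ x ℕ.+ r) assoc h)
  ... | inj₂ (M≤c+s , eq) = trans (𝟙-yes (_ ℕ.<? x) small)
        (sym (cong₂ (λ y z → y + + 1 - z) (𝟙-no (c ℕ.≤? t) (λ c≤t → c≰r (ℕₚ.≤-trans c≤t t≤r))) (𝟙-no (c ℕ.≤? r) c≰r)))
    where
    c≰r : ¬ c ℕ.≤ r
    c≰r c≤r = ℕₚ.<⇒≱ (shift-< {c} {0} c≤r) M≤c+s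
    t≤r : t ℕ.≤ r
    t≤r = ℕₚ.+-cancelˡ-≤ M t r (subst (ℕ._≤ M ℕ.+ r) (trans (sym t+M≡) (ℕₚ.+-comm t M)) (ℕₚ.+-monoˡ-≤ r x≤M))
    s<x : s ℕ.< x
    s<x = ℕₚ.+-cancelʳ-≤ r (suc s) x (subst₂ ℕ._≤_ (trans (sym M≡) (ℕₚ.+-suc s r)) t+M≡ (ℕₚ.m≤n+m M t))
    small : wrap M (c ℕ.+ s) ℕ.< x
    small = ℕₚ.<-trans (ℕₚ.+-cancelʳ-< M _ s (subst₂ ℕ._<_ (sym eq) (ℕₚ.+-comm M s) (ℕₚ.+-monoˡ-< s c<M))) s<x

  -- The mass of an arc of length `x` is that of the uniform flow, x / 2, plus the difference of the
  -- discrepancies at the two ends. A full turn changes nothing, because the flow is exact over one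
  -- period.
  rotated-sum : ∀ {n} (w : Fin n → ℕ) → total w ℕ.+ total w ≡ M → ∀ x → x ℕ.≤ M →
    + 4 * sum (λ q → 𝟙 (rotated w M s q ℕ.<? x) * + w q) ≡ + 2 * + x + saw w (wrap M (x ℕ.+ r)) - saw w r
  rotated-sum {n} w W≡ x x≤M with wrap-cases M (x ℕ.+ r)
  ... | inj₁ (x+r<M , eq) = trans (cong (+ 4 *_) (trans (sum-cong-≗ pointwise) (sum-- (λ q → 𝟙 (centre w q ℕ.≤? x ℕ.+ r) * + w q) (λ q → 𝟙 (centre w q ℕ.≤? r) * + w q))))
      (trans (lem (cumulative w (x ℕ.+ r)) (cumulative w r) (+ x) (+ r)) (cong (λ z → + 2 * + x + saw w z - saw w r) (sym eq)))
    where
    pointwise : ∀ q → 𝟙 (rotated w M s q ℕ.<? x) * + w q ≡ 𝟙 (centre w q ℕ.≤? x ℕ.+ r) * + w q - 𝟙 (centre w q ℕ.≤? r) * + w q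
    pointwise q with w q | centre+u≤ w q
    ... | zero | _ = trans (ℤₚ.*-zeroʳ (𝟙 (rotated w M s q ℕ.<? x))) (sym (cong₂ _-_ (ℤₚ.*-zeroʳ (𝟙 (centre w q ℕ.≤? x ℕ.+ r))) (ℤₚ.*-zeroʳ (𝟙 (centre w q ℕ.≤? r)))))
    ... | suc v | c+ = trans (cong (_* + suc v) (rotated-count-low (centre w q) x (ℕₚ.<-≤-trans (ℕₚ.m<m+n _ (s≤s z≤n)) (subst (centre w q ℕ.+ suc v ℕ.≤_) W≡ c+)) x+r<M))
        (lem₂ (𝟙 (centre w q ℕ.≤? x ℕ.+ r)) (𝟙 (centre w q ℕ.≤? r)) (+ suc v))
      where
      lem₂ : ∀ a b c → (a - b) * c ≡ a * c - b * c
      lem₂ = solve-∀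
    lem : ∀ a b x r → + 4 * (a - b) ≡ + 2 * x + (+ 4 * a - (+ 2 * (x + r) + + 1)) - (+ 4 * b - (+ 2 * r + + 1))
    lem = solve-∀
  ... | inj₂ (_ , eq) = trans (cong (+ 4 *_) (trans (sum-cong-≗ pointwise)
        (trans (sum-- (λ q → 𝟙 (centre w q ℕ.≤? t) * + w q + + w q) (λ q → 𝟙 (centre w q ℕ.≤? r) * + w q))
          (cong (_- cumulative w r) (trans (sum-+ (λ q → 𝟙 (centre w q ℕ.≤? t) * + w q) (λ q → + w q)) (cong (λ z → cumulative w t + z) (sym (total-sum w))))))))
      (lem (cumulative w t) (cumulative w r) (+ x) (+ r) (+ t) (+ total w) (trans (cong (λ z → + (t ℕ.+ z)) W≡) (cong +_ eq)))
    where
    t = wrap M (x ℕ.+ r)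
    pointwise : ∀ q → 𝟙 (rotated w M s q ℕ.<? x) * + w q ≡ 𝟙 (centre w q ℕ.≤? t) * + w q + + w q - 𝟙 (centre w q ℕ.≤? r) * + w q
    pointwise q with w q | centre+u≤ w q
    ... | zero | _ = trans (ℤₚ.*-zeroʳ (𝟙 (rotated w M s q ℕ.<? x))) (sym (cong₂ (λ y z → y + + 0 - z) (ℤₚ.*-zeroʳ (𝟙 (centre w q ℕ.≤? t))) (ℤₚ.*-zeroʳ (𝟙 (centre w q ℕ.≤? r)))))
    ... | suc v | c+ = trans (cong (_* + suc v) (rotated-count-high (centre w q) x t (ℕₚ.<-≤-trans (ℕₚ.m<m+n _ (s≤s z≤n)) (subst (centre w q ℕ.+ suc v ℕ.≤_) W≡ c+)) x≤M eq))
        (lem₂ (𝟙 (centre w q ℕ.≤? t)) (𝟙 (centre w q ℕ.≤? r)) (+ suc v))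
      where
      lem₂ : ∀ a b c → (a + + 1 - b) * c ≡ a * c + c - b * c
      lem₂ = solve-∀
    lem : ∀ a b x r t W → t + (W + W) ≡ x + r → + 4 * (a + W - b) ≡ + 2 * x + (+ 4 * a - (+ 2 * t + + 1)) - (+ 4 * b - (+ 2 * r + + 1))
    lem a b x r t W h = trans (lem₃ a b t W) (trans (cong (λ z → + 4 * a - + 4 * b + + 2 * z - + 2 * t) h) (lem₄ a b x r t))
      where
      lem₃ : ∀ a b t W → + 4 * (a + W - b) ≡ + 4 * a - + 4 * b + + 2 * (t + (W + W)) - + 2 * t
      lem₃ = solve-∀
      lem₄ : ∀ a b x r t → + 4 * a - + 4 * b + + 2 * (x + r) - + 2 * t ≡ + 2 * x + (+ 4 * a - (+ 2 * t + + 1)) - (+ 4 * b - (+ 2 * r + + 1))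
      lem₄ = solve-∀

-- Merging the two tilings into one order

prefix : ∀ {n} → (Fin n → ℕ) → (Fin n → ℤ) → Fin n → ℤ
prefix K y i = sum (λ e → 𝟙 (K e ℕ.≤? K i) * y e)

-- A two-digit number in base `n` with leading digit `p i` and last digit `i`: it orders by `p` and
-- breaks ties by the index.
spread : ∀ {n} → (Fin n → ℕ) → Fin n → ℕ
spread {n} p i = toℕ i ℕ.+ p i ℕ.* n

spread-mono-< : ∀ {n} (p : Fin n → ℕ) i j → p i ℕ.< p j → spread p i ℕ.< spread p j
spread-mono-< {n} p i j h = ℕₚ.<-≤-trans (ℕₚ.+-monoˡ-< (p i ℕ.* n) (Finₚ.toℕ<n i))
  (ℕₚ.≤-trans (ℕₚ.*-monoˡ-≤ n h) (ℕₚ.m≤n+m (p j ℕ.* n) (toℕ j)))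

spread-injective : ∀ {n} (p : Fin n → ℕ) i j → spread p i ≡ spread p j → i ≡ j
spread-injective {suc n} p i j h = Finₚ.toℕ-injective (begin
  toℕ i ≡⟨ m<n⇒m%n≡m (Finₚ.toℕ<n i) ⟨
  toℕ i % suc n ≡⟨ [m+kn]%n≡m%n (toℕ i) (p i) (suc n) ⟨
  spread p i % suc n ≡⟨ cong (_% suc n) h ⟩
  spread p j % suc n ≡⟨ [m+kn]%n≡m%n (toℕ j) (p j) (suc n) ⟩
  toℕ j % suc n ≡⟨ m<n⇒m%n≡m (Finₚ.toℕ<n j) ⟩
  toℕ j ∎)
  where open ≡-Reasoning

double-mono-≤ : ∀ {a b} → a ℕ.≤ b → a ℕ.+ a ℕ.≤ b ℕ.+ b
double-mono-≤ h = ℕₚ.+-mono-≤ h h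

double-mono-< : ∀ {a b} → a ℕ.< b → suc (a ℕ.+ a) ℕ.< b ℕ.+ b
double-mono-< {a} {b} h = subst (ℕ._≤ b ℕ.+ b) (ℕₚ.+-suc (suc a) a) (double-mono-≤ h)

-- Up-steps jump at even times and down-steps, rotated by s, at odd times, so that they never tie.
position : ∀ {n} → (Fin n → ℕ) → (Fin n → ℕ) → ℕ → ℕ → Fin n → ℕ
position u w M s i with w i
... | zero = centre u i ℕ.+ centre u i
... | suc _ = suc (rotated w M s i ℕ.+ rotated w M s i)

position-up : ∀ {n} (u w : Fin n → ℕ) M s i → w i ≡ 0 → position u w M s i ≡ centre u i ℕ.+ centre u i
position-up u w M s i eq with w i
... | zero = refl

position-down : ∀ {n} (u w : Fin n → ℕ) M s i → 0 ℕ.< w i → position u w M s i ≡ suc (rotated w M s i ℕ.+ rotated w M s i)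
position-down u w M s i 0<w with w i
... | suc _ = refl

module Merge {n : ℕ} (u w : Fin n → ℕ) (disjoint : ∀ i → u i ≡ 0 ⊎ w i ≡ 0) (u≡w : total u ≡ total w)
  (s r : ℕ) (M≡ : s ℕ.+ suc r ≡ total w ℕ.+ total w) where

  M : ℕ
  M = total w ℕ.+ total w

  pos key : Fin n → ℕ
  pos = position u w M s
  key = spread pos

  diff : Fin n → ℤ
  diff e = + u e - + w e

  rot : Fin n → ℕ
  rot = rotated w M s

  u>0⇒w≡0 : ∀ e → 0 ℕ.< u e → w e ≡ 0
  u>0⇒w≡0 e 0<u with disjoint e
  ... | inj₁ u≡0 = ⊥-elim (ℕₚ.<-irrefl refl (subst (0 ℕ.<_) u≡0 0<u))
  ... | inj₂ w≡0 = w≡0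

  key-≤ : ∀ {e i a b} → pos e ≡ a → pos i ≡ b → a ℕ.< b → key e ℕ.≤ key i
  key-≤ {e} {i} p q h = ℕₚ.<⇒≤ (spread-mono-< pos e i (subst₂ ℕ._<_ (sym p) (sym q) h))

  key-≰ : ∀ {e i a b} → pos e ≡ a → pos i ≡ b → b ℕ.< a → ¬ key e ℕ.≤ key i
  key-≰ {e} {i} p q h = ℕₚ.<⇒≱ (spread-mono-< pos i e (subst₂ ℕ._<_ (sym q) (sym p) h))

  centre<M : ∀ q → 0 ℕ.< w q → centre w q ℕ.< M
  centre<M q 0<w = ℕₚ.<-≤-trans (ℕₚ.m<m+n _ 0<w) (centre+u≤ w q)

  s<M : s ℕ.< M
  s<M = subst (s ℕ.<_) M≡ (ℕₚ.m<m+n s (s≤s z≤n))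

  rot<M : ∀ q → 0 ℕ.< w q → rot q ℕ.< M
  rot<M q 0<w = wrap-< M _ (ℕₚ.+-mono-< (centre<M q 0<w) s<M)

  rot-injective : ∀ e i → 0 ℕ.< w e → 0 ℕ.< w i → rot e ≡ rot i → e ≡ i
  rot-injective e i 0<we 0<wi eq = centre-injective w e i 0<we
    (wrap-injective M s _ _ (centre<M e 0<we) (centre<M i 0<wi)
      (subst₂ (λ x y → wrap M x ≡ wrap M y) (ℕₚ.+-comm _ s) (ℕₚ.+-comm _ s) eq))

  prefix-split : ∀ i → + 4 * prefix key diff i ≡
    + 4 * sum (λ e → 𝟙 (key e ℕ.≤? key i) * + u e) - + 4 * sum (λ e → 𝟙 (key e ℕ.≤? key i) * + w e)
  prefix-split i = trans (cong (+ 4 *_) (trans (sum-cong-≗ (λ e → lem (𝟙 (key e ℕ.≤? key i)) (+ u e) (+ w e)))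
      (sum-- (λ e → 𝟙 (key e ℕ.≤? key i) * + u e) (λ e → 𝟙 (key e ℕ.≤? key i) * + w e)))) (lem₂ (sum (λ e → 𝟙 (key e ℕ.≤? key i) * + u e)) (sum (λ e → 𝟙 (key e ℕ.≤? key i) * + w e)))
    where
    lem : ∀ a b c → a * (b - c) ≡ a * b - a * c
    lem = solve-∀
    lem₂ : ∀ a b → + 4 * (a - b) ≡ + 4 * a - + 4 * b
    lem₂ = solve-∀

  -- At the midpoint x of the tile the up-steps total x / 2 + u / 2 and the down-steps x / 2 plus a
  -- difference of discrepancies, so the flow cancels. The term `saw w r` depends on the rotation
  -- only and serves as the common centre of all heights.
  prefix-up : ∀ i → w i ≡ 0 →
    + 4 * prefix key diff i - saw w r ≡ + 2 * + u i - saw w (wrap M (centre u i ℕ.+ r))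
  prefix-up i w≡0 = begin
    + 4 * prefix key diff i - saw w r ≡⟨ cong (_- saw w r) (prefix-split i) ⟩
    + 4 * sum (λ e → 𝟙 (key e ℕ.≤? key i) * + u e) - + 4 * sum (λ e → 𝟙 (key e ℕ.≤? key i) * + w e) - saw w r
      ≡⟨ cong₂ (λ y z → + 4 * y - + 4 * z - saw w r) (sum-cong-≗ ups) (sum-cong-≗ downs) ⟩
    + 4 * cumulative u x - + 4 * sum (λ e → 𝟙 (rot e ℕ.<? x) * + w e) - saw w r
      ≡⟨ cong₂ (λ y z → y - z - saw w r) (cumulative-centre u i) (rotated-sum M≡ w refl x x≤M) ⟩
    + 2 * + x + + 2 * + u i - (+ 2 * + x + saw w (wrap M (x ℕ.+ r)) - saw w r) - saw w r
      ≡⟨ lem (+ x) (+ u i) (saw w (wrap M (x ℕ.+ r))) (saw w r) ⟩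
    + 2 * + u i - saw w (wrap M (x ℕ.+ r)) ∎
    where
    open ≡-Reasoning
    x = centre u i
    lem : ∀ x u a b → + 2 * x + + 2 * u - (+ 2 * x + a - b) - b ≡ + 2 * u - a
    lem = solve-∀
    x≤M : x ℕ.≤ M
    x≤M = ℕₚ.≤-trans (ℕₚ.m≤m+n x (u i)) (subst (λ z → x ℕ.+ u i ℕ.≤ z ℕ.+ z) u≡w (centre+u≤ u i))
    here = position-up u w M s i w≡0
    ups : ∀ e → 𝟙 (key e ℕ.≤? key i) * + u e ≡ 𝟙 (centre u e ℕ.≤? x) * + u e
    ups e = 𝟙-*-cong (key e ℕ.≤? key i) (centre u e ℕ.≤? x) (u e) to from
      where
      there = λ 0<u → position-up u w M s e (u>0⇒w≡0 e 0<u)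
      to : 0 ℕ.< u e → key e ℕ.≤ key i → centre u e ℕ.≤ x
      to 0<u k≤ with centre u e ℕ.≤? x
      ... | yes h = h
      ... | no h = ⊥-elim (key-≰ (there 0<u) here (ℕₚ.+-mono-< (ℕₚ.≰⇒> h) (ℕₚ.≰⇒> h)) k≤)
      from : 0 ℕ.< u e → centre u e ℕ.≤ x → key e ℕ.≤ key i
      from 0<u c≤ with ℕₚ.m≤n⇒m<n∨m≡n c≤
      ... | inj₁ c< = key-≤ (there 0<u) here (ℕₚ.+-mono-< c< c<)
      ... | inj₂ c≡ = ℕₚ.≤-reflexive (cong key (centre-injective u e i 0<u c≡))
    downs : ∀ e → 𝟙 (key e ℕ.≤? key i) * + w e ≡ 𝟙 (rot e ℕ.<? x) * + w e
    downs e = 𝟙-*-cong (key e ℕ.≤? key i) (rot e ℕ.<? x) (w e) to from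
      where
      there = position-down u w M s e
      to : 0 ℕ.< w e → key e ℕ.≤ key i → rot e ℕ.< x
      to 0<w k≤ with rot e ℕ.<? x
      ... | yes h = h
      ... | no h = ⊥-elim (key-≰ (there 0<w) here (s≤s (double-mono-≤ (ℕₚ.≮⇒≥ h))) k≤)
      from : 0 ℕ.< w e → rot e ℕ.< x → key e ℕ.≤ key i
      from 0<w r< = key-≤ (there 0<w) here (double-mono-< r<)

  -- The down-step at time `x` is itself counted, so the arc of down-steps has length `suc x`.
  -- Rotated back, its far end is the centre of tile `i`, where the saw is known; only the saw of
  -- the up-steps remains.
  prefix-down : ∀ i → 0 ℕ.< w i → + 4 * prefix key diff i - saw w r ≡ saw u (rot i) - + 2 * + w i
  prefix-down i 0<wi = begin
    + 4 * prefix key diff i - saw w r ≡⟨ cong (_- saw w r) (prefix-split i) ⟩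
    + 4 * sum (λ e → 𝟙 (key e ℕ.≤? key i) * + u e) - + 4 * sum (λ e → 𝟙 (key e ℕ.≤? key i) * + w e) - saw w r
      ≡⟨ cong₂ (λ y z → + 4 * y - + 4 * z - saw w r) (sum-cong-≗ ups) (sum-cong-≗ downs) ⟩
    + 4 * cumulative u x - + 4 * sum (λ e → 𝟙 (rot e ℕ.<? suc x) * + w e) - saw w r
      ≡⟨ cong (λ z → + 4 * cumulative u x - z - saw w r) (rotated-sum M≡ w refl (suc x) (rot<M i 0<wi)) ⟩
    + 4 * cumulative u x - (+ 2 * (+ 1 + + x) + saw w (wrap M (suc x ℕ.+ r)) - saw w r) - saw w r
      ≡⟨ cong (λ z → + 4 * cumulative u x - (+ 2 * (+ 1 + + x) + z - saw w r) - saw w r) (trans (cong (saw w) unrotate) (saw-centre w i)) ⟩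
    + 4 * cumulative u x - (+ 2 * (+ 1 + + x) + (+ 2 * + w i - + 1) - saw w r) - saw w r
      ≡⟨ lem (cumulative u x) (+ x) (+ w i) (saw w r) ⟩
    saw u x - + 2 * + w i ∎
    where
    open ≡-Reasoning
    x = rot i
    lem : ∀ c x w b → + 4 * c - (+ 2 * (+ 1 + x) + (+ 2 * w - + 1) - b) - b ≡ + 4 * c - (+ 2 * x + + 1) - + 2 * w
    lem = solve-∀
    -- Adding `suc r` subtracts `s` modulo `M`. The two cases in which both or neither of the sums
    -- wrap are impossible.
    unrotate : wrap M (suc x ℕ.+ r) ≡ centre w i
    unrotate with wrap-cases M (centre w i ℕ.+ s) | wrap-cases M (suc x ℕ.+ r)
    ... | inj₂ (_ , p) | inj₁ (_ , q) = trans q (ℕₚ.+-cancelʳ-≡ s _ _ (trans (trans (regroup x r s) (cong (x ℕ.+_) M≡)) p))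
      where
      regroup : ∀ x r s → suc x ℕ.+ r ℕ.+ s ≡ x ℕ.+ (s ℕ.+ suc r)
      regroup x r s = trans (ℕₚ.+-assoc (suc x) r s) (trans (sym (ℕₚ.+-suc x (r ℕ.+ s))) (cong (x ℕ.+_) (trans (cong suc (ℕₚ.+-comm r s)) (sym (ℕₚ.+-suc s r)))))
    ... | inj₁ (_ , p) | inj₂ (_ , q) = ℕₚ.+-cancelʳ-≡ M _ _ (trans q (trans (cong (λ z → suc z ℕ.+ r) p) (trans (trans (sym (ℕₚ.+-suc (centre w i ℕ.+ s) r)) (ℕₚ.+-assoc (centre w i) s (suc r))) (cong (centre w i ℕ.+_) M≡))))
    ... | inj₁ (_ , p) | inj₁ (lt , _) = ⊥-elim (ℕₚ.<⇒≱ lt (subst (ℕ._≤ suc x ℕ.+ r) M≡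
            (subst (ℕ._≤ suc x ℕ.+ r) (sym (ℕₚ.+-suc s r)) (s≤s (ℕₚ.+-monoˡ-≤ r (subst (s ℕ.≤_) (sym p) (ℕₚ.m≤n+m s _)))))))
    ... | inj₂ (_ , p) | inj₂ (ge , _) = ⊥-elim (ℕₚ.<⇒≱ x<s (ℕₚ.+-cancelʳ-≤ (suc r) s x (subst₂ ℕ._≤_ (sym M≡) (sym (ℕₚ.+-suc x r)) ge)))
      where
      x<s : x ℕ.< s
      x<s = ℕₚ.+-cancelʳ-< M x s (subst₂ ℕ._<_ (sym p) (ℕₚ.+-comm M s) (ℕₚ.+-monoˡ-< s (centre<M i 0<wi)))
    here = position-down u w M s i 0<wi
    ups : ∀ e → 𝟙 (key e ℕ.≤? key i) * + u e ≡ 𝟙 (centre u e ℕ.≤? x) * + u e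
    ups e = 𝟙-*-cong (key e ℕ.≤? key i) (centre u e ℕ.≤? x) (u e) to from
      where
      there = λ 0<u → position-up u w M s e (u>0⇒w≡0 e 0<u)
      to : 0 ℕ.< u e → key e ℕ.≤ key i → centre u e ℕ.≤ x
      to 0<u k≤ with centre u e ℕ.≤? x
      ... | yes h = h
      ... | no h = ⊥-elim (key-≰ (there 0<u) here (double-mono-< (ℕₚ.≰⇒> h)) k≤)
      from : 0 ℕ.< u e → centre u e ℕ.≤ x → key e ℕ.≤ key i
      from 0<u c≤ = key-≤ (there 0<u) here (s≤s (double-mono-≤ c≤))
    downs : ∀ e → 𝟙 (key e ℕ.≤? key i) * + w e ≡ 𝟙 (rot e ℕ.<? suc x) * + w e
    downs e = 𝟙-*-cong (key e ℕ.≤? key i) (rot e ℕ.<? suc x) (w e) to from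
      where
      there = position-down u w M s e
      to : 0 ℕ.< w e → key e ℕ.≤ key i → rot e ℕ.< suc x
      to 0<w k≤ with rot e ℕ.<? suc x
      ... | yes h = h
      ... | no h = ⊥-elim (key-≰ (there 0<w) here (s≤s (ℕₚ.+-mono-< (ℕₚ.≮⇒≥ h) (ℕₚ.≮⇒≥ h))) k≤)
      from : 0 ℕ.< w e → rot e ℕ.< suc x → key e ℕ.≤ key i
      from 0<w r< with ℕₚ.m≤n⇒m<n∨m≡n (ℕ.s≤s⁻¹ r<)
      ... | inj₁ lt = key-≤ (there 0<w) here (s≤s (ℕₚ.+-mono-< lt lt))
      ... | inj₂ eq = ℕₚ.≤-reflexive (cong key (rot-injective e i 0<w 0<wi eq))

-- Averaging over the rotations

choose : ∀ {P : Set} → Dec P → ℤ → ℤ → ℤ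
choose (yes _) a b = a
choose (no _) a b = b

0≤choose : ∀ {P : Set} (d : Dec P) {a b} → + 0 ≤ a → + 0 ≤ b → + 0 ≤ choose d a b
0≤choose (yes _) 0≤a 0≤b = 0≤a
0≤choose (no _) 0≤a 0≤b = 0≤b

choose-+ : ∀ {P : Set} (d : Dec P) a → choose d a (+ 0) + choose d (+ 0) a ≡ a
choose-+ (yes _) a = ℤₚ.+-identityʳ a
choose-+ (no _) a = ℤₚ.+-identityˡ a

module Average {n : ℕ} (u w : Fin n → ℕ) (disjoint : ∀ i → u i ≡ 0 ⊎ w i ≡ 0) (u≡w : total u ≡ total w)
  (χ : Fin n → ℤ) (0≤χ : ∀ i → + 0 ≤ χ i) (χu : ∀ i → χ i * + u i ≡ + u i) (χw : ∀ i → χ i * + w i ≡ + w i) where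

  W M : ℕ
  W = total w
  M = W ℕ.+ W

  diff : Fin n → ℤ
  diff e = + u e - + w e

  -- Members with both parts zero count as up-steps of size zero, so that `up` and `down` always add
  -- up to `χ`.
  up down : Fin n → ℤ
  up i = choose (w i ℕ.≟ 0) (χ i) (+ 0)
  down i = choose (w i ℕ.≟ 0) (+ 0) (χ i)

  up-u : ∀ i → up i * + u i ≡ + u i
  up-u i with w i ℕ.≟ 0 | disjoint i
  ... | yes _ | _ = χu i
  ... | no _ | inj₁ u≡0 = trans (ℤₚ.*-zeroˡ (+ u i)) (cong +_ (sym u≡0))
  ... | no w≢0 | inj₂ w≡0 = ⊥-elim (w≢0 w≡0)

  down-w : ∀ i → down i * + w i ≡ + w i
  down-w i with w i ℕ.≟ 0
  ... | yes w≡0 = trans (ℤₚ.*-zeroˡ (+ w i)) (cong +_ (sym w≡0))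
  ... | no _ = χw i

  cube : ℤ → ℤ
  cube x = x * x * x

  u² u³ w² w³ P Q pairs : ℤ
  u² = sum (λ i → + u i * + u i)
  u³ = sum (λ i → + u i * + u i * + u i)
  w² = sum (λ i → + w i * + w i)
  w³ = sum (λ i → + w i * + w i * + w i)
  P = sum up
  Q = sum down
  pairs = sum (λ i → sum (λ j → up i * down j * cube (+ u i + + w j)))

  -- As `up i * u i = u i` and `down j * w j = w j`, the expanded cube separates: the mixed terms
  -- pick up the total `W` of the opposite steps, the pure cubes pick up their number.
  pairs-expand : pairs ≡ u³ * Q + + 3 * (u² * + W) + + 3 * (+ W * w²) + P * w³
  pairs-expand = begin
    pairs ≡⟨ sum-cong-≗ inner ⟩
    sum (λ i → + u i * + u i * + u i * Q + + 3 * + W * (+ u i * + u i) + + 3 * w² * + u i + up i * w³)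
      ≡⟨ trans (sum-+₄ (λ i → + u i * + u i * + u i * Q) (λ i → + 3 * + W * (+ u i * + u i)) (λ i → + 3 * w² * + u i) (λ i → up i * w³))
           (cong₄ (λ a b c d → a + b + c + d) (*-sumʳ (λ i → + u i * + u i * + u i) Q) (*-sumˡ (+ 3 * + W) (λ i → + u i * + u i)) (*-sumˡ (+ 3 * w²) (λ i → + u i)) (*-sumʳ up w³)) ⟩
    u³ * Q + + 3 * + W * u² + + 3 * w² * sum (λ i → + u i) + P * w³
      ≡⟨ cong (λ z → u³ * Q + + 3 * + W * u² + + 3 * w² * z + P * w³) (trans (sym (total-sum u)) (cong +_ u≡w)) ⟩
    u³ * Q + + 3 * + W * u² + + 3 * w² * + W + P * w³ ≡⟨ lem (u³ * Q) (+ W) u² w² (P * w³) ⟩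
    u³ * Q + + 3 * (u² * + W) + + 3 * (+ W * w²) + P * w³ ∎
    where
    open ≡-Reasoning
    lem : ∀ a W b c d → a + + 3 * W * b + + 3 * c * W + d ≡ a + + 3 * (b * W) + + 3 * (W * c) + d
    lem = solve-∀
    inner : ∀ i → sum (λ j → up i * down j * cube (+ u i + + w j)) ≡
      + u i * + u i * + u i * Q + + 3 * + W * (+ u i * + u i) + + 3 * w² * + u i + up i * w³
    inner i = begin
      sum (λ j → up i * down j * cube (+ u i + + w j)) ≡⟨ sum-cong-≗ term ⟩
      sum (λ j → u′ * u′ * u′ * down j + + 3 * (u′ * u′) * + w j + + 3 * u′ * (+ w j * + w j) + up i * (+ w j * + w j * + w j))
        ≡⟨ trans (sum-+₄ (λ j → u′ * u′ * u′ * down j) (λ j → + 3 * (u′ * u′) * + w j) (λ j → + 3 * u′ * (+ w j * + w j)) (λ j → up i * (+ w j * + w j * + w j)))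
             (cong₄ (λ a b c d → a + b + c + d) (*-sumˡ (u′ * u′ * u′) down) (*-sumˡ (+ 3 * (u′ * u′)) (λ j → + w j)) (*-sumˡ (+ 3 * u′) (λ j → + w j * + w j)) (*-sumˡ (up i) (λ j → + w j * + w j * + w j))) ⟩
      u′ * u′ * u′ * Q + + 3 * (u′ * u′) * sum (λ j → + w j) + + 3 * u′ * w² + up i * w³
        ≡⟨ cong (λ z → u′ * u′ * u′ * Q + + 3 * (u′ * u′) * z + + 3 * u′ * w² + up i * w³) (sym (total-sum w)) ⟩
      u′ * u′ * u′ * Q + + 3 * (u′ * u′) * + W + + 3 * u′ * w² + up i * w³ ≡⟨ lem₂ (u′ * u′ * u′ * Q) u′ (+ W) w² (up i * w³) ⟩
      u′ * u′ * u′ * Q + + 3 * + W * (u′ * u′) + + 3 * w² * u′ + up i * w³ ∎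
      where
      u′ = + u i
      lem₂ : ∀ a u W b c → a + + 3 * (u * u) * W + + 3 * u * b + c ≡ a + + 3 * W * (u * u) + + 3 * b * u + c
      lem₂ = solve-∀
      expand : ∀ p q u w → p * q * ((u + w) * (u + w) * (u + w)) ≡
        p * u * u * u * q + + 3 * (p * u * u) * (q * w) + + 3 * (p * u) * (q * w * w) + p * (q * w * w * w)
      expand = solve-∀
      term : ∀ j → up i * down j * cube (u′ + + w j) ≡
        u′ * u′ * u′ * down j + + 3 * (u′ * u′) * + w j + + 3 * u′ * (+ w j * + w j) + up i * (+ w j * + w j * + w j)
      term j = trans (expand (up i) (down j) u′ (+ w j))
        (cong₂ (λ a b → a * u′ * u′ * down j + + 3 * (a * u′) * b + + 3 * a * (b * + w j) + up i * (b * + w j * + w j)) (up-u i) (down-w j))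

  keys : ℕ → Fin n → ℕ
  keys s = spread (position u w M s)

  deviation² : ℕ → Fin n → ℤ
  deviation² s i = (+ 4 * prefix (keys s) diff i - saw w (M ∸ suc s)) * (+ 4 * prefix (keys s) diff i - saw w (M ∸ suc s))

  complement : ∀ {s} → s ℕ.< M → s ℕ.+ suc (M ∸ suc s) ≡ M
  complement {s} s<M = trans (ℕₚ.+-suc s (M ∸ suc s)) (ℕₚ.m+[n∸m]≡n s<M)

  -- As `s` runs through a period, so does the point at which the saw of the down-steps is read. The
  -- average is thus one over the whole saw, with the constant offset -2 u.
  sum-deviation-up : ∀ i → w i ≡ 0 → + 3 * sum {M} (λ s → deviation² (toℕ s) i) ≤ + 24 * + W * (+ u i * + u i) + + 8 * w³
  sum-deviation-up i w≡0 = begin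
    + 3 * sum {M} (λ s → deviation² (toℕ s) i) ≡⟨ cong (+ 3 *_) (sum-cong-≗ {M} rewritten) ⟩
    + 3 * sum {M} (λ s → g (wrap M (centre u i ℕ.+ (M ∸ suc (toℕ s)))))
      ≤⟨ *-monoˡ-≤-0≤ (0≤+ 3) (sum-injective {M} (λ s → wrap M (centre u i ℕ.+ (M ∸ suc s))) bounded injective g (λ t → 0≤a² (k + saw w t))) ⟩
    + 3 * sum {M} (g ∘ toℕ) ≤⟨ saw-squares w k ⟩
    + 6 * + W * k * k + + 8 * w³ ≡⟨ lem₂ (+ W) (+ u i) w³ ⟩
    + 24 * + W * (+ u i * + u i) + + 8 * w³ ∎
    where
    open ℤₚ.≤-Reasoning
    k = - (+ 2 * + u i)
    g : ℕ → ℤ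
    g t = (k + saw w t) * (k + saw w t)
    lem₂ : ∀ W u c → + 6 * W * (- (+ 2 * u)) * (- (+ 2 * u)) + + 8 * c ≡ + 24 * W * (u * u) + + 8 * c
    lem₂ = solve-∀
    lem : ∀ a b → (a - b) * (a - b) ≡ (- a + b) * (- a + b)
    lem = solve-∀
    rewritten : ∀ (s : Fin M) → deviation² (toℕ s) i ≡ g (wrap M (centre u i ℕ.+ (M ∸ suc (toℕ s))))
    rewritten s = trans (cong (λ z → z * z) (Merge.prefix-up u w disjoint u≡w (toℕ s) (M ∸ suc (toℕ s)) (complement (Finₚ.toℕ<n s)) i w≡0))
      (lem (+ 2 * + u i) (saw w (wrap M (centre u i ℕ.+ (M ∸ suc (toℕ s))))))
    x≤M : centre u i ℕ.≤ M
    x≤M = ℕₚ.≤-trans (ℕₚ.m≤m+n _ (u i)) (subst (λ z → centre u i ℕ.+ u i ℕ.≤ z ℕ.+ z) u≡w (centre+u≤ u i))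
    r<M : ∀ s → s ℕ.< M → M ∸ suc s ℕ.< M
    r<M s s<M = subst (suc (M ∸ suc s) ℕ.≤_) (complement s<M) (ℕₚ.m≤n+m _ s)
    bounded : ∀ s → s ℕ.< M → wrap M (centre u i ℕ.+ (M ∸ suc s)) ℕ.< M
    bounded s s<M = wrap-< M _ (ℕₚ.+-mono-≤-< x≤M (r<M s s<M))
    injective : ∀ s t → s ℕ.< M → t ℕ.< M → wrap M (centre u i ℕ.+ (M ∸ suc s)) ≡ wrap M (centre u i ℕ.+ (M ∸ suc t)) → s ≡ t
    injective s t s<M t<M eq = ℕₚ.suc-injective (ℕₚ.∸-cancelˡ-≡ s<M t<M (wrap-injective M (centre u i) _ _ (r<M s s<M) (r<M t t<M) eq))

  sum-deviation-down : ∀ i → 0 ℕ.< w i → + 3 * sum {M} (λ s → deviation² (toℕ s) i) ≤ + 24 * + W * (+ w i * + w i) + + 8 * u³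
  sum-deviation-down i 0<w = begin
    + 3 * sum {M} (λ s → deviation² (toℕ s) i) ≡⟨ cong (+ 3 *_) (sum-cong-≗ {M} rewritten) ⟩
    + 3 * sum {M} (λ s → g (wrap M (centre w i ℕ.+ toℕ s)))
      ≤⟨ *-monoˡ-≤-0≤ (0≤+ 3) (sum-injective {M} (λ s → wrap M (centre w i ℕ.+ s)) bounded (λ s t s< t< → wrap-injective M (centre w i) s t s< t<) g (λ t → 0≤a² (k + saw u t))) ⟩
    + 3 * sum {M} (g ∘ toℕ) ≡⟨ cong (λ z → + 3 * sum {z ℕ.+ z} (g ∘ toℕ)) u≡w ⟨
    + 3 * sum {total u ℕ.+ total u} (g ∘ toℕ) ≤⟨ saw-squares u k ⟩
    + 6 * + total u * k * k + + 8 * u³ ≡⟨ cong (λ z → + 6 * + z * k * k + + 8 * u³) u≡w ⟩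
    + 6 * + W * k * k + + 8 * u³ ≡⟨ lem₂ (+ W) (+ w i) u³ ⟩
    + 24 * + W * (+ w i * + w i) + + 8 * u³ ∎
    where
    open ℤₚ.≤-Reasoning
    k = - (+ 2 * + w i)
    g : ℕ → ℤ
    g t = (k + saw u t) * (k + saw u t)
    lem₂ : ∀ W u c → + 6 * W * (- (+ 2 * u)) * (- (+ 2 * u)) + + 8 * c ≡ + 24 * W * (u * u) + + 8 * c
    lem₂ = solve-∀
    lem : ∀ a b → (a - b) * (a - b) ≡ (- b + a) * (- b + a)
    lem = solve-∀
    rewritten : ∀ (s : Fin M) → deviation² (toℕ s) i ≡ g (wrap M (centre w i ℕ.+ toℕ s))
    rewritten s = trans (cong (λ z → z * z) (Merge.prefix-down u w disjoint u≡w (toℕ s) (M ∸ suc (toℕ s)) (complement (Finₚ.toℕ<n s)) i 0<w))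
      (lem (saw u (wrap M (centre w i ℕ.+ toℕ s))) (+ 2 * + w i))
    bounded : ∀ s → s ℕ.< M → wrap M (centre w i ℕ.+ s) ℕ.< M
    bounded s s<M = wrap-< M _ (ℕₚ.+-mono-< (ℕₚ.<-≤-trans (ℕₚ.m<m+n _ 0<w) (centre+u≤ w i)) s<M)

  sum-deviation : ∀ i → χ i * (+ 3 * sum {M} (λ s → deviation² (toℕ s) i)) ≤
    + 24 * + W * (+ u i * + u i) + up i * (+ 8 * w³) + + 24 * + W * (+ w i * + w i) + down i * (+ 8 * u³)
  sum-deviation i = bound (w i ℕ.≟ 0) (up-u i) (down-w i)
    where
    D = + 3 * sum {M} (λ s → deviation² (toℕ s) i)
    lem-up : ∀ c W u a d v → W * (c * u * u) + c * (+ 8 * a) + W * (v * v) + + 0 * d ≡ c * (W * (u * u) + + 8 * a) + W * (v * v)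
    lem-up = solve-∀
    lem-down : ∀ c W v a d x → W * (x * x) + + 0 * d + W * (c * v * v) + c * (+ 8 * a) ≡ c * (W * (v * v) + + 8 * a) + W * (x * x)
    lem-down = solve-∀
    0≤Wxx : ∀ x → + 0 ≤ + 24 * + W * (x * x)
    0≤Wxx x = 0≤a*b (0≤a*b (0≤+ 24) (0≤+ W)) (0≤a² x)
    bound : (d : Dec (w i ≡ 0)) → choose d (χ i) (+ 0) * + u i ≡ + u i → choose d (+ 0) (χ i) * + w i ≡ + w i →
      χ i * D ≤ + 24 * + W * (+ u i * + u i) + choose d (χ i) (+ 0) * (+ 8 * w³) + + 24 * + W * (+ w i * + w i) + choose d (+ 0) (χ i) * (+ 8 * u³)
    bound (yes w≡0) p _ = ℤₚ.≤-trans (*-monoˡ-≤-0≤ (0≤χ i) (sum-deviation-up i w≡0))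
      (≤-from-gap (+ 24 * + W * (+ w i * + w i)) (0≤Wxx (+ w i))
        (trans (cong (λ z → + 24 * + W * (z * + u i) + χ i * (+ 8 * w³) + + 24 * + W * (+ w i * + w i) + + 0 * (+ 8 * u³)) (sym p))
          (lem-up (χ i) (+ 24 * + W) (+ u i) w³ (+ 8 * u³) (+ w i))))
    bound (no w≢0) _ q = ℤₚ.≤-trans (*-monoˡ-≤-0≤ (0≤χ i) (sum-deviation-down i (ℕₚ.n≢0⇒n>0 w≢0)))
      (≤-from-gap (+ 24 * + W * (+ u i * + u i)) (0≤Wxx (+ u i))
        (trans (cong (λ z → + 24 * + W * (+ u i * + u i) + + 0 * (+ 8 * w³) + + 24 * + W * (z * + w i) + χ i * (+ 8 * u³)) (sym q))
          (lem-down (χ i) (+ 24 * + W) (+ w i) u³ (+ 8 * w³) (+ u i))))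

  -- The bounds for the single terms add up to eight times the expansion of `pairs`: offsets give
  -- the mixed terms, saws the pure cubes.
  total-deviation : + 3 * sum {M} (λ s → sum (λ i → χ i * deviation² (toℕ s) i)) ≤ + 8 * pairs
  total-deviation = begin
    + 3 * sum {M} (λ s → sum (λ i → χ i * deviation² (toℕ s) i)) ≡⟨ cong (+ 3 *_) (∑-comm {M} {n} (λ s i → χ i * deviation² (toℕ s) i)) ⟩
    + 3 * sum (λ i → sum {M} (λ s → χ i * deviation² (toℕ s) i)) ≡⟨ cong (+ 3 *_) (sum-cong-≗ (λ i → *-sumˡ {M} (χ i) (λ s → deviation² (toℕ s) i))) ⟩
    + 3 * sum (λ i → χ i * sum {M} (λ s → deviation² (toℕ s) i)) ≡⟨ *-sumˡ (+ 3) (λ i → χ i * sum {M} (λ s → deviation² (toℕ s) i)) ⟨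
    sum (λ i → + 3 * (χ i * sum {M} (λ s → deviation² (toℕ s) i))) ≡⟨ sum-cong-≗ (λ i → lem (χ i) (sum {M} (λ s → deviation² (toℕ s) i))) ⟩
    sum (λ i → χ i * (+ 3 * sum {M} (λ s → deviation² (toℕ s) i))) ≤⟨ sum-mono sum-deviation ⟩
    sum (λ i → + 24 * + W * (+ u i * + u i) + up i * (+ 8 * w³) + + 24 * + W * (+ w i * + w i) + down i * (+ 8 * u³))
      ≡⟨ trans (sum-+₄ (λ i → + 24 * + W * (+ u i * + u i)) (λ i → up i * (+ 8 * w³)) (λ i → + 24 * + W * (+ w i * + w i)) (λ i → down i * (+ 8 * u³)))
           (cong₄ (λ a b c d → a + b + c + d) (*-sumˡ (+ 24 * + W) (λ i → + u i * + u i)) (*-sumʳ up (+ 8 * w³)) (*-sumˡ (+ 24 * + W) (λ i → + w i * + w i)) (*-sumʳ down (+ 8 * u³))) ⟩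
    + 24 * + W * u² + P * (+ 8 * w³) + + 24 * + W * w² + Q * (+ 8 * u³) ≡⟨ lem₂ (+ W) u² P w³ w² Q u³ ⟩
    + 8 * (u³ * Q + + 3 * (u² * + W) + + 3 * (+ W * w²) + P * w³) ≡⟨ cong (+ 8 *_) pairs-expand ⟨
    + 8 * pairs ∎
    where
    open ℤₚ.≤-Reasoning
    lem : ∀ a b → + 3 * (a * b) ≡ a * (+ 3 * b)
    lem = solve-∀
    lem₂ : ∀ W a P b c Q d → + 24 * W * a + P * (+ 8 * b) + + 24 * W * c + Q * (+ 8 * d) ≡ + 8 * (d * Q + + 3 * (a * W) + + 3 * (W * c) + P * b)
    lem₂ = solve-∀

  weighted-deviation : ℕ → ℤ
  weighted-deviation s = sum (λ i → χ i * deviation² s i)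

  rescale : ∀ s → + M * weighted-deviation s ≤ sum {M} (weighted-deviation ∘ toℕ) → + 3 * + W * weighted-deviation s ≤ + 4 * pairs
  rescale s h = *-cancelˡ-≤-0< (+ 2) (+<+ (s≤s z≤n)) (begin
      + 2 * (+ 3 * + W * S) ≡⟨ lem (+ W) S ⟩
      + 3 * ((+ W + + W) * S) ≤⟨ *-monoˡ-≤-0≤ (0≤+ 3) h ⟩
      + 3 * sum {M} (weighted-deviation ∘ toℕ) ≤⟨ total-deviation ⟩
      + 8 * pairs ≡⟨ lem₂ pairs ⟩
      + 2 * (+ 4 * pairs) ∎)
    where
    open ℤₚ.≤-Reasoning
    S = weighted-deviation s
    lem : ∀ W S → + 2 * (+ 3 * W * S) ≡ + 3 * ((W + W) * S)
    lem = solve-∀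
    lem₂ : ∀ p → + 8 * p ≡ + 2 * (+ 4 * p)
    lem₂ = solve-∀

  balanced-order : 0 ℕ.< W → Σ (Fin n → ℕ) λ K → (∀ i j → K i ≡ K j → i ≡ j) × Σ ℤ λ c →
    + 3 * + W * sum (λ i → χ i * ((+ 4 * prefix K diff i - c) * (+ 4 * prefix K diff i - c))) ≤ + 4 * pairs
  balanced-order 0<W = let s , _ , h = ∃-below-average M (ℕₚ.<-≤-trans 0<W (ℕₚ.m≤m+n W W)) weighted-deviation in
    keys s , spread-injective (position u w M s) , saw w (M ∸ suc s) , rescale s h

-- Balanced orders of steps in a half-plane

positivePart negativePart : ℤ → ℕ
positivePart (+ n) = n
positivePart -[1+ n ] = 0
negativePart (+ n) = 0
negativePart -[1+ n ] = suc n

parts : ∀ y → + positivePart y - + negativePart y ≡ y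
parts (+ n) = ℤₚ.+-identityʳ (+ n)
parts -[1+ n ] = refl

parts-disjoint : ∀ y → positivePart y ≡ 0 ⊎ negativePart y ≡ 0
parts-disjoint (+ n) = inj₂ refl
parts-disjoint -[1+ n ] = inj₁ refl

total≡0 : ∀ {n} (w : Fin n → ℕ) → total w ≡ 0 → ∀ i → w i ≡ 0
total≡0 w eq zero = ℕₚ.m+n≡0⇒m≡0 (w zero) eq
total≡0 w eq (suc i) = total≡0 (w ∘ suc) (ℕₚ.m+n≡0⇒n≡0 (w zero) eq) i

-- For each pair of an up-step and a down-step, ℓ is the length of the chord joining them and g its
-- moment; the cubic is nonnegative on 0 ≤ ℓ ≤ 3mL by the bounds g ≤ mℓ (for ℓ ≤ 2mL) and g ≤ 2m²L.
chord-inequality : ∀ m L ℓ g → + 0 ≤ m → + 0 ≤ L → + 0 ≤ ℓ → ℓ ≤ + 3 * m * L → g ≤ m * ℓ → g ≤ + 2 * m * m * L →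
  + 4 * (ℓ * ℓ * ℓ) + + 80 * m * L * L * g ≤ + 96 * m * m * L * L * ℓ
chord-inequality m L ℓ g 0≤m 0≤L 0≤ℓ ℓ≤ g≤mℓ g≤ = [ short , long ]′ (ℤₚ.≤-total ℓ (+ 2 * (m * L)))
  where
  goal = + 4 * (ℓ * ℓ * ℓ) + + 80 * m * L * L * g ≤ + 96 * m * m * L * L * ℓ
  0≤mL : + 0 ≤ m * L
  0≤mL = 0≤a*b {m} {L} 0≤m 0≤L
  0≤mLL : + 0 ≤ m * L * L
  0≤mLL = 0≤a*b {m * L} {L} 0≤mL 0≤L
  scale : ∀ n {a b} → + 0 ≤ a → + 0 ≤ b → + 0 ≤ + n * (a * b)
  scale n {a} {b} p q = 0≤a*b {+ n} {a * b} (0≤+ n) (0≤a*b {a} {b} p q)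
  short : ℓ ≤ + 2 * (m * L) → goal
  short h = ≤-from-gap (+ 80 * (m * L * L * (m * ℓ - g)) + + 4 * (ℓ * (+ 2 * (m * L) - ℓ) * (+ 2 * (m * L) + ℓ)))
      (0≤a+b (scale 80 {m * L * L} {m * ℓ - g} 0≤mLL (0≤b-a g≤mℓ))
        (scale 4 {ℓ * (+ 2 * (m * L) - ℓ)} {+ 2 * (m * L) + ℓ} (0≤a*b {ℓ} {+ 2 * (m * L) - ℓ} 0≤ℓ (0≤b-a h)) (0≤a+b {+ 2 * (m * L)} {ℓ} (0≤a*b {+ 2} {m * L} (0≤+ 2) 0≤mL) 0≤ℓ)))
      (arith m L ℓ g)
    where
    arith : ∀ m L ℓ g → + 96 * m * m * L * L * ℓ ≡ + 4 * (ℓ * ℓ * ℓ) + + 80 * m * L * L * g +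
      (+ 80 * (m * L * L * (m * ℓ - g)) + + 4 * (ℓ * (+ 2 * (m * L) - ℓ) * (+ 2 * (m * L) + ℓ)))
    arith = solve-∀
  long : + 2 * (m * L) ≤ ℓ → goal
  long h = ≤-from-gap (+ 80 * (m * L * L * (+ 2 * m * m * L - g)) + + 4 * ((ℓ - + 2 * (m * L)) * factor))
      (0≤a+b (scale 80 {m * L * L} {+ 2 * m * m * L - g} 0≤mLL (0≤b-a g≤)) (scale 4 {ℓ - + 2 * (m * L)} {factor} (0≤b-a h) 0≤factor))
      (arith m L ℓ g)
    where
    factor = (+ 3 * m * L - ℓ) * (ℓ + + 5 * (m * L)) + + 5 * (m * L * (m * L))
    0≤factor : + 0 ≤ factor
    0≤factor = 0≤a+b {(+ 3 * m * L - ℓ) * (ℓ + + 5 * (m * L))} {+ 5 * (m * L * (m * L))}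
      (0≤a*b {+ 3 * m * L - ℓ} {ℓ + + 5 * (m * L)} (0≤b-a ℓ≤) (0≤a+b {ℓ} {+ 5 * (m * L)} 0≤ℓ (0≤a*b {+ 5} {m * L} (0≤+ 5) 0≤mL)))
      (scale 5 {m * L} {m * L} 0≤mL 0≤mL)
    arith : ∀ m L ℓ g → + 96 * m * m * L * L * ℓ ≡ + 4 * (ℓ * ℓ * ℓ) + + 80 * m * L * L * g +
      (+ 80 * (m * L * L * (+ 2 * m * m * L - g)) + + 4 * ((ℓ - + 2 * (m * L)) * ((+ 3 * m * L - ℓ) * (ℓ + + 5 * (m * L)) + + 5 * (m * L * (m * L)))))
    arith = solve-∀

module Chain {n : ℕ} {A : Fin n → Set} (A? : ∀ i → Dec (A i)) (m : ℕ) (f y : Fin n → ℤ)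
  (0≤f : ∀ i → A i → + 0 ≤ f i) (f≤m : ∀ i → A i → f i ≤ + m)
  (y-outside : ∀ i → ¬ A i → y i ≡ + 0) (∑y≡0 : sum y ≡ + 0) where

  χ : Fin n → ℤ
  χ i = 𝟙 (A? i)

  L N : ℤ
  L = sum (λ i → χ i * f i)
  N = sum χ

  u w : Fin n → ℕ
  u = positivePart ∘ y
  w = negativePart ∘ y

  y≡ : ∀ i → + u i - + w i ≡ y i
  y≡ i = parts (y i)

  u≡w : total u ≡ total w
  u≡w = ℤₚ.+-injective (ℤₚ.i-j≡0⇒i≡j (+ total u) (+ total w)
    (trans (cong₂ _-_ (total-sum u) (total-sum w)) (trans (sym (sum-- (λ i → + u i) (λ i → + w i))) (trans (sum-cong-≗ y≡) ∑y≡0))))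

  0≤χ : ∀ i → + 0 ≤ χ i
  0≤χ i = 0≤𝟙 (A? i)

  χ-positivePart : ∀ i → χ i * + u i ≡ + u i
  χ-positivePart i with A? i
  ... | yes _ = ℤₚ.*-identityˡ _
  ... | no ¬a = trans (ℤₚ.*-zeroˡ (+ u i)) (cong (λ z → + positivePart z) (sym (y-outside i ¬a)))

  χ-negativePart : ∀ i → χ i * + w i ≡ + w i
  χ-negativePart i with A? i
  ... | yes _ = ℤₚ.*-identityˡ _
  ... | no ¬a = trans (ℤₚ.*-zeroˡ (+ w i)) (cong (λ z → + negativePart z) (sym (y-outside i ¬a)))

  open Average u w (parts-disjoint ∘ y) u≡w χ 0≤χ χ-positivePart χ-negativePart

  0≤L : + 0 ≤ L
  0≤L = 0≤sum term
    where
    term : ∀ i → + 0 ≤ χ i * f i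
    term i with A? i
    ... | yes a = subst (+ 0 ≤_) (sym (ℤₚ.*-identityˡ (f i))) (0≤f i a)
    ... | no _ = ℤₚ.≤-reflexive (sym (ℤₚ.*-zeroˡ (f i)))

  0≤N : + 0 ≤ N
  0≤N = 0≤sum 0≤χ

  L≤Nm : L ≤ N * + m
  L≤Nm = ℤₚ.≤-trans (sum-mono term) (ℤₚ.≤-reflexive (*-sumʳ χ (+ m)))
    where
    term : ∀ i → χ i * f i ≤ χ i * + m
    term i with A? i
    ... | yes a = *-monoˡ-≤-0≤ (0≤+ 1) (f≤m i a)
    ... | no _ = ℤₚ.≤-reflexive (trans (ℤₚ.*-zeroˡ (f i)) (sym (ℤₚ.*-zeroˡ (+ m))))

  up+down : ∀ i → up i + down i ≡ χ i
  up+down i = choose-+ (w i ℕ.≟ 0) (χ i)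

  -- Each up-step meets `Q` down-steps and each down-step meets `P` up-steps, both kinds have total
  -- `W`, and `P + Q` is `N`.
  length-sum : sum (λ i → sum (λ j → up i * down j * (+ u i + + w j))) ≡ N * + W
  length-sum = begin
    sum (λ i → sum (λ j → up i * down j * (+ u i + + w j))) ≡⟨ sum-cong-≗ inner ⟩
    sum (λ i → + u i * Q + up i * + W) ≡⟨ sum-+ (λ i → + u i * Q) (λ i → up i * + W) ⟩
    sum (λ i → + u i * Q) + sum (λ i → up i * + W) ≡⟨ cong₂ _+_ (*-sumʳ (λ i → + u i) Q) (*-sumʳ up (+ W)) ⟩
    sum (λ i → + u i) * Q + P * + W ≡⟨ cong (λ z → z * Q + P * + W) (trans (sym (total-sum u)) (cong +_ u≡w)) ⟩
    + W * Q + P * + W ≡⟨ lem (+ W) Q P ⟩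
    (P + Q) * + W ≡⟨ cong (_* + W) (trans (sym (sum-+ up down)) (sum-cong-≗ up+down)) ⟩
    N * + W ∎
    where
    open ≡-Reasoning
    lem : ∀ W Q P → W * Q + P * W ≡ (P + Q) * W
    lem = solve-∀
    expand : ∀ p q u w → p * q * (u + w) ≡ p * u * q + p * (q * w)
    expand = solve-∀
    inner : ∀ i → sum (λ j → up i * down j * (+ u i + + w j)) ≡ + u i * Q + up i * + W
    inner i = begin
      sum (λ j → up i * down j * (+ u i + + w j)) ≡⟨ sum-cong-≗ (λ j → trans (expand (up i) (down j) (+ u i) (+ w j)) (cong₂ (λ a b → a * down j + up i * b) (up-u i) (down-w j))) ⟩
      sum (λ j → + u i * down j + up i * + w j) ≡⟨ sum-+ (λ j → + u i * down j) (λ j → up i * + w j) ⟩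
      sum (λ j → + u i * down j) + sum (λ j → up i * + w j) ≡⟨ cong₂ _+_ (*-sumˡ (+ u i) down) (*-sumˡ (up i) (λ j → + w j)) ⟩
      + u i * Q + up i * sum (λ j → + w j) ≡⟨ cong (λ z → + u i * Q + up i * z) (sym (total-sum w)) ⟩
      + u i * Q + up i * + W ∎

  -- The chord from (f i , u i) to (f j , - w j) meets the axis at the abscissa `moment i j` / (u i
  -- + w j). Up to sign the moment is the determinant of these two vectors, which is why `det-bound`
  -- bounds it.
  moment : Fin n → Fin n → ℤ
  moment i j = f i * + w j + f j * + u i

  moment-sum : sum (λ i → sum (λ j → up i * down j * moment i j)) ≡ L * + W
  moment-sum = begin
    sum (λ i → sum (λ j → up i * down j * moment i j)) ≡⟨ sum-cong-≗ inner ⟩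
    sum (λ i → up i * f i * + W + + u i * sum (λ j → down j * f j)) ≡⟨ sum-+ (λ i → up i * f i * + W) (λ i → + u i * sum (λ j → down j * f j)) ⟩
    sum (λ i → up i * f i * + W) + sum (λ i → + u i * sum (λ j → down j * f j))
      ≡⟨ cong₂ _+_ (*-sumʳ (λ i → up i * f i) (+ W)) (*-sumʳ (λ i → + u i) (sum (λ j → down j * f j))) ⟩
    sum (λ i → up i * f i) * + W + sum (λ i → + u i) * sum (λ j → down j * f j)
      ≡⟨ cong (λ z → sum (λ i → up i * f i) * + W + z * sum (λ j → down j * f j)) (trans (sym (total-sum u)) (cong +_ u≡w)) ⟩
    sum (λ i → up i * f i) * + W + + W * sum (λ j → down j * f j) ≡⟨ lem (sum (λ i → up i * f i)) (+ W) (sum (λ j → down j * f j)) ⟩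
    (sum (λ i → up i * f i) + sum (λ j → down j * f j)) * + W
      ≡⟨ cong (_* + W) (trans (sym (sum-+ (λ i → up i * f i) (λ i → down i * f i)))
           (sum-cong-≗ (λ i → trans (sym (ℤₚ.*-distribʳ-+ (f i) (up i) (down i))) (cong (_* f i) (up+down i))))) ⟩
    L * + W ∎
    where
    open ≡-Reasoning
    lem : ∀ a W b → a * W + W * b ≡ (a + b) * W
    lem = solve-∀
    expand : ∀ p q f w f′ u → p * q * (f * w + f′ * u) ≡ p * f * (q * w) + p * u * (q * f′)
    expand = solve-∀
    inner : ∀ i → sum (λ j → up i * down j * moment i j) ≡ up i * f i * + W + + u i * sum (λ j → down j * f j)
    inner i = begin
      sum (λ j → up i * down j * moment i j) ≡⟨ sum-cong-≗ (λ j → trans (expand (up i) (down j) (f i) (+ w j) (f j) (+ u i)) (cong₂ (λ a b → up i * f i * b + a * (down j * f j)) (up-u i) (down-w j))) ⟩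
      sum (λ j → up i * f i * + w j + + u i * (down j * f j)) ≡⟨ sum-+ (λ j → up i * f i * + w j) (λ j → + u i * (down j * f j)) ⟩
      sum (λ j → up i * f i * + w j) + sum (λ j → + u i * (down j * f j)) ≡⟨ cong₂ _+_ (*-sumˡ (up i * f i) (λ j → + w j)) (*-sumˡ (+ u i) (λ j → down j * f j)) ⟩
      up i * f i * sum (λ j → + w j) + + u i * sum (λ j → down j * f j) ≡⟨ cong (λ z → up i * f i * z + + u i * sum (λ j → down j * f j)) (sym (total-sum w)) ⟩
      up i * f i * + W + + u i * sum (λ j → down j * f j) ∎

  0≤up : ∀ i → + 0 ≤ up i
  0≤up i = 0≤choose (w i ℕ.≟ 0) (0≤χ i) ℤₚ.≤-refl

  0≤down : ∀ i → + 0 ≤ down i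
  0≤down i = 0≤choose (w i ℕ.≟ 0) ℤₚ.≤-refl (0≤χ i)

  0≤up*down : ∀ i j → + 0 ≤ up i * down j
  0≤up*down i j = 0≤a*b {up i} {down j} (0≤up i) (0≤down j)

  up*down-support : ∀ i j → up i * down j ≡ + 0 ⊎ (A i × A j × w i ≡ 0 × w j ≢ 0)
  up*down-support i j = decide (A? i) (A? j) (w i ℕ.≟ 0) (w j ℕ.≟ 0)
    where
    decide : (a : Dec (A i)) (b : Dec (A j)) (p : Dec (w i ≡ 0)) (q : Dec (w j ≡ 0)) →
      choose p (𝟙 a) (+ 0) * choose q (+ 0) (𝟙 b) ≡ + 0 ⊎ (A i × A j × w i ≡ 0 × w j ≢ 0)
    decide (yes a) (yes b) (yes p) (no q) = inj₂ (a , b , p , q)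
    decide a b (no _) q = inj₁ (ℤₚ.*-zeroˡ (choose q (+ 0) (𝟙 b)))
    decide a b (yes _) (yes _) = inj₁ (ℤₚ.*-zeroʳ (𝟙 a))
    decide (no _) b (yes _) (no _) = inj₁ (ℤₚ.*-zeroˡ (𝟙 b))
    decide (yes _) (no _) (yes _) (no _) = inj₁ refl

  module _ (y-gap : ∀ i j → A i → A j → y i - y j ≤ + 3 * + m * L)
    (det-bound : ∀ i j → A i → A j → f j * y i - f i * y j ≤ + 2 * + m * + m * L) where

    -- The hypotheses of the cubic inequality come from `y-gap` for the length, from f ≤ m at both
    -- ends for the crossing abscissa, and from `det-bound` for the moment.
    chord : ∀ i j → A i → A j → w i ≡ 0 → w j ≢ 0 →
      + 4 * cube (+ u i + + w j) + + 80 * + m * L * L * moment i j ≤ + 96 * + m * + m * L * L * (+ u i + + w j)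
    chord i j a b wi≡0 wj≢0 = chord-inequality (+ m) L (+ u i + + w j) (moment i j) (0≤+ m) 0≤L (0≤+ _)
        (subst (_≤ + 3 * + m * L) (trans (cong₂ _-_ yi yj) (lem (+ u i) (+ w j))) (y-gap i j a b))
        (≤-from-gap _ (0≤a+b (0≤a*b (0≤b-a (f≤m i a)) (0≤+ (w j))) (0≤a*b (0≤b-a (f≤m j b)) (0≤+ (u i)))) (lem₂ (+ m) (f i) (f j) (+ u i) (+ w j)))
        (subst (_≤ + 2 * + m * + m * L) (trans (cong₂ (λ y z → f j * y - f i * z) yi yj) (lem₃ (f i) (f j) (+ u i) (+ w j))) (det-bound i j a b))
      where
      uj≡0 : u j ≡ 0
      uj≡0 = fromInj₁ (λ wj≡0 → ⊥-elim (wj≢0 wj≡0)) (parts-disjoint (y j))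
      yi : y i ≡ + u i
      yi = trans (sym (y≡ i)) (trans (cong (λ z → + u i - + z) wi≡0) (ℤₚ.+-identityʳ _))
      yj : y j ≡ - + w j
      yj = trans (sym (y≡ j)) (trans (cong (λ z → + z - + w j) uj≡0) (ℤₚ.+-identityˡ _))
      lem : ∀ u w → u - - w ≡ u + w
      lem = solve-∀
      lem₂ : ∀ m f f′ u w → m * (u + w) ≡ f * w + f′ * u + ((m - f) * w + (m - f′) * u)
      lem₂ = solve-∀
      lem₃ : ∀ f f′ u w → f′ * u - f * - w ≡ f * w + f′ * u
      lem₃ = solve-∀

    chord-term : ∀ i j → up i * down j * (+ 4 * cube (+ u i + + w j) + + 80 * + m * L * L * moment i j) ≤
      up i * down j * (+ 96 * + m * + m * L * L * (+ u i + + w j))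
    chord-term i j = [ (λ z → ℤₚ.≤-reflexive (trans (vanish z) (sym (vanish z)))) ,
        (λ (a , b , p , q) → *-monoˡ-≤-0≤ (0≤up*down i j) (chord i j a b p q)) ]′ (up*down-support i j)
      where
      vanish : up i * down j ≡ + 0 → ∀ {x} → up i * down j * x ≡ + 0
      vanish z {x} = trans (cong (_* x) z) (ℤₚ.*-zeroˡ x)

    chord-sum : + 4 * pairs + + 80 * + m * L * L * (L * + W) ≤ + 96 * + m * + m * L * L * (N * + W)
    chord-sum = begin
      + 4 * pairs + a * (L * + W) ≡⟨ cong₂ (λ y z → y + a * z) (sym (sum-sum-*ˡ (+ 4) (λ i j → up i * down j * cube (+ u i + + w j)))) (sym moment-sum) ⟩
      sum (λ i → sum (λ j → + 4 * (up i * down j * cube (+ u i + + w j)))) + a * sum (λ i → sum (λ j → up i * down j * moment i j))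
        ≡⟨ cong (λ z → sum (λ i → sum (λ j → + 4 * (up i * down j * cube (+ u i + + w j)))) + z) (sym (sum-sum-*ˡ a (λ i j → up i * down j * moment i j))) ⟩
      sum (λ i → sum (λ j → + 4 * (up i * down j * cube (+ u i + + w j)))) + sum (λ i → sum (λ j → a * (up i * down j * moment i j)))
        ≡⟨ sum-sum-+ (λ i j → + 4 * (up i * down j * cube (+ u i + + w j))) (λ i j → a * (up i * down j * moment i j)) ⟨
      sum (λ i → sum (λ j → + 4 * (up i * down j * cube (+ u i + + w j)) + a * (up i * down j * moment i j)))
        ≡⟨ sum-sum-cong (λ i j → lem (up i * down j) (cube (+ u i + + w j)) a (moment i j)) ⟩
      sum (λ i → sum (λ j → up i * down j * (+ 4 * cube (+ u i + + w j) + a * moment i j))) ≤⟨ sum-sum-mono chord-term ⟩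
      sum (λ i → sum (λ j → up i * down j * (b * (+ u i + + w j)))) ≡⟨ sum-sum-cong (λ i j → lem₂ (up i * down j) b (+ u i + + w j)) ⟩
      sum (λ i → sum (λ j → b * (up i * down j * (+ u i + + w j)))) ≡⟨ sum-sum-*ˡ b (λ i j → up i * down j * (+ u i + + w j)) ⟩
      b * sum (λ i → sum (λ j → up i * down j * (+ u i + + w j))) ≡⟨ cong (b *_) length-sum ⟩
      b * (N * + W) ∎
      where
      open ℤₚ.≤-Reasoning
      a = + 80 * + m * L * L
      b = + 96 * + m * + m * L * L
      lem : ∀ p c a g → + 4 * (p * c) + a * (p * g) ≡ p * (+ 4 * c + a * g)
      lem = solve-∀
      lem₂ : ∀ p b c → p * (b * c) ≡ b * (p * c)
      lem₂ = solve-∀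

    prefix-y : ∀ K i → prefix K diff i ≡ prefix K y i
    prefix-y K i = sum-cong-≗ (λ e → cong (𝟙 (K e ℕ.≤? K i) *_) (y≡ e))

    deviation : (Fin n → ℕ) → ℤ → ℤ
    deviation K c = sum (λ i → χ i * ((+ 4 * prefix K y i - c) * (+ 4 * prefix K y i - c)))

    flat : total w ≡ 0 → deviation toℕ (+ 0) ≡ + 0
    flat W≡0 = sum-0 _ (λ i → trans (cong (λ z → χ i * ((+ 4 * z - + 0) * (+ 4 * z - + 0))) (still i)) (ℤₚ.*-zeroʳ (χ i)))
      where
      still : ∀ i → prefix toℕ y i ≡ + 0
      still i = sum-0 _ (λ e → trans (cong (𝟙 (toℕ e ℕ.≤? toℕ i) *_)
        (trans (sym (y≡ e)) (cong₂ (λ a b → + a - + b) (total≡0 u (trans u≡w W≡0) e) (total≡0 w W≡0 e)))) (ℤₚ.*-zeroʳ (𝟙 (toℕ e ℕ.≤? toℕ i))))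

    -- When all heights vanish, every order has deviation zero, and the claim follows from L ≤ N m
    -- with 80 ≤ 96 to spare.
    moment-bound : + 80 * + m * L * L * L ≤ + 96 * + m * + m * L * L * N
    moment-bound = ≤-from-gap _ (0≤a+b (0≤a*b (0≤a*b (0≤a*b (0≤a*b (0≤+ 80) (0≤+ m)) 0≤L) 0≤L) (0≤b-a L≤Nm))
        (0≤a*b (0≤a*b (0≤a*b (0≤a*b (0≤a*b (0≤+ 16) (0≤+ m)) (0≤+ m)) 0≤L) 0≤L) 0≤N)) (lem (+ m) L N)
      where
      lem : ∀ m L N → + 96 * m * m * L * L * N ≡ + 80 * m * L * L * L + (+ 80 * m * L * L * (N * m - L) + + 16 * m * m * L * L * N)
      lem = solve-∀

    weighted-bound : 0 ℕ.< W → ∀ D → + 3 * + W * D ≤ + 4 * pairs → + 3 * D + + 80 * + m * L * L * L ≤ + 96 * + m * + m * L * L * N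
    weighted-bound 0<W D h = *-cancelˡ-≤-0< {+ 3 * D + a * L} {b * N} (+ W) (+<+ 0<W) (begin
      + W * (+ 3 * D + a * L) ≡⟨ lem (+ W) D a L ⟩
      + 3 * + W * D + a * (L * + W) ≤⟨ ℤₚ.+-monoˡ-≤ (a * (L * + W)) h ⟩
      + 4 * pairs + a * (L * + W) ≤⟨ chord-sum ⟩
      b * (N * + W) ≡⟨ lem₂ (+ W) b N ⟩
      + W * (b * N) ∎)
      where
      open ℤₚ.≤-Reasoning
      a = + 80 * + m * L * L
      b = + 96 * + m * + m * L * L
      lem : ∀ W D a L → W * (+ 3 * D + a * L) ≡ + 3 * W * D + a * (L * W)
      lem = solve-∀
      lem₂ : ∀ W b N → b * (N * W) ≡ W * (b * N)
      lem₂ = solve-∀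

    LowDeviationOrder : Set
    LowDeviationOrder = Σ (Fin n → ℕ) λ K → (∀ i j → K i ≡ K j → i ≡ j) × Σ ℤ λ c →
      + 3 * deviation K c + + 80 * + m * L * L * L ≤ + 96 * + m * + m * L * L * N

    flat-order : W ≡ 0 → LowDeviationOrder
    flat-order W≡0 = toℕ , (λ _ _ → Finₚ.toℕ-injective) , + 0 ,
      subst (λ z → + 3 * z + + 80 * + m * L * L * L ≤ + 96 * + m * + m * L * L * N) (sym (flat W≡0))
        (subst (_≤ + 96 * + m * + m * L * L * N) (sym (ℤₚ.+-identityˡ (+ 80 * + m * L * L * L))) moment-bound)

    steep-order : 0 ℕ.< W → LowDeviationOrder
    steep-order 0<W = let K , K-inj , c , h = balanced-order 0<W in
      K , K-inj , c , weighted-bound 0<W (deviation K c) (subst (λ z → + 3 * + W * z ≤ + 4 * pairs)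
        (sum-cong-≗ (λ i → cong (λ z → χ i * ((+ 4 * z - c) * (+ 4 * z - c))) (prefix-y K i))) h)

    low-deviation-order : LowDeviationOrder
    low-deviation-order = [ flat-order , steep-order ]′ (zero-or-positive W)
      where
      zero-or-positive : ∀ W → W ≡ 0 ⊎ 0 ℕ.< W
      zero-or-positive zero = inj₁ refl
      zero-or-positive (suc _) = inj₂ (s≤s z≤n)

-- Cyclic segments and minimality

𝟙-× : ∀ {P Q : Set} (d : Dec P) (e : Dec Q) → 𝟙 (d ×-dec e) ≡ 𝟙 d * 𝟙 e
𝟙-× (yes _) (yes _) = refl
𝟙-× (yes _) (no _) = refl
𝟙-× (no _) e = sym (ℤₚ.*-zeroˡ (𝟙 e))

𝟙-⊎ : ∀ {P Q : Set} (d : Dec P) (e : Dec Q) → (P → ¬ Q) → 𝟙 (d ⊎-dec e) ≡ 𝟙 d + 𝟙 e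
𝟙-⊎ (yes p) (yes q) disj = ⊥-elim (disj p q)
𝟙-⊎ (yes _) (no _) _ = refl
𝟙-⊎ (no _) (yes _) _ = refl
𝟙-⊎ (no _) (no _) _ = refl

-- Stepping cyclically from (excluding) i to (including) i′ in the order given by K.
Segment : ∀ {n} → (Fin n → ℕ) → Fin n → Fin n → Fin n → Set
Segment K i i′ e = (K i ℕ.< K e × K e ℕ.≤ K i′) ⊎ (K i′ ℕ.< K i × (K i ℕ.< K e ⊎ K e ℕ.≤ K i′))

segment? : ∀ {n} (K : Fin n → ℕ) i i′ e → Dec (Segment K i i′ e)
segment? K i i′ e = (K i ℕ.<? K e ×-dec K e ℕ.≤? K i′) ⊎-dec (K i′ ℕ.<? K i ×-dec (K i ℕ.<? K e ⊎-dec K e ℕ.≤? K i′))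

start∉segment : ∀ {n} (K : Fin n → ℕ) i i′ → ¬ Segment K i i′ i
start∉segment K i i′ (inj₁ (lt , _)) = ℕₚ.<-irrefl refl lt
start∉segment K i i′ (inj₂ (_ , inj₁ lt)) = ℕₚ.<-irrefl refl lt
start∉segment K i i′ (inj₂ (lt , inj₂ le)) = ℕₚ.<⇒≱ lt le

end∈segment : ∀ {n} (K : Fin n → ℕ) i i′ → K i ≢ K i′ → Segment K i i′ i′
end∈segment K i i′ K≢ with ℕₚ.<-cmp (K i) (K i′)
... | tri< lt _ _ = inj₁ (lt , ℕₚ.≤-refl)
... | tri≈ _ eq _ = ⊥-elim (K≢ eq)
... | tri> _ _ gt = inj₂ (gt , inj₂ ℕₚ.≤-refl)

-- A cyclic segment is a difference of two prefixes, plus one full turn if it passes the end of the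
-- order.
𝟙-segment : ∀ {n} (K : Fin n → ℕ) i i′ e →
  𝟙 (segment? K i i′ e) ≡ 𝟙 (K e ℕ.≤? K i′) - 𝟙 (K e ℕ.≤? K i) + 𝟙 (K i′ ℕ.<? K i)
𝟙-segment K i i′ e = go (segment? K i i′ e) (K e ℕ.≤? K i′) (K e ℕ.≤? K i) (K i′ ℕ.<? K i)
  where
  go : (s : Dec (Segment K i i′ e)) (a : Dec (K e ℕ.≤ K i′)) (b : Dec (K e ℕ.≤ K i)) (c : Dec (K i′ ℕ.< K i)) →
    𝟙 s ≡ 𝟙 a - 𝟙 b + 𝟙 c
  go s (yes a) (yes b) (yes c) = 𝟙-yes s (inj₂ (c , inj₂ a))
  go s (yes a) (yes b) (no ¬c) = 𝟙-no s λ { (inj₁ (lt , _)) → ℕₚ.<⇒≱ lt b ; (inj₂ (c , _)) → ¬c c }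
  go s (yes a) (no ¬b) (yes c) = ⊥-elim (¬b (ℕₚ.≤-trans a (ℕₚ.<⇒≤ c)))
  go s (yes a) (no ¬b) (no ¬c) = 𝟙-yes s (inj₁ (ℕₚ.≰⇒> ¬b , a))
  go s (no ¬a) (yes b) (yes c) = 𝟙-no s λ { (inj₁ (_ , a)) → ¬a a ; (inj₂ (_ , inj₁ lt)) → ℕₚ.<⇒≱ lt b ; (inj₂ (_ , inj₂ a)) → ¬a a }
  go s (no ¬a) (yes b) (no ¬c) = ⊥-elim (¬a (ℕₚ.≤-trans b (ℕₚ.≮⇒≥ ¬c)))
  go s (no ¬a) (no ¬b) (yes c) = 𝟙-yes s (inj₂ (c , inj₁ (ℕₚ.≰⇒> ¬b)))
  go s (no ¬a) (no ¬b) (no ¬c) = 𝟙-no s λ { (inj₁ (_ , a)) → ¬a a ; (inj₂ (c , _)) → ¬c c }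

segment-sum : ∀ {n} (K : Fin n → ℕ) i i′ (z : Fin n → ℤ) →
  sum (λ e → 𝟙 (segment? K i i′ e) * z e) ≡ prefix K z i′ - prefix K z i + 𝟙 (K i′ ℕ.<? K i) * sum z
segment-sum K i i′ z = begin
  sum (λ e → 𝟙 (segment? K i i′ e) * z e)
    ≡⟨ sum-cong-≗ (λ e → trans (cong (_* z e) (𝟙-segment K i i′ e)) (lem (𝟙 (K e ℕ.≤? K i′)) (𝟙 (K e ℕ.≤? K i)) ω (z e))) ⟩
  sum (λ e → 𝟙 (K e ℕ.≤? K i′) * z e - 𝟙 (K e ℕ.≤? K i) * z e + ω * z e)
    ≡⟨ sum-+ (λ e → 𝟙 (K e ℕ.≤? K i′) * z e - 𝟙 (K e ℕ.≤? K i) * z e) (λ e → ω * z e) ⟩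
  sum (λ e → 𝟙 (K e ℕ.≤? K i′) * z e - 𝟙 (K e ℕ.≤? K i) * z e) + sum (λ e → ω * z e)
    ≡⟨ cong₂ _+_ (sum-- (λ e → 𝟙 (K e ℕ.≤? K i′) * z e) (λ e → 𝟙 (K e ℕ.≤? K i) * z e)) (*-sumˡ ω z) ⟩
  prefix K z i′ - prefix K z i + ω * sum z ∎
  where
  open ≡-Reasoning
  ω = 𝟙 (K i′ ℕ.<? K i)
  lem : ∀ a b c z → (a - b + c) * z ≡ a * z - b * z + c * z
  lem = solve-∀

subSum-sum : ∀ {n} (x : Fin n → Pt) {S : Fin n → Set} (S? : ∀ e → Dec (S e)) →
  subSum x (tabulate (λ e → does (S? e))) ≡ (sum (λ e → 𝟙 (S? e) * proj₁ (x e)) , sum (λ e → 𝟙 (S? e) * proj₂ (x e)))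
subSum-sum {zero} x S? = refl
subSum-sum {suc n} x S? with S? zero
... | yes _ = trans (cong (x zero ⊕_) (subSum-sum (x ∘ suc) (S? ∘ suc))) (sym (cong₂ _,_ (keep (proj₁ (x zero)) t₁) (keep (proj₂ (x zero)) t₂)))
  where
  t₁ = sum (λ e → 𝟙 (S? (suc e)) * proj₁ (x (suc e)))
  t₂ = sum (λ e → 𝟙 (S? (suc e)) * proj₂ (x (suc e)))
  keep : ∀ a t → + 1 * a + t ≡ a + t
  keep = solve-∀
... | no _ = trans (subSum-sum (x ∘ suc) (S? ∘ suc)) (sym (cong₂ _,_ (drop (proj₁ (x zero)) t₁) (drop (proj₂ (x zero)) t₂)))
  where
  t₁ = sum (λ e → 𝟙 (S? (suc e)) * proj₁ (x (suc e)))
  t₂ = sum (λ e → 𝟙 (S? (suc e)) * proj₂ (x (suc e)))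
  drop : ∀ a t → + 0 * a + t ≡ t
  drop = solve-∀

minimal : ∀ {n} (x : Fin n → Pt) → MinZeroSum x → {S : Fin n → Set} (S? : ∀ e → Dec (S e)) →
  sum (λ e → 𝟙 (S? e) * proj₁ (x e)) ≡ + 0 → sum (λ e → 𝟙 (S? e) * proj₂ (x e)) ≡ + 0 → (∀ e → S e) ⊎ (∀ e → ¬ S e)
minimal {n} x (_ , min) {S} S? z₁ z₂ with Finₚ.any? S? | Finₚ.all? S?
... | no none | _ = inj₂ (λ e s → none (e , s))
... | yes _ | yes all = inj₁ all
... | yes (e , s) | no ¬all = ⊥-elim (min I (e , Vecₚ.lookup⇒[]= e I (trans (Vecₚ.lookup∘tabulate _ e) (dec-true (S? e) s))) I≢⊤
        (trans (subSum-sum x S?) (cong₂ _,_ z₁ z₂)))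
  where
  I : Subset n
  I = tabulate (λ e → does (S? e))
  I≢⊤ : I ≢ ⊤
  I≢⊤ I≡⊤ = ¬all (λ e → holds e (S? e) (trans (sym (Vecₚ.lookup∘tabulate (λ e → does (S? e)) e)) (trans (cong (λ J → lookup J e) I≡⊤) (Vecₚ.lookup-replicate e true))))
    where
    holds : ∀ e (d : Dec (S e)) → does d ≡ true → S e
    holds e (yes s) _ = s

subSum-⊤ : ∀ {n} (x : Fin n → Pt) → subSum x ⊤ ≡ (sum (λ e → proj₁ (x e)) , sum (λ e → proj₂ (x e)))
subSum-⊤ {zero} x = refl
subSum-⊤ {suc n} x = cong (x zero ⊕_) (subSum-⊤ (x ∘ suc))

-1<0or-1 : ∀ κ → κ < + 1 → - + 1 ≤ κ → κ ≡ + 0 ⊎ κ ≡ - + 1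
-1<0or-1 (+ zero) _ _ = inj₁ refl
-1<0or-1 (+ suc n) (+<+ (s≤s ())) _
-1<0or-1 -[1+ zero ] _ _ = inj₂ refl
-1<0or-1 -[1+ suc n ] _ (ℤ.-≤- ())

*-cancelʳ-<-0< : ∀ {a b} c → + 0 < c → a * c < b * c → a < b
*-cancelʳ-<-0< (+ suc n) _ h = ℤₚ.*-cancelʳ-<-nonNeg (+ suc n) h
*-cancelʳ-<-0< (+ zero) (+<+ ()) _
*-cancelʳ-<-0< -[1+ n ] () _

*-cancelʳ-≤-0< : ∀ {a b} c → + 0 < c → a * c ≤ b * c → a ≤ b
*-cancelʳ-≤-0< {a} {b} c 0<c h = *-cancelˡ-≤-0< {a} {b} c 0<c (subst₂ _≤_ (ℤₚ.*-comm a c) (ℤₚ.*-comm b c) h)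

module Split {n : ℕ} (x : Fin n → Pt) (mz : MinZeroSum x) where

  x₁ x₂ : Fin n → ℤ
  x₁ i = proj₁ (x i)
  x₂ i = proj₂ (x i)

  -- Terms with x₁ = 0 go to `B`. The strict sign on `A` makes a proper part of `A` have abscissa
  -- sum strictly below `L`; on `B` only weak bounds are available.
  A B : Fin n → Set
  A i = + 0 < x₁ i
  B i = ¬ A i

  A? : ∀ i → Dec (A i)
  A? i = + 0 ℤ.<? x₁ i

  B? : ∀ i → Dec (B i)
  B? i = ¬? (A? i)

  a₁ a₂ b₁ b₂ : Fin n → ℤ
  a₁ i = 𝟙 (A? i) * x₁ i
  a₂ i = 𝟙 (A? i) * x₂ i
  b₁ i = 𝟙 (B? i) * x₁ i
  b₂ i = 𝟙 (B? i) * x₂ i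

  L h : ℤ
  L = sum a₁
  h = sum a₂

  𝟙A+𝟙B : ∀ i → 𝟙 (A? i) + 𝟙 (B? i) ≡ + 1
  𝟙A+𝟙B i with A? i
  ... | yes _ = refl
  ... | no _ = refl

  ∑x₁ : sum x₁ ≡ + 0
  ∑x₁ = cong proj₁ (trans (sym (subSum-⊤ x)) (proj₁ mz))

  ∑x₂ : sum x₂ ≡ + 0
  ∑x₂ = cong proj₂ (trans (sym (subSum-⊤ x)) (proj₁ mz))

  split-sum : ∀ (z : Fin n → ℤ) → sum z ≡ + 0 → sum (λ i → 𝟙 (B? i) * z i) ≡ - sum (λ i → 𝟙 (A? i) * z i)
  split-sum z z≡0 = lem (trans (sym (sum-+ (λ i → 𝟙 (A? i) * z i) (λ i → 𝟙 (B? i) * z i)))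
      (trans (sum-cong-≗ (λ i → trans (sym (ℤₚ.*-distribʳ-+ (z i) (𝟙 (A? i)) (𝟙 (B? i)))) (trans (cong (_* z i) (𝟙A+𝟙B i)) (ℤₚ.*-identityˡ (z i))))) z≡0))
    where
    lem : ∀ {a b} → a + b ≡ + 0 → b ≡ - a
    lem {a} {b} eq = trans (lem₂ a b) (trans (cong (λ z → z - a) eq) (ℤₚ.+-identityˡ (- a)))
      where
      lem₂ : ∀ a b → b ≡ a + b - a
      lem₂ = solve-∀

  ∑b₁ : sum b₁ ≡ - L
  ∑b₁ = split-sum x₁ ∑x₁

  ∑b₂ : sum b₂ ≡ - h
  ∑b₂ = split-sum x₂ ∑x₂

  0≤a₁ : ∀ i → + 0 ≤ a₁ i
  0≤a₁ i with A? i
  ... | yes p = subst (+ 0 ≤_) (sym (ℤₚ.*-identityˡ (x₁ i))) (ℤₚ.<⇒≤ p)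
  ... | no _ = ℤₚ.≤-reflexive (sym (ℤₚ.*-zeroˡ (x₁ i)))

  b₁≤0 : ∀ i → b₁ i ≤ + 0
  b₁≤0 i with A? i
  ... | yes _ = ℤₚ.≤-reflexive (ℤₚ.*-zeroˡ (x₁ i))
  ... | no ¬p = subst (_≤ + 0) (sym (ℤₚ.*-identityˡ (x₁ i))) (ℤₚ.≮⇒≥ ¬p)

  0<a₁ : ∀ i → A i → + 0 < a₁ i
  0<a₁ i p = subst (+ 0 <_) (sym (trans (cong (_* x₁ i) (𝟙-yes (A? i) p)) (ℤₚ.*-identityˡ (x₁ i)))) p

  module Injective (K : Fin n → ℕ) (K-inj : ∀ i j → K i ≡ K j → i ≡ j) (H : Fin n → ℕ) (H-inj : ∀ i j → H i ≡ H j → i ≡ j)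
    (i i′ j j′ : Fin n) (Ai : A i) (Ai′ : A i′) (Bj : B j) (Bj′ : B j′) where

    s? : ∀ e → Dec (Segment K i i′ e)
    s? = segment? K i i′

    t? : ∀ e → Dec (Segment H j j′ e)
    t? = segment? H j j′

    D₁ D₂ E₁ E₂ : ℤ
    D₁ = sum (λ e → 𝟙 (s? e) * a₁ e)
    D₂ = sum (λ e → 𝟙 (s? e) * a₂ e)
    E₁ = sum (λ e → 𝟙 (t? e) * b₁ e)
    E₂ = sum (λ e → 𝟙 (t? e) * b₂ e)

    𝟙*≥0 : ∀ {P : Set} (d : Dec P) {z} → + 0 ≤ z → + 0 ≤ 𝟙 d * z
    𝟙*≥0 (yes _) {z} 0≤z = subst (+ 0 ≤_) (sym (ℤₚ.*-identityˡ z)) 0≤z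
    𝟙*≥0 (no _) {z} 0≤z = ℤₚ.≤-reflexive (sym (ℤₚ.*-zeroˡ z))

    𝟙*≤ : ∀ {P : Set} (d : Dec P) {z} → + 0 ≤ z → 𝟙 d * z ≤ z
    𝟙*≤ (yes _) {z} 0≤z = ℤₚ.≤-reflexive (ℤₚ.*-identityˡ z)
    𝟙*≤ (no _) {z} 0≤z = subst (_≤ z) (sym (ℤₚ.*-zeroˡ z)) 0≤z

    0≤D₁ : + 0 ≤ D₁
    0≤D₁ = 0≤sum (λ e → 𝟙*≥0 (s? e) (0≤a₁ e))

    -- The segment omits its start `i`, whose abscissa is positive.
    D₁<L : D₁ < L
    D₁<L = subst₂ _<_ (ℤₚ.+-identityʳ D₁) (trans (ℤₚ.+-comm D₁ (L - D₁)) (lem L D₁)) (ℤₚ.+-monoʳ-< D₁ (ℤₚ.<-≤-trans (0<a₁ i Ai) gap))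
      where
      lem : ∀ a b → a - b + b ≡ a
      lem = solve-∀
      miss : ∀ e → + 0 ≤ a₁ e - 𝟙 (s? e) * a₁ e
      miss e = 0≤b-a (𝟙*≤ (s? e) (0≤a₁ e))
      gap : a₁ i ≤ L - D₁
      gap = subst₂ _≤_ (trans (cong (λ z → a₁ i - z * a₁ i) (𝟙-no (s? i) (start∉segment K i i′))) (lem₂ (a₁ i)))
        (sum-- a₁ (λ e → 𝟙 (s? e) * a₁ e)) (term≤sum (λ e → a₁ e - 𝟙 (s? e) * a₁ e) miss i)
        where
        lem₂ : ∀ z → z - + 0 * z ≡ z
        lem₂ = solve-∀

    E₁≤0 : E₁ ≤ + 0
    E₁≤0 = subst (E₁ ≤_) (sum-0 {n} (λ _ → + 0) (λ _ → refl)) (sum-mono (λ e → nonpositive (t? e) (b₁≤0 e)))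
      where
      nonpositive : ∀ {P : Set} (d : Dec P) {z} → z ≤ + 0 → 𝟙 d * z ≤ + 0
      nonpositive (yes _) {z} z≤0 = subst (_≤ + 0) (sym (ℤₚ.*-identityˡ z)) z≤0
      nonpositive (no _) {z} z≤0 = ℤₚ.≤-reflexive (ℤₚ.*-zeroˡ z)

    -L≤E₁ : - L ≤ E₁
    -L≤E₁ = subst (_≤ E₁) ∑b₁ (sum-mono (λ e → above (t? e) (b₁≤0 e)))
      where
      above : ∀ {P : Set} (d : Dec P) {z} → z ≤ + 0 → z ≤ 𝟙 d * z
      above (yes _) {z} z≤0 = ℤₚ.≤-reflexive (sym (ℤₚ.*-identityˡ z))
      above (no _) {z} z≤0 = subst (z ≤_) (sym (ℤₚ.*-zeroˡ z)) z≤0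

    0<L : + 0 < L
    0<L = ℤₚ.≤-<-trans 0≤D₁ D₁<L

    union? : ∀ e → Dec ((A e × Segment K i i′ e) ⊎ (B e × Segment H j j′ e))
    union? e = (A? e ×-dec s? e) ⊎-dec (B? e ×-dec t? e)

    union-sum : ∀ (z : Fin n → ℤ) → sum (λ e → 𝟙 (union? e) * z e) ≡
      sum (λ e → 𝟙 (s? e) * (𝟙 (A? e) * z e)) + sum (λ e → 𝟙 (t? e) * (𝟙 (B? e) * z e))
    union-sum z = trans (sum-cong-≗ (λ e → trans (cong (_* z e) (trans (𝟙-⊎ (A? e ×-dec s? e) (B? e ×-dec t? e) (λ p q → proj₁ q (proj₁ p)))
        (cong₂ _+_ (𝟙-× (A? e) (s? e)) (𝟙-× (B? e) (t? e))))) (lem (𝟙 (A? e)) (𝟙 (s? e)) (𝟙 (B? e)) (𝟙 (t? e)) (z e))))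
        (sum-+ (λ e → 𝟙 (s? e) * (𝟙 (A? e) * z e)) (λ e → 𝟙 (t? e) * (𝟙 (B? e) * z e)))
      where
      lem : ∀ a b c d z → (a * b + c * d) * z ≡ b * (a * z) + d * (c * z)
      lem = solve-∀

    wrapped? : ∀ e → Dec (A e ⊎ (B e × Segment H j j′ e))
    wrapped? e = A? e ⊎-dec (B? e ×-dec t? e)

    wrapped-sum : ∀ (z : Fin n → ℤ) → sum (λ e → 𝟙 (wrapped? e) * z e) ≡ sum (λ e → 𝟙 (A? e) * z e) + sum (λ e → 𝟙 (t? e) * (𝟙 (B? e) * z e))
    wrapped-sum z = trans (sum-cong-≗ (λ e → trans (cong (_* z e) (trans (𝟙-⊎ (A? e) (B? e ×-dec t? e) (λ p q → proj₁ q p))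
        (cong (λ q → 𝟙 (A? e) + q) (𝟙-× (B? e) (t? e))))) (lem (𝟙 (A? e)) (𝟙 (B? e)) (𝟙 (t? e)) (z e))))
        (sum-+ (λ e → 𝟙 (A? e) * z e) (λ e → 𝟙 (t? e) * (𝟙 (B? e) * z e)))
      where
      lem : ∀ a c d z → (a + c * d) * z ≡ a * z + d * (c * z)
      lem = solve-∀

    equal-if-avoided : ¬ Segment K i i′ i′ → i ≡ i′
    equal-if-avoided ¬s with K i ℕₚ.≟ K i′
    ... | yes eq = K-inj i i′ eq
    ... | no K≢ = ⊥-elim (¬s (end∈segment K i i′ K≢))

    equal-if-avoided′ : ¬ Segment H j j′ j′ → j ≡ j′
    equal-if-avoided′ ¬t with H j ℕₚ.≟ H j′
    ... | yes eq = H-inj j j′ eq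
    ... | no H≢ = ⊥-elim (¬t (end∈segment H j j′ H≢))

    -- The union of the two segments sums to zero and omits `i`, so minimality makes it empty; but a
    -- segment between distinct elements contains its end.
    no-winding : D₁ + E₁ ≡ + 0 → D₂ + E₂ ≡ + 0 → i ≡ i′ × j ≡ j′
    no-winding z₁ z₂ = [ (λ all → ⊥-elim ([ (λ (_ , s) → start∉segment K i i′ s) , (λ (b , _) → b Ai) ]′ (all i))) ,
        (λ none → equal-if-avoided (λ s → none i′ (inj₁ (Ai′ , s))) , equal-if-avoided′ (λ t → none j′ (inj₂ (Bj′ , t)))) ]′
        (minimal x mz union? (trans (union-sum x₁) z₁) (trans (union-sum x₂) z₂))

    -- Here the A-segment is empty, and all of A together with the B-segment has sum zero.
    one-winding : D₁ + E₁ ≡ - L → D₂ + E₂ ≡ - h → ⊥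
    one-winding z₁ z₂ = [ (λ all → [ (λ a → Bj a) , (λ (_ , t) → start∉segment H j j′ t) ]′ (all j)) , (λ none → none i (inj₁ Ai)) ]′
        (minimal x mz wrapped? (trans (wrapped-sum x₁) (close D₁ E₁ L D₁≡0 z₁)) (trans (wrapped-sum x₂) (close D₂ E₂ h D₂≡0 z₂)))
      where
      close : ∀ d e l → d ≡ + 0 → d + e ≡ - l → l + e ≡ + 0
      close d e l refl eq = trans (cong (λ q → l + q) (trans (sym (ℤₚ.+-identityˡ e)) eq)) (ℤₚ.+-inverseʳ l)
      D₁≤0 : D₁ ≤ + 0
      D₁≤0 = ≤-from-gap (E₁ - - L) (0≤b-a -L≤E₁) (trans (lem L) (trans (cong (λ z → z - - L) (sym z₁)) (ℤₚ.+-assoc D₁ E₁ (- - L))))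
        where
        lem : ∀ l → + 0 ≡ - l - - l
        lem = solve-∀
      avoid : ∀ e → A e → ¬ Segment K i i′ e
      avoid e Ae s = ℤₚ.<⇒≱ (0<a₁ e Ae) (ℤₚ.≤-trans (subst (_≤ D₁) (trans (cong (_* a₁ e) (𝟙-yes (s? e) s)) (ℤₚ.*-identityˡ (a₁ e)))
        (term≤sum (λ e → 𝟙 (s? e) * a₁ e) (λ e → 𝟙*≥0 (s? e) (0≤a₁ e)) e)) D₁≤0)
      empty : ∀ (z : Fin n → ℤ) → sum (λ e → 𝟙 (s? e) * (𝟙 (A? e) * z e)) ≡ + 0
      empty z = sum-0 (λ e → 𝟙 (s? e) * (𝟙 (A? e) * z e)) (λ e → trans (sym (ℤₚ.*-assoc (𝟙 (s? e)) (𝟙 (A? e)) (z e))) (trans (cong (_* z e) (trans (sym (𝟙-× (s? e) (A? e)))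
        (𝟙-no (s? e ×-dec A? e) (λ (s , a) → avoid e a s)))) (ℤₚ.*-zeroˡ (z e))))
      D₁≡0 : D₁ ≡ + 0
      D₁≡0 = empty x₁
      D₂≡0 : D₂ ≡ + 0
      D₂≡0 = empty x₂

    -- From 0 ≤ D₁ < L and -L ≤ E₁ ≤ 0 only the multiples 0 and -1 of the vector (L , h) remain.
    winding : ∀ κ → D₁ + E₁ ≡ κ * L → D₂ + E₂ ≡ κ * h → i ≡ i′ × j ≡ j′
    winding κ e₁ e₂ = [ (λ { refl → no-winding (trans e₁ (ℤₚ.*-zeroˡ L)) (trans e₂ (ℤₚ.*-zeroˡ h)) }) ,
        (λ { refl → ⊥-elim (one-winding (trans e₁ (ℤₚ.-1*i≡-i L)) (trans e₂ (ℤₚ.-1*i≡-i h))) }) ]′ (-1<0or-1 κ κ<1 -1≤κ)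
      where
      κ<1 : κ < + 1
      κ<1 = *-cancelʳ-<-0< {κ} {+ 1} L 0<L (subst₂ _<_ e₁ (sym (ℤₚ.*-identityˡ L))
        (ℤₚ.≤-<-trans (subst (D₁ + E₁ ≤_) (ℤₚ.+-identityʳ D₁) (ℤₚ.+-monoʳ-≤ D₁ E₁≤0)) D₁<L))
      -1≤κ : - + 1 ≤ κ
      -1≤κ = *-cancelʳ-≤-0< { - + 1} {κ} L 0<L (subst₂ _≤_ (sym (ℤₚ.-1*i≡-i L)) e₁
        (ℤₚ.≤-trans -L≤E₁ (subst (_≤ D₁ + E₁) (ℤₚ.+-identityˡ E₁) (ℤₚ.+-monoˡ-≤ E₁ 0≤D₁))))

    prefix-injective : ∀ k → prefix K a₁ i + prefix H b₁ j ≡ prefix K a₁ i′ + prefix H b₁ j′ + k * L →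
      prefix K a₂ i + prefix H b₂ j ≡ prefix K a₂ i′ + prefix H b₂ j′ + k * h → i ≡ i′ × j ≡ j′
    prefix-injective k e₁ e₂ = winding κ (winds a₁ b₁ L ∑b₁ refl e₁) (winds a₂ b₂ h ∑b₂ refl e₂)
      where
      ωA = 𝟙 (K i′ ℕ.<? K i)
      ωB = 𝟙 (H j′ ℕ.<? H j)
      -- A segment of `A` that passes the end of its order contributes the full vector (L , h), one
      -- of `B` its negative; `k` is the multiple in the hypothesis.
      κ = ωA - ωB - k
      winds : ∀ (a b : Fin n → ℤ) l → sum b ≡ - l → sum a ≡ l → prefix K a i + prefix H b j ≡ prefix K a i′ + prefix H b j′ + k * l →
        sum (λ e → 𝟙 (s? e) * a e) + sum (λ e → 𝟙 (t? e) * b e) ≡ κ * l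
      winds a b l eb ea eq = trans (cong₂ _+_ (segment-sum K i i′ a) (segment-sum H j j′ b))
        (trans (cong₂ (λ y z → prefix K a i′ - prefix K a i + ωA * y + (prefix H b j′ - prefix H b j + ωB * z)) ea eb)
          (trans (lem (prefix K a i′) (prefix K a i) (prefix H b j′) (prefix H b j) ωA ωB l)
            (trans (cong (λ z → prefix K a i′ + prefix H b j′ - z + (ωA - ωB) * l) eq) (lem₂ (prefix K a i′) (prefix H b j′) k (ωA - ωB) l))))
        where
        lem : ∀ a′ a b′ b p q l → a′ - a + p * l + (b′ - b + q * - l) ≡ a′ + b′ - (a + b) + (p - q) * l
        lem = solve-∀
        lem₂ : ∀ a′ b′ k r l → a′ + b′ - (a′ + b′ + k * l) + r * l ≡ (r - k) * l
        lem₂ = solve-∀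

-- Counting lattice cells

sum-↑ : ∀ a b (f : Fin (a ℕ.+ b) → ℤ) → sum f ≡ sum (λ i → f (i ↑ˡ b)) + sum (λ j → f (a ↑ʳ j))
sum-↑ zero b f = sym (ℤₚ.+-identityˡ (sum f))
sum-↑ (suc a) b f = trans (cong (λ z → f zero + z) (sum-↑ a b (f ∘ suc)))
  (sym (ℤₚ.+-assoc (f zero) (sum (λ i → f (suc (i ↑ˡ b)))) (sum (λ j → f (suc a ↑ʳ j)))))

sum-combine : ∀ a b (f : Fin (a ℕ.* b) → ℤ) → sum f ≡ sum (λ i → sum (λ j → f (combine {a} i j)))
sum-combine zero b f = refl
sum-combine (suc a) b f = trans (sum-↑ b (a ℕ.* b) f)
  (cong (λ z → sum (λ j → f (j ↑ˡ (a ℕ.* b))) + z) (sum-combine a b (λ c → f (b ↑ʳ c))))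

sum-remainder : ∀ a b (g : Fin b → ℤ) → sum (λ c → g (proj₂ (remQuot {a} b c))) ≡ + a * sum g
sum-remainder a b g = trans (sum-combine a b (λ c → g (proj₂ (remQuot {a} b c))))
  (trans (sum-cong-≗ {a} (λ i → sum-cong-≗ {b} (λ j → cong (λ p → g (proj₂ p)) (Finₚ.remQuot-combine {a} {b} i j)))) (sum-const a (sum g)))

pronic-sum : ∀ j a → + 3 * sum {j} (λ t → (+ toℕ t - a) * (+ toℕ t - a + + 1)) ≡
  (+ j - a) * ((+ j - a) * (+ j - a) - + 1) + a * (a * a - + 1)
pronic-sum zero a = lem a
  where
  lem : ∀ a → + 0 ≡ (+ 0 - a) * ((+ 0 - a) * (+ 0 - a) - + 1) + a * (a * a - + 1)
  lem = solve-∀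
pronic-sum (suc j) a = begin
  + 3 * ((+ 0 - a) * (+ 0 - a + + 1) + sum {j} (λ t → (+ 1 + + toℕ t - a) * (+ 1 + + toℕ t - a + + 1)))
    ≡⟨ cong (λ z → + 3 * ((+ 0 - a) * (+ 0 - a + + 1) + z)) (sum-cong-≗ {j} (λ t → shift (+ toℕ t) a)) ⟩
  + 3 * ((+ 0 - a) * (+ 0 - a + + 1) + S) ≡⟨ ℤₚ.*-distribˡ-+ (+ 3) ((+ 0 - a) * (+ 0 - a + + 1)) S ⟩
  + 3 * ((+ 0 - a) * (+ 0 - a + + 1)) + + 3 * S ≡⟨ cong (λ z → + 3 * ((+ 0 - a) * (+ 0 - a + + 1)) + z) (pronic-sum j (a - + 1)) ⟩
  + 3 * ((+ 0 - a) * (+ 0 - a + + 1)) + ((+ j - (a - + 1)) * ((+ j - (a - + 1)) * (+ j - (a - + 1)) - + 1) + (a - + 1) * ((a - + 1) * (a - + 1) - + 1))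
    ≡⟨ lem (+ j) a ⟩
  (+ 1 + + j - a) * ((+ 1 + + j - a) * (+ 1 + + j - a) - + 1) + a * (a * a - + 1) ∎
  where
  open ≡-Reasoning
  S = sum {j} (λ t → (+ toℕ t - (a - + 1)) * (+ toℕ t - (a - + 1) + + 1))
  shift : ∀ t a → (+ 1 + t - a) * (+ 1 + t - a + + 1) ≡ (t - (a - + 1)) * (t - (a - + 1) + + 1)
  shift = solve-∀
  lem : ∀ j a → + 3 * ((+ 0 - a) * (+ 0 - a + + 1)) + ((j - (a - + 1)) * ((j - (a - + 1)) * (j - (a - + 1)) - + 1) + (a - + 1) * ((a - + 1) * (a - + 1) - + 1)) ≡
    (+ 1 + j - a) * ((+ 1 + j - a) * (+ 1 + j - a) - + 1) + a * (a * a - + 1)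
  lem = solve-∀

-- On the cell from κ P to (κ + 1) P the square is at least P² min (κ² , (κ + 1)²) ≥ P² (κ (κ + 1) - k).
square-in-cell : ∀ P r κ k → + 0 ≤ P → + 0 ≤ r → r ≤ P → κ ≤ k → - k ≤ κ + + 1 →
  P * P * (κ * (κ + + 1) - k) ≤ (r + κ * P) * (r + κ * P)
square-in-cell P r κ k 0≤P 0≤r r≤P κ≤k -k≤ = [ nonneg , neg ]′ (ℤₚ.≤-total (+ 0) κ)
  where
  goal = P * P * (κ * (κ + + 1) - k) ≤ (r + κ * P) * (r + κ * P)
  nonneg : + 0 ≤ κ → goal
  nonneg 0≤κ = ≤-from-gap (r * r + + 2 * (r * κ * P) + P * P * (k - κ))
    (0≤a+b {r * r + + 2 * (r * κ * P)} {P * P * (k - κ)} (0≤a+b {r * r} {+ 2 * (r * κ * P)} (0≤a² r) (0≤a*b {+ 2} {r * κ * P} (0≤+ 2) (0≤a*b {r * κ} {P} (0≤a*b {r} {κ} 0≤r 0≤κ) 0≤P)))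
      (0≤a*b {P * P} {k - κ} (0≤a² P) (0≤b-a κ≤k)))
    (lem P r κ k)
    where
    lem : ∀ P r κ k → (r + κ * P) * (r + κ * P) ≡ P * P * (κ * (κ + + 1) - k) + (r * r + + 2 * (r * κ * P) + P * P * (k - κ))
    lem = solve-∀
  neg : κ ≤ + 0 → goal
  neg κ≤0 = [ (λ κ≡0 → nonneg (ℤₚ.≤-reflexive (sym κ≡0))) , below ]′ (split κ κ≤0)
    where
    split : ∀ κ → κ ≤ + 0 → κ ≡ + 0 ⊎ κ ≤ - + 1
    split (+ zero) _ = inj₁ refl
    split (+ suc _) (+≤+ ())
    split -[1+ _ ] _ = inj₂ (ℤ.-≤- z≤n)
    below : κ ≤ - + 1 → goal
    below κ≤-1 = ≤-from-gap ((P - r) * (P - r) + + 2 * ((P - r) * (- + 1 - κ) * P) + P * P * (κ + + 1 - - k))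
      (0≤a+b {(P - r) * (P - r) + + 2 * ((P - r) * (- + 1 - κ) * P)} {P * P * (κ + + 1 - - k)}
        (0≤a+b {(P - r) * (P - r)} {+ 2 * ((P - r) * (- + 1 - κ) * P)} (0≤a² (P - r))
          (0≤a*b {+ 2} {(P - r) * (- + 1 - κ) * P} (0≤+ 2) (0≤a*b {(P - r) * (- + 1 - κ)} {P} (0≤a*b {P - r} { - + 1 - κ} (0≤b-a r≤P) (0≤b-a κ≤-1)) 0≤P)))
        (0≤a*b {P * P} {κ + + 1 - - k} (0≤a² P) (0≤b-a -k≤)))
      (lem P r κ k)
      where
      lem : ∀ P r κ k → (r + κ * P) * (r + κ * P) ≡ P * P * (κ * (κ + + 1) - k) + ((P - r) * (P - r) + + 2 * ((P - r) * (- + 1 - κ) * P) + P * P * (κ + + 1 - - k))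
      lem = solve-∀

square-outside-right : ∀ P r κ k → + 0 ≤ P → + 0 ≤ k → + 0 ≤ r → k ≤ κ → P * P * (k * k) - (r + κ * P) * (r + κ * P) ≤ + 0
square-outside-right P r κ k 0≤P 0≤k 0≤r k≤κ = ≤-from-gap (s * (s + + 2 * (P * k))) (0≤a*b {s} {s + + 2 * (P * k)} 0≤s (0≤a+b {s} {+ 2 * (P * k)} 0≤s (0≤a*b {+ 2} {P * k} (0≤+ 2) (0≤a*b {P} {k} 0≤P 0≤k)))) (lem P r κ k)
  where
  s = r + (κ - k) * P
  0≤s : + 0 ≤ s
  0≤s = 0≤a+b {r} {(κ - k) * P} 0≤r (0≤a*b {κ - k} {P} (0≤b-a k≤κ) 0≤P)
  lem : ∀ P r κ k → + 0 ≡ P * P * (k * k) - (r + κ * P) * (r + κ * P) + (r + (κ - k) * P) * (r + (κ - k) * P + + 2 * (P * k))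
  lem = solve-∀

-- The reflection r ↦ P - r, κ ↦ - (κ + 1) exchanges the two sides of the strip.
square-outside-left : ∀ P r κ k → + 0 ≤ P → + 0 ≤ k → r ≤ P → κ + + 1 ≤ - k → P * P * (k * k) - (r + κ * P) * (r + κ * P) ≤ + 0
square-outside-left P r κ k 0≤P 0≤k r≤P κ≤ = subst (_≤ + 0) (lem P r κ k) (square-outside-right P (P - r) (- (κ + + 1)) k 0≤P 0≤k (0≤b-a r≤P)
    (subst (_≤ - (κ + + 1)) (ℤₚ.neg-involutive k) (ℤₚ.neg-mono-≤ κ≤)))
  where
  lem : ∀ P r κ k → P * P * (k * k) - (P - r + - (κ + + 1) * P) * (P - r + - (κ + + 1) * P) ≡ P * P * (k * k) - (r + κ * P) * (r + κ * P)
  lem = solve-∀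

small-multiple : ∀ {r r′ P} q → r ℕ.< P → r′ ℕ.< P → + r - + r′ ≡ q * + P → q ≡ + 0
small-multiple {r} {r′} {P} q r<P r′<P eq = ≤-antisym-1 q below above
  where
  0<P : + 0 < + P
  0<P = +<+ (ℕₚ.≤-<-trans z≤n r<P)
  below : q < + 1
  below = *-cancelʳ-<-0< {q} {+ 1} (+ P) 0<P (subst₂ _<_ eq (sym (ℤₚ.*-identityˡ (+ P)))
    (ℤₚ.≤-<-trans (ℤₚ.i-j≤i (+ r) (+ r′)) (+<+ r<P)))
  above : - + 1 < q
  above = *-cancelʳ-<-0< { - + 1} {q} (+ P) 0<P (subst₂ _<_ (sym (ℤₚ.-1*i≡-i (+ P))) eq
    (ℤₚ.<-≤-trans (ℤₚ.neg-mono-< (+<+ r′<P)) (subst (_≤ + r - + r′) (ℤₚ.+-identityˡ (- + r′)) (ℤₚ.+-monoˡ-≤ (- + r′) (0≤+ r)))))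
  ≤-antisym-1 : ∀ q → q < + 1 → - + 1 < q → q ≡ + 0
  ≤-antisym-1 (+ zero) _ _ = refl
  ≤-antisym-1 (+ suc n) (+<+ (s≤s ())) _
  ≤-antisym-1 -[1+ n ] _ (ℤ.-<- ())

module Count {n : ℕ} {A B : Fin n → Set} (A? : ∀ i → Dec (A i)) (B? : ∀ i → Dec (B i)) (X₁ X₂ : Fin n → Fin n → ℤ)
  (ℓ′ : ℕ) (h c : ℤ) (m : ℕ)
  (separated : ∀ i j i′ j′ k → A i → B j → A i′ → B j′ →
    X₁ i j ≡ X₁ i′ j′ + k * + suc ℓ′ → X₂ i j ≡ X₂ i′ j′ + k * h → i ≡ i′ × j ≡ j′) where

  -- `P` is the spacing of the values of `D` at lattice points with the same abscissa. The strip |D|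
  -- ≤ k P has half-width 8 m L, that is 2 m L before the scaling of heights by 4.
  ℓ P k : ℕ
  ℓ = suc ℓ′
  P = 4 ℕ.* suc ℓ′
  k = m ℕ.+ m

  D : Fin n → Fin n → ℤ
  D i j = + 4 * (+ ℓ * X₂ i j - h * X₁ i j) - c

  -- The cell of a pair: its residue along the period and its level across it.
  residue level-remainder : Fin n → Fin n → ℕ
  residue i j = X₁ i j %ℕ ℓ
  level-remainder i j = D i j %ℕ P

  level : Fin n → Fin n → ℤ
  level i j = D i j /ℕ P

  Code : Fin n → Fin n → Fin (ℓ ℕ.* (k ℕ.+ k)) → Set
  Code i j q = (A i × B j) × (toℕ (proj₁ (remQuot {ℓ} (k ℕ.+ k) q)) ≡ residue i j × + toℕ (proj₂ (remQuot {ℓ} (k ℕ.+ k) q)) ≡ level i j + + k)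

  code? : ∀ i j q → Dec (Code i j q)
  code? i j q = (A? i ×-dec B? j) ×-dec (_ ℕₚ.≟ residue i j ×-dec _ ℤₚ.≟ level i j + + k)

  -- After subtracting the multiple of (ℓ , h) that makes the abscissae agree, the values of `D`
  -- differ by a multiple of `P`. Being in one level they differ by less than `P`, so the ordinates
  -- agree as well and `separated` applies.
  same-cell : ∀ i j i′ j′ → A i → B j → A i′ → B j′ → residue i j ≡ residue i′ j′ → level i j ≡ level i′ j′ → i ≡ i′ × j ≡ j′
  same-cell i j i′ j′ Ai Bj Ai′ Bj′ eq₁ eq₂ = separated i j i′ j′ κ Ai Bj Ai′ Bj′ first second
    where
    t = X₁ i j /ℕ ℓ
    t′ = X₁ i′ j′ /ℕ ℓ
    κ = t - t′
    lem₁ : ∀ r t t′ l → r + t * l ≡ r + t′ * l + (t - t′) * l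
    lem₁ = solve-∀
    first : X₁ i j ≡ X₁ i′ j′ + κ * + ℓ
    first = begin
      X₁ i j ≡⟨ a≡a%ℕn+[a/ℕn]*n (X₁ i j) ℓ ⟩
      + residue i j + t * + ℓ ≡⟨ cong (λ z → + z + t * + ℓ) eq₁ ⟩
      + residue i′ j′ + t * + ℓ ≡⟨ lem₁ (+ residue i′ j′) t t′ (+ ℓ) ⟩
      + residue i′ j′ + t′ * + ℓ + κ * + ℓ ≡⟨ cong (_+ κ * + ℓ) (a≡a%ℕn+[a/ℕn]*n (X₁ i′ j′) ℓ) ⟨
      X₁ i′ j′ + κ * + ℓ ∎
      where open ≡-Reasoning
    q = X₂ i j - X₂ i′ j′ - κ * h
    lem₂ : ∀ r r′ v P → r - r′ ≡ r + v * P - (r′ + v * P)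
    lem₂ = solve-∀
    lem₃ : ∀ l a h b c a′ κ → + 4 * (l * a - h * (b + κ * l)) - c - (+ 4 * (l * a′ - h * b) - c) ≡ (a - a′ - κ * h) * (+ 4 * l)
    lem₃ = solve-∀
    multiple : + level-remainder i j - + level-remainder i′ j′ ≡ q * + P
    multiple = begin
      + level-remainder i j - + level-remainder i′ j′ ≡⟨ lem₂ (+ level-remainder i j) (+ level-remainder i′ j′) (level i j) (+ P) ⟩
      + level-remainder i j + level i j * + P - (+ level-remainder i′ j′ + level i j * + P)
        ≡⟨ cong (λ z → + level-remainder i j + level i j * + P - (+ level-remainder i′ j′ + z * + P)) eq₂ ⟩
      + level-remainder i j + level i j * + P - (+ level-remainder i′ j′ + level i′ j′ * + P)
        ≡⟨ cong₂ _-_ (a≡a%ℕn+[a/ℕn]*n (D i j) P) (a≡a%ℕn+[a/ℕn]*n (D i′ j′) P) ⟨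
      D i j - D i′ j′ ≡⟨ cong (λ z → + 4 * (+ ℓ * X₂ i j - h * z) - c - D i′ j′) first ⟩
      + 4 * (+ ℓ * X₂ i j - h * (X₁ i′ j′ + κ * + ℓ)) - c - D i′ j′ ≡⟨ lem₃ (+ ℓ) (X₂ i j) h (X₁ i′ j′) c (X₂ i′ j′) κ ⟩
      q * (+ 4 * + ℓ) ≡⟨ cong (q *_) (ℤₚ.pos-* 4 ℓ) ⟨
      q * + P ∎
      where open ≡-Reasoning
    lem₄ : ∀ a a′ b → a - a′ - b ≡ + 0 → a ≡ a′ + b
    lem₄ a a′ b eq = trans (lem₅ a a′ b) (trans (cong (λ z → a′ + b + z) eq) (ℤₚ.+-identityʳ (a′ + b)))
      where
      lem₅ : ∀ a a′ b → a ≡ a′ + b + (a - a′ - b)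
      lem₅ = solve-∀
    second : X₂ i j ≡ X₂ i′ j′ + κ * h
    second = lem₄ (X₂ i j) (X₂ i′ j′) (κ * h) (small-multiple q (n%ℕd<d (D i j) P) (n%ℕd<d (D i′ j′) P) multiple)

  code-injective : ∀ i j i′ j′ q → Code i j q → Code i′ j′ q → i ≡ i′ × j ≡ j′
  code-injective i j i′ j′ q ((Ai , Bj) , r , l) ((Ai′ , Bj′) , r′ , l′) =
    same-cell i j i′ j′ Ai Bj Ai′ Bj′ (trans (sym r) r′) (∙-cancelʳ (+ k) (level i j) (level i′ j′) (trans (sym l) l′))

  -- With κ = t - k this is P² (k² + k - κ (κ + 1)), a bound for R² - D² on the whole level κ. It is
  -- a single quadratic for both signs of κ, so that its sum has a closed form, and it factors as P²
  -- (2k - t) (t + 1), whence its sign.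
  G : ℤ → ℤ
  G t = + P * + P * (+ k * + k + + k - (t - + k) * (t - + k + + 1))

  R² : ℤ
  R² = + P * + P * (+ k * + k)

  weight : Fin n → Fin n → ℤ
  weight i j = 𝟙 (A? i ×-dec B? j) * (R² - D i j * D i j)

  0≤G : ∀ t → t ℕ.< k ℕ.+ k → + 0 ≤ G (+ t)
  0≤G t t< = subst (+ 0 ≤_) (lem (+ P) (+ k) (+ t)) (0≤a*b {+ P * + P} {(+ k + + k - + t) * (+ t + + 1)} (0≤a² (+ P))
      (0≤a*b {+ k + + k - + t} {+ t + + 1} (0≤b-a {+ t} {+ k + + k} (+≤+ (ℕₚ.<⇒≤ t<))) (0≤+ (t ℕ.+ 1))))
    where
    lem : ∀ P k t → P * P * ((k + k - t) * (t + + 1)) ≡ P * P * (k * k + k - (t - k) * (t - k + + 1))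
    lem = solve-∀

  D≡ : ∀ i j → D i j ≡ + level-remainder i j + level i j * + P
  D≡ i j = a≡a%ℕn+[a/ℕn]*n (D i j) P

  remainder≤P : ∀ i j → + level-remainder i j ≤ + P
  remainder≤P i j = +≤+ (ℕₚ.<⇒≤ (n%ℕd<d (D i j) P))

  value : Fin n → Fin n → ℤ
  value i j = R² - D i j * D i j

  value-inside : ∀ i j t → t ℕ.< k ℕ.+ k → + t ≡ level i j + + k → value i j ≤ G (+ t)
  value-inside i j t t< eq = subst₂ _≤_ (cong (λ z → R² - z * z) (sym (D≡ i j)))
      (lem (+ P) (+ k) (+ t) κ eq)
      (ℤₚ.+-monoʳ-≤ R² (ℤₚ.neg-mono-≤ (square-in-cell (+ P) r κ (+ k) (0≤+ P) (0≤+ _) (remainder≤P i j) upper lower)))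
    where
    κ = level i j
    r = + level-remainder i j
    κ≡ : κ ≡ + t - + k
    κ≡ = trans (lem₂ κ (+ k)) (cong (_- + k) (sym eq))
      where
      lem₂ : ∀ a b → a ≡ a + b - b
      lem₂ = solve-∀
    upper : κ ≤ + k
    upper = ≤-from-gap (+ (k ℕ.+ k) - + t) (0≤b-a (+≤+ (ℕₚ.<⇒≤ t<))) (trans (lem₃ (+ t) (+ k)) (cong (_+ (+ (k ℕ.+ k) - + t)) (sym κ≡)))
      where
      lem₃ : ∀ t k → k ≡ t - k + (k + k - t)
      lem₃ = solve-∀
    lower : - + k ≤ κ + + 1
    lower = ≤-from-gap (+ t + + 1) (0≤+ (t ℕ.+ 1)) (trans (cong (_+ + 1) κ≡) (lem₄ (+ t) (+ k)))
      where
      lem₄ : ∀ t k → t - k + + 1 ≡ - k + (t + + 1)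
      lem₄ = solve-∀
    lem : ∀ P k t κ → t ≡ κ + k → P * P * (k * k) - P * P * (κ * (κ + + 1) - k) ≡ P * P * (k * k + k - (t - k) * (t - k + + 1))
    lem P k t κ refl = lem₅ P k κ
      where
      lem₅ : ∀ P k κ → P * P * (k * k) - P * P * (κ * (κ + + 1) - k) ≡ P * P * (k * k + k - (κ + k - k) * (κ + k - k + + 1))
      lem₅ = solve-∀

  value-right : ∀ i j → + k ≤ level i j → value i j ≤ + 0
  value-right i j k≤κ = subst (λ z → R² - z * z ≤ + 0) (sym (D≡ i j))
    (square-outside-right (+ P) (+ level-remainder i j) (level i j) (+ k) (0≤+ P) (0≤+ k) (0≤+ _) k≤κ)

  value-left : ∀ i j → level i j + + 1 ≤ - + k → value i j ≤ + 0
  value-left i j κ≤ = subst (λ z → R² - z * z ≤ + 0) (sym (D≡ i j))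
    (square-outside-left (+ P) (+ level-remainder i j) (level i j) (+ k) (0≤+ P) (0≤+ k) (remainder≤P i j) κ≤)

  locate : ∀ κ → (κ + + 1 ≤ - + k) ⊎ (+ k ≤ κ) ⊎ (∃[ t ] t ℕ.< k ℕ.+ k × + t ≡ κ + + k)
  locate κ = go (κ + + k) refl
    where
    lem : ∀ a b → a ≡ a + b - b
    lem = solve-∀
    go : ∀ z → z ≡ κ + + k → (κ + + 1 ≤ - + k) ⊎ (+ k ≤ κ) ⊎ (∃[ t ] t ℕ.< k ℕ.+ k × + t ≡ κ + + k)
    go (+ t) eq with t ℕ.<? k ℕ.+ k
    ... | yes t< = inj₂ (inj₂ (t , t< , eq))
    ... | no t≮ = inj₂ (inj₁ (subst (+ k ≤_) (sym (trans (lem κ (+ k)) (cong (_- + k) (sym eq))))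
            (≤-from-gap (+ t - + (k ℕ.+ k)) (0≤b-a (+≤+ (ℕₚ.≮⇒≥ t≮))) (lem₂ (+ t) (+ k)))))
      where
      lem₂ : ∀ t k → t - k ≡ k + (t - (k + k))
      lem₂ = solve-∀
    go -[1+ s ] eq = inj₁ (subst (λ z → z + + 1 ≤ - + k) (sym (trans (lem κ (+ k)) (cong (_- + k) (sym eq))))
            (≤-from-gap (+ s) (0≤+ s) (lem₂ (+ s) (+ k))))
      where
      lem₂ : ∀ s k → - k ≡ - (+ 1 + s) - k + + 1 + s
      lem₂ = solve-∀

  g : Fin (ℓ ℕ.* (k ℕ.+ k)) → ℤ
  g q = G (+ toℕ (proj₂ (remQuot {ℓ} (k ℕ.+ k) q)))

  -- Pairs outside the strip have nonpositive weight and need no cell; this is what permits a finite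
  -- set of codes although the heights themselves are not bounded.
  weight-bound : ∀ i j → weight i j ≤ + 0 ⊎ (∃[ q ] Code i j q × weight i j ≤ g q)
  weight-bound i j = go (A? i) (B? j)
    where
    within-pair : (p : A i) (q : B j) → + 1 * value i j ≤ + 0 ⊎ (∃[ q ] Code i j q × + 1 * value i j ≤ g q)
    within-pair p q = subst (λ z → z ≤ + 0 ⊎ (∃[ q ] Code i j q × z ≤ g q)) (sym (ℤₚ.*-identityˡ (value i j)))
      ([ (λ κ≤ → inj₁ (value-left i j κ≤)) , [ (λ k≤ → inj₁ (value-right i j k≤)) , (λ (t , t< , eq) → inj₂ (cell t t< eq)) ]′ ]′ (locate (level i j)))
      where
      cell : ∀ t → t ℕ.< k ℕ.+ k → + t ≡ level i j + + k → ∃[ q ] Code i j q × value i j ≤ g q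
      cell t t< eq = Fin.combine {ℓ} r d , ((p , q) , trans (cong (λ z → toℕ (proj₁ z)) rq) (Finₚ.toℕ-fromℕ< _) , trans (cong (λ z → + toℕ (proj₂ z)) rq) (trans (cong +_ (Finₚ.toℕ-fromℕ< t<)) eq)) ,
          subst (λ z → value i j ≤ G (+ z)) (sym (trans (cong (λ z → toℕ (proj₂ z)) rq) (Finₚ.toℕ-fromℕ< t<))) (value-inside i j t t< eq)
        where
        r : Fin ℓ
        r = Fin.fromℕ< (n%ℕd<d (X₁ i j) ℓ)
        d : Fin (k ℕ.+ k)
        d = Fin.fromℕ< t<
        rq : remQuot {ℓ} (k ℕ.+ k) (Fin.combine r d) ≡ (r , d)
        rq = Finₚ.remQuot-combine {ℓ} {k ℕ.+ k} r d
    go : (a : Dec (A i)) (b : Dec (B j)) → 𝟙 (a ×-dec b) * value i j ≤ + 0 ⊎ (∃[ q ] Code i j q × 𝟙 (a ×-dec b) * value i j ≤ g q)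
    go (yes p) (yes q) = within-pair p q
    go (yes _) (no _) = inj₁ (ℤₚ.≤-reflexive (ℤₚ.*-zeroˡ (value i j)))
    go (no _) _ = inj₁ (ℤₚ.≤-reflexive (ℤₚ.*-zeroˡ (value i j)))

  G-sum : + 3 * sum {k ℕ.+ k} (λ t → G (+ toℕ t)) ≡ + P * + P * (+ 4 * + k * + k * + k + + 6 * + k * + k + + 2 * + k)
  G-sum = begin
    + 3 * sum {k ℕ.+ k} (λ t → G (+ toℕ t)) ≡⟨ cong (+ 3 *_) (*-sumˡ {k ℕ.+ k} (+ P * + P) (λ t → a - p (toℕ t))) ⟩
    + 3 * (+ P * + P * sum {k ℕ.+ k} (λ t → a - p (toℕ t))) ≡⟨ cong (λ z → + 3 * (+ P * + P * z)) (trans (sum-- {k ℕ.+ k} (λ _ → a) (λ t → p (toℕ t))) (cong (_- sum {k ℕ.+ k} (λ t → p (toℕ t))) (sum-const (k ℕ.+ k) a))) ⟩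
    + 3 * (+ P * + P * (+ (k ℕ.+ k) * a - S)) ≡⟨ lem (+ P) (+ (k ℕ.+ k) * a) S ⟩
    + P * + P * (+ 3 * (+ (k ℕ.+ k) * a) - + 3 * S) ≡⟨ cong (λ z → + P * + P * (+ 3 * (+ (k ℕ.+ k) * a) - z)) (pronic-sum (k ℕ.+ k) (+ k)) ⟩
    + P * + P * (+ 3 * ((+ k + + k) * a) - ((+ k + + k - + k) * ((+ k + + k - + k) * (+ k + + k - + k) - + 1) + + k * (+ k * + k - + 1)))
      ≡⟨ lem₂ (+ P) (+ k) ⟩
    + P * + P * (+ 4 * + k * + k * + k + + 6 * + k * + k + + 2 * + k) ∎
    where
    open ≡-Reasoning
    a = + k * + k + + k
    p : ℕ → ℤ
    p t = (+ t - + k) * (+ t - + k + + 1)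
    S = sum {k ℕ.+ k} (λ t → p (toℕ t))
    lem : ∀ P b S → + 3 * (P * P * (b - S)) ≡ P * P * (+ 3 * b - + 3 * S)
    lem = solve-∀
    lem₂ : ∀ P k → P * P * (+ 3 * ((k + k) * (k * k + k)) - ((k + k - k) * ((k + k - k) * (k + k - k) - + 1) + k * (k * k - + 1))) ≡
      P * P * (+ 4 * k * k * k + + 6 * k * k + + 2 * k)
    lem₂ = solve-∀

  count : + 3 * sum (λ i → sum (λ j → weight i j)) ≤ + ℓ * (+ P * + P * (+ 4 * + k * + k * + k + + 6 * + k * + k + + 2 * + k))
  count = begin
    + 3 * sum (λ i → sum (λ j → weight i j))
      ≤⟨ *-monoˡ-≤-0≤ (0≤+ 3) (sum-sum-pigeonhole code? code-injective g (λ q → 0≤G _ (Finₚ.toℕ<n (proj₂ (remQuot {ℓ} (k ℕ.+ k) q)))) weight weight-bound) ⟩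
    + 3 * sum g ≡⟨ cong (+ 3 *_) (sum-remainder ℓ (k ℕ.+ k) (λ t → G (+ toℕ t))) ⟩
    + 3 * (+ ℓ * sum {k ℕ.+ k} (λ t → G (+ toℕ t))) ≡⟨ lem (+ ℓ) (sum {k ℕ.+ k} (λ t → G (+ toℕ t))) ⟩
    + ℓ * (+ 3 * sum {k ℕ.+ k} (λ t → G (+ toℕ t))) ≡⟨ cong (+ ℓ *_) G-sum ⟩
    + ℓ * (+ P * + P * (+ 4 * + k * + k * + k + + 6 * + k * + k + + 2 * + k)) ∎
    where
    open ℤₚ.≤-Reasoning
    lem : ∀ a b → + 3 * (a * b) ≡ a * (+ 3 * b)
    lem = solve-∀

-- The upper bound

prefix-linear : ∀ {n} (K : Fin n → ℕ) a b (y z : Fin n → ℤ) i → prefix K (λ e → a * y e - b * z e) i ≡ a * prefix K y i - b * prefix K z i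
prefix-linear K a b y z i = begin
  sum (λ e → 𝟙 (K e ℕ.≤? K i) * (a * y e - b * z e)) ≡⟨ sum-cong-≗ (λ e → lem (𝟙 (K e ℕ.≤? K i)) a (y e) b (z e)) ⟩
  sum (λ e → a * (𝟙 (K e ℕ.≤? K i) * y e) - b * (𝟙 (K e ℕ.≤? K i) * z e))
    ≡⟨ sum-- (λ e → a * (𝟙 (K e ℕ.≤? K i) * y e)) (λ e → b * (𝟙 (K e ℕ.≤? K i) * z e)) ⟩
  sum (λ e → a * (𝟙 (K e ℕ.≤? K i) * y e)) - sum (λ e → b * (𝟙 (K e ℕ.≤? K i) * z e))
    ≡⟨ cong₂ _-_ (*-sumˡ a (λ e → 𝟙 (K e ℕ.≤? K i) * y e)) (*-sumˡ b (λ e → 𝟙 (K e ℕ.≤? K i) * z e)) ⟩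
  a * prefix K y i - b * prefix K z i ∎
  where
  open ≡-Reasoning
  lem : ∀ p a y b z → p * (a * y - b * z) ≡ a * (p * y) - b * (p * z)
  lem = solve-∀

Within : ℤ → ℤ → Set
Within m z = - m ≤ z × z ≤ m

within-difference : ∀ {m y z} → + 0 ≤ y → y ≤ m → + 0 ≤ z → z ≤ m → Within m (y - z)
within-difference {m} {y} {z} 0≤y y≤m 0≤z z≤m =
  ≤-from-gap (y + (m - z)) (0≤a+b 0≤y (0≤b-a z≤m)) (lem₁ m y z) ,
  ≤-from-gap ((m - y) + z) (0≤a+b (0≤b-a y≤m) 0≤z) (lem₂ m y z)
  where
  lem₁ : ∀ m y z → y - z ≡ - m + (y + (m - z))
  lem₁ = solve-∀
  lem₂ : ∀ m y z → m ≡ y - z + ((m - y) + z)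
  lem₂ = solve-∀

-- The part L (p - q) is at most 2 m L. For - h δ ≤ m L, note that (L + h) (m + δ) + (L - h) (m - δ)
-- = 2 (m L + h δ); this is why the inequality is doubled.
gap-bound : ∀ m L h δ p q → Within L h → Within m δ → Within m p → Within m q → + 0 ≤ L →
  L * (p - q) - h * δ ≤ + 3 * m * L
gap-bound m L h δ p q (h₁ , h₂) (δ₁ , δ₂) (p₁ , p₂) (q₁ , q₂) 0≤L = *-cancelˡ-≤-0< {L * (p - q) - h * δ} {+ 3 * m * L} (+ 2) (+<+ (s≤s z≤n))
  (≤-from-gap (+ 2 * (L * ((m - p) + (q - - m))) + ((h - - L) * (δ - - m) + (L - h) * (m - δ)))
    (0≤a+b {+ 2 * (L * ((m - p) + (q - - m)))} {(h - - L) * (δ - - m) + (L - h) * (m - δ)}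
      (0≤a*b {+ 2} {L * ((m - p) + (q - - m))} (0≤+ 2) (0≤a*b {L} {(m - p) + (q - - m)} 0≤L (0≤a+b {m - p} {q - - m} (0≤b-a p₂) (0≤b-a q₁))))
      (0≤a+b {(h - - L) * (δ - - m)} {(L - h) * (m - δ)} (0≤a*b {h - - L} {δ - - m} (0≤b-a h₁) (0≤b-a δ₁)) (0≤a*b {L - h} {m - δ} (0≤b-a h₂) (0≤b-a δ₂))))
    (lem m L h δ p q))
  where
  lem : ∀ m L h δ p q → + 2 * (+ 3 * m * L) ≡ + 2 * (L * (p - q) - h * δ) + (+ 2 * (L * ((m - p) + (q - - m))) + ((h - - L) * (δ - - m) + (L - h) * (m - δ)))
  lem = solve-∀

det-≤ : ∀ m L f g p q → + 0 ≤ m → + 0 ≤ L → + 0 ≤ f → f ≤ m → + 0 ≤ g → g ≤ m → Within m p → Within m q →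
  L * (f * p - g * q) ≤ + 2 * m * m * L
det-≤ m L f g p q 0≤m 0≤L 0≤f f≤m 0≤g g≤m (p₁ , p₂) (q₁ , q₂) = ≤-from-gap (L * (u + v)) (0≤a*b {L} {u + v} 0≤L (0≤a+b {u} {v} 0≤u 0≤v)) (lem m L f g p q)
  where
  u = f * (m - p) + m * (m - f)
  v = g * (q - - m) + m * (m - g)
  0≤u : + 0 ≤ u
  0≤u = 0≤a+b {f * (m - p)} {m * (m - f)} (0≤a*b {f} {m - p} 0≤f (0≤b-a p₂)) (0≤a*b {m} {m - f} 0≤m (0≤b-a f≤m))
  0≤v : + 0 ≤ v
  0≤v = 0≤a+b {g * (q - - m)} {m * (m - g)} (0≤a*b {g} {q - - m} 0≤g (0≤b-a q₁)) (0≤a*b {m} {m - g} 0≤m (0≤b-a g≤m))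
  lem : ∀ m L f g p q → + 2 * m * m * L ≡ L * (f * p - g * q) + L * ((f * (m - p) + m * (m - f)) + (g * (q - - m) + m * (m - g)))
  lem = solve-∀

module Bound {n : ℕ} (x : Fin n → Pt) (mz : MinZeroSum x) (m : ℕ) (box : ∀ i → Box m (x i)) where

  open Split x mz public

  box₁ : ∀ i → Within (+ m) (x₁ i)
  box₁ i = proj₁ (box i)

  box₂ : ∀ i → Within (+ m) (x₂ i)
  box₂ i = proj₂ (box i)

  yA yB : Fin n → ℤ
  yA e = L * a₂ e - h * a₁ e
  yB e = L * b₂ e - h * b₁ e

  vanishing : ∀ {P : Set} (d : Dec P) l k y z → ¬ P → l * (𝟙 d * y) - k * (𝟙 d * z) ≡ + 0
  vanishing d l k y z ¬p = trans (cong (λ t → l * (t * y) - k * (t * z)) (𝟙-no d ¬p)) (lem l k y z)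
    where
    lem : ∀ l k y z → l * (+ 0 * y) - k * (+ 0 * z) ≡ + 0
    lem = solve-∀

  selected : ∀ {P : Set} (d : Dec P) l k y z → P → l * (𝟙 d * y) - k * (𝟙 d * z) ≡ l * y - k * z
  selected d l k y z p = trans (cong (λ t → l * (t * y) - k * (t * z)) (𝟙-yes d p)) (lem l k y z)
    where
    lem : ∀ l k y z → l * (+ 1 * y) - k * (+ 1 * z) ≡ l * y - k * z
    lem = solve-∀

  ∑y : ∀ (y z : Fin n → ℤ) a b → sum y ≡ b → sum z ≡ a → L * b - h * a ≡ + 0 → sum (λ e → L * y e - h * z e) ≡ + 0
  ∑y y z a b eb ea eq = trans (sum-- (λ e → L * y e) (λ e → h * z e)) (trans (cong₂ _-_ (trans (*-sumˡ L y) (cong (L *_) eb)) (trans (*-sumˡ h z) (cong (h *_) ea))) eq)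

  ∑yA : sum yA ≡ + 0
  ∑yA = ∑y a₂ a₁ L h refl refl (lem L h)
    where
    lem : ∀ L h → L * h - h * L ≡ + 0
    lem = solve-∀

  ∑yB : sum yB ≡ + 0
  ∑yB = ∑y b₂ b₁ (- L) (- h) ∑b₂ ∑b₁ (lem L h)
    where
    lem : ∀ L h → L * - h - h * - L ≡ + 0
    lem = solve-∀

  0≤L : + 0 ≤ L
  0≤L = 0≤sum 0≤a₁

  fB : Fin n → ℤ
  fB i = - x₁ i

  0≤fB : ∀ i → B i → + 0 ≤ fB i
  0≤fB i b = ℤₚ.neg-mono-≤ (ℤₚ.≮⇒≥ b)

  fB≤m : ∀ i → B i → fB i ≤ + m
  fB≤m i _ = subst (fB i ≤_) (ℤₚ.neg-involutive (+ m)) (ℤₚ.neg-mono-≤ (proj₁ (box₁ i)))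

  0≤x₁ : ∀ i → A i → + 0 ≤ x₁ i
  0≤x₁ i a = ℤₚ.<⇒≤ a

  x₁≤m : ∀ i → A i → x₁ i ≤ + m
  x₁≤m i _ = proj₂ (box₁ i)

  module CA = Chain A? m x₁ yA 0≤x₁ x₁≤m (λ i ¬a → vanishing (A? i) L h (x₂ i) (x₁ i) ¬a) ∑yA
  module CB = Chain B? m fB yB 0≤fB fB≤m (λ i ¬b → vanishing (B? i) L h (x₂ i) (x₁ i) ¬b) ∑yB

  LB≡L : CB.L ≡ L
  LB≡L = trans (sum-cong-≗ (λ i → lem (𝟙 (B? i)) (x₁ i))) (trans (*-sumˡ (- + 1) b₁) (trans (cong (- + 1 *_) ∑b₁) (lem₂ L)))
    where
    lem : ∀ a b → a * - b ≡ - + 1 * (a * b)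
    lem = solve-∀
    lem₂ : ∀ L → - + 1 * - L ≡ L
    lem₂ = solve-∀

  NA NB : ℤ
  NA = sum (λ i → 𝟙 (A? i))
  NB = sum (λ i → 𝟙 (B? i))

  NA+NB : NA + NB ≡ + n
  NA+NB = trans (sym (sum-+ (λ i → 𝟙 (A? i)) (λ i → 𝟙 (B? i)))) (trans (sum-cong-≗ 𝟙A+𝟙B) (trans (sum-const n (+ 1)) (ℤₚ.*-identityʳ (+ n))))

  devA devB : (Fin n → ℕ) → ℤ → ℤ
  devA K c = sum (λ i → 𝟙 (A? i) * ((+ 4 * prefix K yA i - c) * (+ 4 * prefix K yA i - c)))
  devB K c = sum (λ i → 𝟙 (B? i) * ((+ 4 * prefix K yB i - c) * (+ 4 * prefix K yB i - c)))

  module _ (|h|≤L : Within L h) where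

    gap-lemma : ∀ p q r s → L * p - h * q - (L * r - h * s) ≡ L * (p - r) - h * (q - s)
    gap-lemma = lem L h
      where
      lem : ∀ L h p q r s → L * p - h * q - (L * r - h * s) ≡ L * (p - r) - h * (q - s)
      lem = solve-∀

    -- Inside one half-plane two abscissae differ by at most `m` rather than 2m, which gives the
    -- factor 3 in place of 4.
    gapA : ∀ i j → A i → A j → yA i - yA j ≤ + 3 * + m * L
    gapA i j a b = subst (_≤ + 3 * + m * L) (sym (trans (cong₂ _-_ (selected (A? i) L h (x₂ i) (x₁ i) a) (selected (A? j) L h (x₂ j) (x₁ j) b)) (gap-lemma (x₂ i) (x₁ i) (x₂ j) (x₁ j))))
      (gap-bound (+ m) L h (x₁ i - x₁ j) (x₂ i) (x₂ j) |h|≤L (within-difference (0≤x₁ i a) (x₁≤m i a) (0≤x₁ j b) (x₁≤m j b)) (box₂ i) (box₂ j) 0≤L)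

    gapB : ∀ i j → B i → B j → yB i - yB j ≤ + 3 * + m * L
    gapB i j a b = subst (_≤ + 3 * + m * L) (sym (trans (cong₂ _-_ (selected (B? i) L h (x₂ i) (x₁ i) a) (selected (B? j) L h (x₂ j) (x₁ j) b)) (gap-lemma (x₂ i) (x₁ i) (x₂ j) (x₁ j))))
      (gap-bound (+ m) L h (x₁ i - x₁ j) (x₂ i) (x₂ j) |h|≤L (subst (Within (+ m)) (lem (x₁ i) (x₁ j)) (within-difference (0≤fB j b) (fB≤m j b) (0≤fB i a) (fB≤m i a))) (box₂ i) (box₂ j) 0≤L)
      where
      lem : ∀ a b → - b - - a ≡ a - b
      lem = solve-∀

    -- The terms with `h` cancel: only `L` times a determinant of the original vectors is left.
    detA : ∀ i j → A i → A j → x₁ j * yA i - x₁ i * yA j ≤ + 2 * + m * + m * L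
    detA i j a b = subst (_≤ + 2 * + m * + m * L) (sym (trans (cong₂ (λ y z → x₁ j * y - x₁ i * z) (selected (A? i) L h (x₂ i) (x₁ i) a) (selected (A? j) L h (x₂ j) (x₁ j) b)) (lem L h (x₁ i) (x₂ i) (x₁ j) (x₂ j))))
      (det-≤ (+ m) L (x₁ j) (x₁ i) (x₂ i) (x₂ j) (0≤+ m) 0≤L (0≤x₁ j b) (x₁≤m j b) (0≤x₁ i a) (x₁≤m i a) (box₂ i) (box₂ j))
      where
      lem : ∀ L h p q r s → r * (L * q - h * p) - p * (L * s - h * r) ≡ L * (r * q - p * s)
      lem = solve-∀

    detB : ∀ i j → B i → B j → fB j * yB i - fB i * yB j ≤ + 2 * + m * + m * L
    detB i j a b = subst (_≤ + 2 * + m * + m * L) (sym (trans (cong₂ (λ y z → fB j * y - fB i * z) (selected (B? i) L h (x₂ i) (x₁ i) a) (selected (B? j) L h (x₂ j) (x₁ j) b)) (lem L h (x₁ i) (x₂ i) (x₁ j) (x₂ j))))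
      (det-≤ (+ m) L (fB j) (fB i) (x₂ i) (x₂ j) (0≤+ m) 0≤L (0≤fB j b) (fB≤m j b) (0≤fB i a) (fB≤m i a) (box₂ i) (box₂ j))
      where
      lem : ∀ L h p q r s → - r * (L * q - h * p) - - p * (L * s - h * r) ≡ L * (- r * q - - p * s)
      lem = solve-∀

    orderA : Σ (Fin n → ℕ) λ K → (∀ i j → K i ≡ K j → i ≡ j) × Σ ℤ λ c → + 3 * devA K c + + 80 * + m * L * L * L ≤ + 96 * + m * + m * L * L * NA
    orderA = CA.low-deviation-order gapA detA

    orderB : Σ (Fin n → ℕ) λ K → (∀ i j → K i ≡ K j → i ≡ j) × Σ ℤ λ c → + 3 * devB K c + + 80 * + m * L * L * L ≤ + 96 * + m * + m * L * L * NB
    orderB = let K , K-inj , c , p = CB.low-deviation-order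
                   (λ i j a b → subst (λ z → yB i - yB j ≤ + 3 * + m * z) (sym LB≡L) (gapB i j a b))
                   (λ i j a b → subst (λ z → fB j * yB i - fB i * yB j ≤ + 2 * + m * + m * z) (sym LB≡L) (detB i j a b))
             in K , K-inj , c , subst (λ z → + 3 * devB K c + + 80 * + m * z * z * z ≤ + 96 * + m * + m * z * z * NB) LB≡L p

sum-product : ∀ {n k} (f : Fin n → ℤ) (g : Fin k → ℤ) → sum (λ i → sum (λ j → f i * g j)) ≡ sum f * sum g
sum-product f g = trans (sum-cong-≗ (λ i → *-sumˡ (f i) g)) (*-sumʳ f (sum g))

-- Add `NB` times the first bound and `NA` times the second to the third. The deviations disappear,
-- and so does the product `NA * NB`, because 3 · 64 = 96 + 96.
eliminate-deviations : ∀ u v w NA NB dA dB → + 0 ≤ NA → + 0 ≤ NB →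
  + 3 * dA + + 80 * u ≤ + 96 * v * NA → + 3 * dB + + 80 * u ≤ + 96 * v * NB →
  + 3 * (+ 64 * v * (NA * NB) - dA * NB - NA * dB) ≤ w → + 80 * u * (NA + NB) ≤ w
eliminate-deviations u v w NA NB dA dB 0≤NA 0≤NB hA hB hS = ≤-from-gap (NB * gA + NA * gB + gS)
  (0≤a+b {NB * gA + NA * gB} {gS} (0≤a+b {NB * gA} {NA * gB} (0≤a*b {NB} {gA} 0≤NB (0≤b-a hA)) (0≤a*b {NA} {gB} 0≤NA (0≤b-a hB))) (0≤b-a hS))
  (lem u v w NA NB dA dB)
  where
  gA = + 96 * v * NA - (+ 3 * dA + + 80 * u)
  gB = + 96 * v * NB - (+ 3 * dB + + 80 * u)
  gS = w - + 3 * (+ 64 * v * (NA * NB) - dA * NB - NA * dB)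
  lem : ∀ u v w NA NB dA dB → w ≡ + 80 * u * (NA + NB) +
    (NB * (+ 96 * v * NA - (+ 3 * dA + + 80 * u)) + NA * (+ 96 * v * NB - (+ 3 * dB + + 80 * u)) +
    (w - + 3 * (+ 64 * v * (NA * NB) - dA * NB - NA * dB)))
  lem = solve-∀

module Combine {n : ℕ} (x : Fin n → Pt) (mz : MinZeroSum x) (m : ℕ) (box : ∀ i → Box m (x i)) where

  open Bound x mz m box

  module _ (ℓ′ : ℕ) (L≡ : L ≡ + suc ℓ′)
    (K : Fin n → ℕ) (K-inj : ∀ i j → K i ≡ K j → i ≡ j) (cA : ℤ)
    (H : Fin n → ℕ) (H-inj : ∀ i j → H i ≡ H j → i ≡ j) (cB : ℤ) where

    α β : Fin n → ℤ
    α i = + 4 * prefix K yA i - cA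
    β j = + 4 * prefix H yB j - cB

    separated⁺ : ∀ i j i′ j′ k → A i → B j → A i′ → B j′ →
      prefix K a₁ i + prefix H b₁ j ≡ prefix K a₁ i′ + prefix H b₁ j′ + k * + suc ℓ′ →
      prefix K a₂ i + prefix H b₂ j ≡ prefix K a₂ i′ + prefix H b₂ j′ + k * h → i ≡ i′ × j ≡ j′
    separated⁺ i j i′ j′ k Ai Bj Ai′ Bj′ e₁ e₂ = Injective.prefix-injective K K-inj H H-inj i i′ j j′ Ai Ai′ Bj Bj′ k
      (trans e₁ (cong (λ z → prefix K a₁ i′ + prefix H b₁ j′ + k * z) (sym L≡))) e₂

    transpose : ∀ a b a′ b′ t → a - b ≡ a′ - b′ + t → a + b′ ≡ a′ + b + t
    transpose a b a′ b′ t eq = trans (lem a b b′) (trans (cong (λ z → z + b + b′) eq) (lem₂ a′ b b′ t))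
      where
      lem : ∀ a b b′ → a + b′ ≡ a - b + b + b′
      lem = solve-∀
      lem₂ : ∀ a′ b b′ t → a′ - b′ + t + b + b′ ≡ a′ + b + t
      lem₂ = solve-∀

    -- Moving the prefixes of `B` to the other sides turns an equality of differences into one of
    -- sums with `j` and `j′` exchanged.
    separated⁻ : ∀ i j i′ j′ k → A i → B j → A i′ → B j′ →
      prefix K a₁ i - prefix H b₁ j ≡ prefix K a₁ i′ - prefix H b₁ j′ + k * + suc ℓ′ →
      prefix K a₂ i - prefix H b₂ j ≡ prefix K a₂ i′ - prefix H b₂ j′ + k * h → i ≡ i′ × j ≡ j′
    separated⁻ i j i′ j′ k Ai Bj Ai′ Bj′ e₁ e₂ =
      let i≡ , j≡ = separated⁺ i j′ i′ j k Ai Bj′ Ai′ Bj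
                      (transpose (prefix K a₁ i) (prefix H b₁ j) (prefix K a₁ i′) (prefix H b₁ j′) (k * + suc ℓ′) e₁)
                      (transpose (prefix K a₂ i) (prefix H b₂ j) (prefix K a₂ i′) (prefix H b₂ j′) (k * h) e₂)
      in i≡ , sym j≡

    module C⁺ = Count A? B? (λ i j → prefix K a₁ i + prefix H b₁ j) (λ i j → prefix K a₂ i + prefix H b₂ j) ℓ′ h (cA + cB) m separated⁺
    module C⁻ = Count A? B? (λ i j → prefix K a₁ i - prefix H b₁ j) (λ i j → prefix K a₂ i - prefix H b₂ j) ℓ′ h (cA - cB) m separated⁻

    D⁺≡ : ∀ i j → C⁺.D i j ≡ α i + β j
    D⁺≡ i j = trans (lem (+ suc ℓ′) h (prefix K a₁ i) (prefix K a₂ i) (prefix H b₁ j) (prefix H b₂ j) cA cB)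
      (cong₂ (λ y z → + 4 * y - cA + (+ 4 * z - cB))
        (trans (cong (λ z → z * prefix K a₂ i - h * prefix K a₁ i) (sym L≡)) (sym (prefix-linear K L h a₂ a₁ i)))
        (trans (cong (λ z → z * prefix H b₂ j - h * prefix H b₁ j) (sym L≡)) (sym (prefix-linear H L h b₂ b₁ j))))
      where
      lem : ∀ L h p q r s c d → + 4 * (L * (q + s) - h * (p + r)) - (c + d) ≡ + 4 * (L * q - h * p) - c + (+ 4 * (L * s - h * r) - d)
      lem = solve-∀

    D⁻≡ : ∀ i j → C⁻.D i j ≡ α i - β j
    D⁻≡ i j = trans (lem (+ suc ℓ′) h (prefix K a₁ i) (prefix K a₂ i) (prefix H b₁ j) (prefix H b₂ j) cA cB)
      (cong₂ (λ y z → + 4 * y - cA - (+ 4 * z - cB))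
        (trans (cong (λ z → z * prefix K a₂ i - h * prefix K a₁ i) (sym L≡)) (sym (prefix-linear K L h a₂ a₁ i)))
        (trans (cong (λ z → z * prefix H b₂ j - h * prefix H b₁ j) (sym L≡)) (sym (prefix-linear H L h b₂ b₁ j))))
      where
      lem : ∀ L h p q r s c d → + 4 * (L * (q - s) - h * (p - r)) - (c - d) ≡ + 4 * (L * q - h * p) - c - (+ 4 * (L * s - h * r) - d)
      lem = solve-∀

    R² S : ℤ
    R² = C⁺.R²
    S = R² * (NA * NB) - devA K cA * NB - NA * devB H cB

    -- Adding the two counts removes the cross term 2αβ.
    two-counts : sum (λ i → sum (λ j → C⁺.weight i j)) + sum (λ i → sum (λ j → C⁻.weight i j)) ≡ + 2 * S
    two-counts = begin
      sum (λ i → sum (λ j → C⁺.weight i j)) + sum (λ i → sum (λ j → C⁻.weight i j)) ≡⟨ sum-sum-+ C⁺.weight C⁻.weight ⟨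
      sum (λ i → sum (λ j → C⁺.weight i j + C⁻.weight i j)) ≡⟨ sum-sum-cong pointwise ⟩
      sum (λ i → sum (λ j → + 2 * term i j)) ≡⟨ sum-sum-*ˡ (+ 2) term ⟩
      + 2 * sum (λ i → sum (λ j → term i j)) ≡⟨ cong (+ 2 *_) separate ⟩
      + 2 * S ∎
      where
      open ≡-Reasoning
      χA χB vA vB : Fin n → ℤ
      χA i = 𝟙 (A? i)
      χB j = 𝟙 (B? j)
      vA i = χA i * (α i * α i)
      vB j = χB j * (β j * β j)
      term : Fin n → Fin n → ℤ
      term i j = R² * (χA i * χB j) + (- + 1 * (vA i * χB j) + - + 1 * (χA i * vB j))
      lem : ∀ p q r a b → p * q * (r - (a + b) * (a + b)) + p * q * (r - (a - b) * (a - b)) ≡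
        + 2 * (r * (p * q) + (- + 1 * (p * (a * a) * q) + - + 1 * (p * (q * (b * b)))))
      lem = solve-∀
      pointwise : ∀ i j → C⁺.weight i j + C⁻.weight i j ≡ + 2 * term i j
      pointwise i j = trans (cong₂ _+_ (cong₂ (λ y z → y * (R² - z * z)) (𝟙-× (A? i) (B? j)) (D⁺≡ i j)) (cong₂ (λ y z → y * (R² - z * z)) (𝟙-× (A? i) (B? j)) (D⁻≡ i j)))
        (lem (χA i) (χB j) R² (α i) (β j))
      lem₂ : ∀ r p q a b → r * (p * q) + (- + 1 * (a * q) + - + 1 * (p * b)) ≡ r * (p * q) - a * q - p * b
      lem₂ = solve-∀
      separate : sum (λ i → sum (λ j → term i j)) ≡ S
      separate = begin
        sum (λ i → sum (λ j → term i j)) ≡⟨ sum-sum-+ (λ i j → R² * (χA i * χB j)) (λ i j → - + 1 * (vA i * χB j) + - + 1 * (χA i * vB j)) ⟩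
        sum (λ i → sum (λ j → R² * (χA i * χB j))) + sum (λ i → sum (λ j → - + 1 * (vA i * χB j) + - + 1 * (χA i * vB j)))
          ≡⟨ cong₂ _+_ (trans (sum-sum-*ˡ R² (λ i j → χA i * χB j)) (cong (R² *_) (sum-product χA χB)))
               (trans (sum-sum-+ (λ i j → - + 1 * (vA i * χB j)) (λ i j → - + 1 * (χA i * vB j)))
                 (cong₂ _+_ (trans (sum-sum-*ˡ (- + 1) (λ i j → vA i * χB j)) (cong (- + 1 *_) (sum-product vA χB)))
                            (trans (sum-sum-*ˡ (- + 1) (λ i j → χA i * vB j)) (cong (- + 1 *_) (sum-product χA vB))))) ⟩
        R² * (NA * NB) + (- + 1 * (devA K cA * NB) + - + 1 * (NA * devB H cB)) ≡⟨ lem₂ R² NA NB (devA K cA) (devB H cB) ⟩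
        S ∎

    count-total : + 3 * S ≤ L * (+ 4 * L * (+ 4 * L) * (+ 4 * (+ m + + m) * (+ m + + m) * (+ m + + m) + + 6 * (+ m + + m) * (+ m + + m) + + 2 * (+ m + + m)))
    count-total = *-cancelˡ-≤-0< {+ 3 * S} {T L} (+ 2) (+<+ (s≤s z≤n)) (begin
      + 2 * (+ 3 * S) ≡⟨ lem S ⟩
      + 3 * (+ 2 * S) ≡⟨ cong (+ 3 *_) two-counts ⟨
      + 3 * (W⁺ + W⁻) ≡⟨ ℤₚ.*-distribˡ-+ (+ 3) W⁺ W⁻ ⟩
      + 3 * W⁺ + + 3 * W⁻ ≤⟨ ℤₚ.+-mono-≤ C⁺.count C⁻.count ⟩
      T′ + T′ ≡⟨ lem₂ T′ ⟩
      + 2 * T′ ≡⟨ cong (+ 2 *_) (trans (cong (λ z → + suc ℓ′ * (z * z * (+ 4 * + k * + k * + k + + 6 * + k * + k + + 2 * + k))) (ℤₚ.pos-* 4 (suc ℓ′))) (cong T (sym L≡))) ⟩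
      + 2 * T L ∎)
      where
      open ℤₚ.≤-Reasoning
      k = m ℕ.+ m
      W⁺ = sum (λ i → sum (λ j → C⁺.weight i j))
      W⁻ = sum (λ i → sum (λ j → C⁻.weight i j))
      T′ = + suc ℓ′ * (+ (4 ℕ.* suc ℓ′) * + (4 ℕ.* suc ℓ′) * (+ 4 * + k * + k * + k + + 6 * + k * + k + + 2 * + k))
      T : ℤ → ℤ
      T L = L * (+ 4 * L * (+ 4 * L) * (+ 4 * + k * + k * + k + + 6 * + k * + k + + 2 * + k))
      lem : ∀ S → + 2 * (+ 3 * S) ≡ + 3 * (+ 2 * S)
      lem = solve-∀
      lem₂ : ∀ t → t + t ≡ + 2 * t
      lem₂ = solve-∀

    R²≡ : R² ≡ + 4 * L * (+ 4 * L) * ((+ m + + m) * (+ m + + m))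
    R²≡ = cong (λ z → z * z * ((+ m + + m) * (+ m + + m))) (trans (ℤₚ.pos-* 4 (suc ℓ′)) (cong (+ 4 *_) (sym L≡)))

    length-bound : + 3 * devA K cA + + 80 * + m * L * L * L ≤ + 96 * + m * + m * L * L * NA →
      + 3 * devB H cB + + 80 * + m * L * L * L ≤ + 96 * + m * + m * L * L * NB → 0 ℕ.< m →
      + 5 * + n ≤ + 32 * + m * + m + + 24 * + m + + 4
    -- The elimination gives 80 u n ≤ 16 u q with `u` = m L³; the common positive factor 16 u is
    -- cancelled in two steps.
    length-bound pA pB 0<m = *-cancelˡ-≤-0< {+ 5 * + n} {q} u 0<u
      (*-cancelˡ-≤-0< {u * (+ 5 * + n)} {u * q} (+ 16) (+<+ (s≤s z≤n))
        (subst₂ _≤_ (trans (cong (+ 80 * u *_) NA+NB) (lem₁ u (+ n))) (lem₂ (+ m) L)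
          (eliminate-deviations u v (T L) NA NB dA dB (0≤sum (λ i → 0≤𝟙 (A? i))) (0≤sum (λ i → 0≤𝟙 (B? i)))
            (subst₂ _≤_ (cong (λ z → + 3 * dA + z) (lem₃ (+ m) L)) (lem₄ (+ m) L NA) pA)
            (subst₂ _≤_ (cong (λ z → + 3 * dB + z) (lem₃ (+ m) L)) (lem₄ (+ m) L NB) pB)
            (subst (λ z → + 3 * (z * (NA * NB) - dA * NB - NA * dB) ≤ T L) (trans R²≡ (lem₅ (+ m) L)) count-total))))
      where
      dA = devA K cA
      dB = devB H cB
      q = + 32 * + m * + m + + 24 * + m + + 4
      u = + m * L * L * L
      v = + m * + m * L * L
      T : ℤ → ℤ
      T L = L * (+ 4 * L * (+ 4 * L) * (+ 4 * (+ m + + m) * (+ m + + m) * (+ m + + m) + + 6 * (+ m + + m) * (+ m + + m) + + 2 * (+ m + + m)))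
      lem₁ : ∀ u n → + 80 * u * n ≡ + 16 * (u * (+ 5 * n))
      lem₁ = solve-∀
      lem₂ : ∀ m L → L * (+ 4 * L * (+ 4 * L) * (+ 4 * (m + m) * (m + m) * (m + m) + + 6 * (m + m) * (m + m) + + 2 * (m + m))) ≡
        + 16 * (m * L * L * L * (+ 32 * m * m + + 24 * m + + 4))
      lem₂ = solve-∀
      lem₃ : ∀ m L → + 80 * m * L * L * L ≡ + 80 * (m * L * L * L)
      lem₃ = solve-∀
      lem₄ : ∀ m L N → + 96 * m * m * L * L * N ≡ + 96 * (m * m * L * L) * N
      lem₄ = solve-∀
      lem₅ : ∀ m L → + 4 * L * (+ 4 * L) * ((m + m) * (m + m)) ≡ + 64 * (m * m * L * L)
      lem₅ = solve-∀
      0<a*b : ∀ {a b} → + 0 < a → + 0 < b → + 0 < a * b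
      0<a*b {+ suc a} {+ suc b} _ _ = +<+ (s≤s z≤n)
      0<a*b {+ zero} (+<+ ()) _
      0<a*b { -[1+ _ ]} () _
      0<a*b {+ suc a} {+ zero} _ (+<+ ())
      0<a*b {+ suc a} { -[1+ _ ]} _ ()
      0<L : + 0 < L
      0<L = subst (+ 0 <_) (sym L≡) (+<+ (s≤s z≤n))
      0<u : + 0 < u
      0<u = 0<a*b {+ m * L * L} {L} (0<a*b {+ m * L} {L} (0<a*b {+ m} {L} (+<+ 0<m) 0<L) 0<L) 0<L

transposed : ∀ {n} → (Fin n → Pt) → Fin n → Pt
transposed x i = proj₂ (x i) , proj₁ (x i)

subSum-transposed : ∀ {n} (x : Fin n → Pt) I → subSum (transposed x) I ≡ (proj₂ (subSum x I) , proj₁ (subSum x I))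
subSum-transposed {zero} x [] = refl
subSum-transposed {suc n} x (inside ∷ I) = cong (transposed x zero ⊕_) (subSum-transposed (x ∘ suc) I)
subSum-transposed {suc n} x (outside ∷ I) = subSum-transposed (x ∘ suc) I

transposed-minZeroSum : ∀ {n} (x : Fin n → Pt) → MinZeroSum x → MinZeroSum (transposed x)
transposed-minZeroSum x (total≡0 , min) =
  trans (subSum-transposed x ⊤) (cong (λ p → proj₂ p , proj₁ p) total≡0) ,
  λ I ne I≢⊤ eq → min I ne I≢⊤ (cong (λ p → proj₂ p , proj₁ p) (trans (sym (subSum-transposed x I)) eq))

-- The abscissae on `A` are positive and those on `B` nonpositive, and either side adds up to `L` in
-- absolute value.
all-zero : ∀ {k} (x : Fin k → Pt) (mz : MinZeroSum x) → Split.L x mz ≤ + 0 → ∀ i → proj₁ (x i) ≡ + 0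
all-zero {k} x mz L≤0 i = trans (lem (x₁ i) (𝟙 (A? i)) (𝟙 (B? i)) (𝟙A+𝟙B i)) (cong₂ _+_ a≡0 b≡0)
  where
  open Split x mz
  lem : ∀ z a b → a + b ≡ + 1 → z ≡ a * z + b * z
  lem z a b eq = trans (sym (ℤₚ.*-identityˡ z)) (trans (cong (_* z) (sym eq)) (ℤₚ.*-distribʳ-+ z a b))
  a≡0 : a₁ i ≡ + 0
  a≡0 = ℤₚ.≤-antisym (ℤₚ.≤-trans (term≤sum a₁ 0≤a₁ i) L≤0) (0≤a₁ i)
  -b : Fin k → ℤ
  -b i = - b₁ i
  0≤-b : ∀ i → + 0 ≤ -b i
  0≤-b i = ℤₚ.neg-mono-≤ (b₁≤0 i)
  ∑-b : sum -b ≡ L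
  ∑-b = trans (sum-cong-≗ (λ i → sym (ℤₚ.-1*i≡-i (b₁ i)))) (trans (*-sumˡ (- + 1) b₁) (trans (ℤₚ.-1*i≡-i (sum b₁)) (trans (cong -_ ∑b₁) (ℤₚ.neg-involutive L))))
  b≡0 : b₁ i ≡ + 0
  b≡0 = ℤₚ.≤-antisym (b₁≤0 i) (subst (+ 0 ≤_) (ℤₚ.neg-involutive (b₁ i)) (ℤₚ.neg-mono-≤ (ℤₚ.≤-trans (term≤sum -b 0≤-b i) (ℤₚ.≤-trans (ℤₚ.≤-reflexive ∑-b) L≤0))))

module Dominant {n : ℕ} (x : Fin n → Pt) (mz : MinZeroSum x) (m : ℕ) (box : ∀ i → Box m (x i)) (0<m : 0 ℕ.< m)
  (dominates : Split.L (transposed x) (transposed-minZeroSum x mz) ≤ Split.L x mz) where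

  open Bound x mz m box

  -- Any partial sum is at most the sum of the positive terms, which for the ordinates is the `L` of
  -- the transposed sequence. Used for `A` it bounds `h`, used for `B` it bounds - h.
  indicator-≤ : ∀ {P : Set} (d : Dec P) z → 𝟙 d * z ≤ 𝟙 (+ 0 ℤ.<? z) * z
  indicator-≤ (yes _) z with + 0 ℤ.<? z
  ... | yes _ = ℤₚ.≤-refl
  ... | no ¬p = subst₂ _≤_ (sym (ℤₚ.*-identityˡ z)) (sym (ℤₚ.*-zeroˡ z)) (ℤₚ.≮⇒≥ ¬p)
  indicator-≤ (no _) z with + 0 ℤ.<? z
  ... | yes p = subst₂ _≤_ (sym (ℤₚ.*-zeroˡ z)) (sym (ℤₚ.*-identityˡ z)) (ℤₚ.<⇒≤ p)
  ... | no _ = ℤₚ.≤-refl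

  |h|≤L : Within L h
  |h|≤L = subst (- L ≤_) (ℤₚ.neg-involutive h) (ℤₚ.neg-mono-≤ (subst (_≤ L) ∑b₂ (ℤₚ.≤-trans (sum-mono (λ i → indicator-≤ (B? i) (x₂ i))) dominates))) ,
    ℤₚ.≤-trans (sum-mono (λ i → indicator-≤ (A? i) (x₂ i))) dominates

  bound-positive : ∀ ℓ′ → L ≡ + suc ℓ′ → + 5 * + n ≤ + 32 * + m * + m + + 24 * + m + + 4
  bound-positive ℓ′ L≡ = let K , K-inj , cA , pA = orderA |h|≤L
                             H , H-inj , cB , pB = orderB |h|≤L
                         in Combine.length-bound x mz m box ℓ′ L≡ K K-inj cA H H-inj cB pA pB 0<m

  -- All terms are then the zero vector, and one zero term is already a zero-sum subsequence.
  bound-zero : L ≤ + 0 → n ℕ.≤ 1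
  bound-zero L≤0 = short n (λ i → all-zero x mz L≤0 i) (λ i → all-zero (transposed x) (transposed-minZeroSum x mz) (ℤₚ.≤-trans dominates L≤0) i) (λ S? → minimal x mz S?)
    where
    short : ∀ n {x : Fin n → Pt} → (∀ i → proj₁ (x i) ≡ + 0) → (∀ i → proj₂ (x i) ≡ + 0) →
      ({S : Fin n → Set} (S? : ∀ e → Dec (S e)) → sum (λ e → 𝟙 (S? e) * proj₁ (x e)) ≡ + 0 → sum (λ e → 𝟙 (S? e) * proj₂ (x e)) ≡ + 0 → (∀ e → S e) ⊎ (∀ e → ¬ S e)) → n ℕ.≤ 1
    short zero _ _ _ = z≤n
    short (suc zero) _ _ _ = ℕₚ.≤-refl
    short (suc (suc n)) z₁ z₂ min = ⊥-elim ([ (λ all → absurd (all (suc zero))) , (λ none → none zero refl) ]′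
        (min (λ e → e Finₚ.≟ zero) (sum-0 _ (λ e → trans (cong (𝟙 (e Finₚ.≟ zero) *_) (z₁ e)) (ℤₚ.*-zeroʳ (𝟙 (e Finₚ.≟ zero)))))
           (sum-0 _ (λ e → trans (cong (𝟙 (e Finₚ.≟ zero) *_) (z₂ e)) (ℤₚ.*-zeroʳ (𝟙 (e Finₚ.≟ zero)))))))
      where
      absurd : ∀ {n} {i : Fin n} → Fin.suc i ≡ Fin.zero → ⊥
      absurd ()

  bound : + 5 * + n ≤ + 32 * + m * + m + + 24 * + m + + 4
  bound = by-sign L refl
    where
    trivial : n ℕ.≤ 1 → + 5 * + n ≤ + 32 * + m * + m + + 24 * + m + + 4
    trivial n≤1 = ℤₚ.≤-trans (*-monoˡ-≤-0≤ {+ n} {+ 1} (0≤+ 5) (+≤+ n≤1))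
      (≤-from-gap (+ 32 * (+ m * + m) + + 23 * + m + (+ m - + 1)) (0≤a+b {+ 32 * (+ m * + m) + + 23 * + m} {+ m - + 1} (0≤a+b {+ 32 * (+ m * + m)} {+ 23 * + m} (0≤a*b {+ 32} {+ m * + m} (0≤+ 32) (0≤a² (+ m))) (0≤a*b {+ 23} {+ m} (0≤+ 23) (0≤+ m))) (0≤b-a (+≤+ 0<m))) (lem (+ m)))
      where
      lem : ∀ m → + 32 * m * m + + 24 * m + + 4 ≡ + 5 * + 1 + (+ 32 * (m * m) + + 23 * m + (m - + 1))
      lem = solve-∀
    by-sign : ∀ l → L ≡ l → + 5 * + n ≤ + 32 * + m * + m + + 24 * + m + + 4
    by-sign (+ suc ℓ′) L≡ = bound-positive ℓ′ L≡
    by-sign (+ zero) L≡ = trivial (bound-zero (ℤₚ.≤-reflexive L≡))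
    by-sign -[1+ _ ] L≡ = trivial (bound-zero (subst (_≤ + 0) (sym L≡) ℤ.-≤+))

minZeroSum-length : ∀ {n} (x : Fin n → Pt) m → 0 ℕ.< m → MinZeroSum x → (∀ i → Box m (x i)) →
  + 5 * + n ≤ + 32 * + m * + m + + 24 * + m + + 4
minZeroSum-length x m 0<m mz box = [ (λ le → Dominant.bound x mz m box 0<m le) ,
    (λ ge → Dominant.bound (transposed x) (transposed-minZeroSum x mz) m (λ i → proj₂ (box i) , proj₁ (box i)) 0<m ge) ]′
  (ℤₚ.≤-total (Split.L (transposed x) (transposed-minZeroSum x mz)) (Split.L x mz))

-- Existence of the Davenport constant

subSum-cong : ∀ {n} {x y : Fin n → Pt} → (∀ i → x i ≡ y i) → ∀ I → subSum x I ≡ subSum y I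
subSum-cong {zero} h [] = refl
subSum-cong {suc n} h (inside ∷ I) = cong₂ _⊕_ (h zero) (subSum-cong (h ∘ suc) I)
subSum-cong {suc n} h (outside ∷ I) = subSum-cong (h ∘ suc) I

minZeroSum-cong : ∀ {n} {x y : Fin n → Pt} → (∀ i → x i ≡ y i) → MinZeroSum x → MinZeroSum y
minZeroSum-cong h (total≡0 , min) = trans (sym (subSum-cong h ⊤)) total≡0 , λ I ne I≢⊤ eq → min I ne I≢⊤ (trans (subSum-cong h I) eq)

minZeroSum? : ∀ {n} (x : Fin n → Pt) → Dec (MinZeroSum x)
minZeroSum? {n} x = (subSum x ⊤ ≟ₚ 0p) ×-dec
  map′ (λ none I ne I≢⊤ eq → none (I , ne , I≢⊤ , eq)) (λ min (I , ne , I≢⊤ , eq) → min I ne I≢⊤ eq)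
    (¬? (Subsetₚ.anySubset? (λ I → Subsetₚ.nonempty? I ×-dec ¬? (Vecₚ.≡-dec Boolₚ._≟_ I ⊤) ×-dec (subSum x I ≟ₚ 0p))))
  where
  _≟ₚ_ : (p q : Pt) → Dec (p ≡ q)
  _≟ₚ_ = Productₚ.≡-dec ℤₚ._≟_ ℤₚ._≟_

offset : ∀ m → Fin (suc (m ℕ.+ m)) → ℤ
offset m i = + toℕ i - + m

offset-within : ∀ m i → Within (+ m) (offset m i)
offset-within m i = ≤-from-gap (+ toℕ i) (0≤+ _) (ℤₚ.+-comm (+ toℕ i) (- + m)) ,
  ≤-from-gap (+ m + + m - + toℕ i) (0≤b-a (+≤+ (ℕ.s≤s⁻¹ (Finₚ.toℕ<n i)))) (lem (+ m) (+ toℕ i))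
  where
  lem : ∀ m i → m ≡ i - m + (m + m - i)
  lem = solve-∀

offset-surjective : ∀ m a → Within (+ m) a → ∃[ i ] offset m i ≡ a
offset-surjective m a (lo , hi) = go (a + + m) refl
  where
  lem : ∀ a b → a + b - b ≡ a
  lem = solve-∀
  go : ∀ z → a + + m ≡ z → ∃[ i ] offset m i ≡ a
  go (+ t) eq = Fin.fromℕ< t< , trans (cong (λ z → + z - + m) (Finₚ.toℕ-fromℕ< t<)) (trans (cong (_- + m) (sym eq)) (lem a (+ m)))
    where
    t< : t ℕ.< suc (m ℕ.+ m)
    t< = s≤s (ℤₚ.drop‿+≤+ (subst (_≤ + m + + m) eq (ℤₚ.+-monoˡ-≤ (+ m) hi)))
  go -[1+ t ] eq = ⊥-elim (negative (subst (+ 0 ≤_) eq (subst (_≤ a + + m) (ℤₚ.+-inverseˡ (+ m)) (ℤₚ.+-monoˡ-≤ (+ m) lo))))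
    where
    negative : ¬ + 0 ≤ -[1+ t ]
    negative ()

anyInBox? : ∀ m {Q : Pt → Set} → (∀ p → Dec (Q p)) → Dec (Σ Pt λ p → Box m p × Q p)
anyInBox? m {Q} Q? = map′
  (λ (i , j , q) → (offset m i , offset m j) , (offset-within m i , offset-within m j) , q)
  (λ ((a , b) , (wa , wb) , q) → let i , ei = offset-surjective m a wa ; j , ej = offset-surjective m b wb in
    i , j , subst₂ (λ a b → Q (a , b)) (sym ei) (sym ej) q)
  (Finₚ.any? (λ i → Finₚ.any? (λ j → Q? (offset m i , offset m j))))

cons : ∀ {n} → Pt → (Fin n → Pt) → Fin (suc n) → Pt
cons p x zero = p
cons p x (suc i) = x i

emptySequence : Fin 0 → Pt
emptySequence ()

-- Splitting a sequence into its first term and the rest and joining them with `cons` gives it back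
-- only pointwise, hence the requirement that `Q` respect pointwise equality.
anySequence? : ∀ m n {Q : (Fin n → Pt) → Set} → (∀ {x y} → (∀ i → x i ≡ y i) → Q x → Q y) → (∀ x → Dec (Q x)) →
  Dec (Σ (Fin n → Pt) λ x → (∀ i → Box m (x i)) × Q x)
anySequence? m zero resp Q? = map′ (λ q → emptySequence , (λ ()) , q) (λ (x , _ , q) → resp {x} {emptySequence} (λ ()) q) (Q? emptySequence)
anySequence? m (suc n) {Q} resp Q? = map′
  (λ (p , bp , x , bx , q) → cons p x , (λ { zero → bp ; (suc i) → bx i }) , q)
  (λ (x , bx , q) → x zero , bx zero , (λ i → x (suc i)) , (λ i → bx (suc i)) , resp (λ { zero → refl ; (suc i) → refl }) q)
  (anyInBox? m (λ p → anySequence? m n {λ x → Q (cons p x)} (λ {x} {y} h → resp (λ { zero → refl ; (suc i) → h i })) (λ x → Q? (cons p x))))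

greatest : {P : ℕ → Set} → (∀ n → Dec (P n)) → P 0 → ∀ N → ∃[ d ] P d × (∀ n → n ℕ.≤ N → P n → n ℕ.≤ d)
greatest P? p0 zero = 0 , p0 , λ n n≤ _ → n≤
greatest {P} P? p0 (suc N) = step (P? (suc N)) (greatest P? p0 N)
  where
  step : Dec (P (suc N)) → (∃[ d ] P d × (∀ n → n ℕ.≤ N → P n → n ℕ.≤ d)) → ∃[ d ] P d × (∀ n → n ℕ.≤ suc N → P n → n ℕ.≤ d)
  step (yes p) _ = suc N , p , λ n n≤ _ → n≤
  step (no ¬p) (d , pd , max) = d , pd , λ n n≤ pn → [ (λ n< → max n (ℕ.s≤s⁻¹ n<) pn) , (λ { refl → ⊥-elim (¬p pn) }) ]′ (ℕₚ.m≤n⇒m<n∨m≡n n≤)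

-- The length bound makes the search for a longest sequence finite, and the empty sequence gives it
-- a start.
davenport-exists : ∀ m → 0 ℕ.< m → ∃[ d ] IsDavenport (Box m) d × + 5 * + d ≤ + 32 * + m * + m + + 24 * + m + + 4
davenport-exists m 0<m = let d , (x , bx , mz) , max = greatest Q? empty N in
  d , ((x , bx , mz) , λ n x bx mz → max n (short n x mz bx) (x , bx , mz)) , minZeroSum-length x m 0<m mz bx
  where
  Q? : ∀ n → Dec (Σ (Fin n → Pt) λ x → (∀ i → Box m (x i)) × MinZeroSum x)
  Q? n = anySequence? m n minZeroSum-cong minZeroSum?
  empty : Σ (Fin 0 → Pt) λ x → (∀ i → Box m (x i)) × MinZeroSum x
  empty = (λ ()) , (λ ()) , refl , λ { [] (() , _) }
  z : ℤ
  z = + 32 * + m * + m + + 24 * + m + + 4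
  -- A crude limit of the search: n ≤ 5 n ≤ `z`.
  N : ℕ
  N = ℤ.∣ z ∣
  short : ∀ n (x : Fin n → Pt) → MinZeroSum x → (∀ i → Box m (x i)) → n ℕ.≤ N
  short n x mz bx = ℤₚ.drop‿+≤+ (ℤₚ.≤-trans n≤5n (subst (+ 5 * + n ≤_) (sym (ℤₚ.0≤i⇒+∣i∣≡i 0≤z)) 5n≤z))
    where
    5n≤z : + 5 * + n ≤ z
    5n≤z = minZeroSum-length x m 0<m mz bx
    n≤5n : + n ≤ + 5 * + n
    n≤5n = ≤-from-gap (+ 4 * + n) (0≤a*b {+ 4} {+ n} (0≤+ 4) (0≤+ n)) (lem (+ n))
      where
      lem : ∀ n → + 5 * n ≡ n + + 4 * n
      lem = solve-∀
    0≤z : + 0 ≤ z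
    0≤z = ℤₚ.≤-trans (0≤+ n) (ℤₚ.≤-trans n≤5n 5n≤z)

-- Minimal sequences with three distinct terms

subSum-lookup : ∀ {n} (x : Fin n → Pt) (I : Subset n) →
  subSum x I ≡ (sum (λ e → 𝟙 (lookup I e Boolₚ.≟ true) * proj₁ (x e)) , sum (λ e → 𝟙 (lookup I e Boolₚ.≟ true) * proj₂ (x e)))
subSum-lookup x I = trans (cong (subSum x) (sym (trans (Vecₚ.tabulate-cong (λ e → does-≟ (lookup I e))) (Vecₚ.tabulate∘lookup I))))
  (subSum-sum x (λ e → lookup I e Boolₚ.≟ true))
  where
  does-≟ : ∀ b → does (b Boolₚ.≟ true) ≡ b
  does-≟ true = refl
  does-≟ false = refl

-- A relation k₁ v₁ + k₂ v₂ + k₃ v₃ = 0 between vectors with Cramer coefficients a, b, c.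
relation-multiple : ∀ a b c k₁ k₂ k₃ → 0 ℕ.< a → gcd a (gcd b c) ≡ 1 → k₁ ℕ.≤ a →
  b ℕ.* k₁ ≡ a ℕ.* k₂ → c ℕ.* k₁ ≡ a ℕ.* k₃ → (k₁ ≡ 0 × k₂ ≡ 0 × k₃ ≡ 0) ⊎ (k₁ ≡ a × k₂ ≡ b × k₃ ≡ c)
relation-multiple a@(suc _) b c k₁ k₂ k₃ 0<a gcd≡1 k₁≤a e₂ e₃ = cases k₁ k₁≤a a∣k₁ e₂ e₃
  where
  a∣k₁ : a ∣ k₁
  a∣k₁ = subst (a ∣_) (trans (sym (c*gcd[m,n]≡gcd[cm,cn] k₁ a (gcd b c))) (trans (cong (k₁ ℕ.*_) gcd≡1) (ℕₚ.*-identityʳ k₁)))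
    (gcd-greatest (∣n⇒∣m*n k₁ ∣-refl) (subst (a ∣_) (sym (c*gcd[m,n]≡gcd[cm,cn] k₁ b c))
      (gcd-greatest (divides k₂ (trans (ℕₚ.*-comm k₁ b) (trans e₂ (ℕₚ.*-comm a k₂)))) (divides k₃ (trans (ℕₚ.*-comm k₁ c) (trans e₃ (ℕₚ.*-comm a k₃)))))))
  vanish : ∀ k d → d ℕ.* 0 ≡ a ℕ.* k → k ≡ 0
  vanish k d eq = [ (λ ()) , (λ k≡0 → k≡0) ]′ (ℕₚ.m*n≡0⇒m≡0∨n≡0 a (trans (sym eq) (ℕₚ.*-zeroʳ d)))
  cases : ∀ k₁ → k₁ ℕ.≤ a → a ∣ k₁ → b ℕ.* k₁ ≡ a ℕ.* k₂ → c ℕ.* k₁ ≡ a ℕ.* k₃ → (k₁ ≡ 0 × k₂ ≡ 0 × k₃ ≡ 0) ⊎ (k₁ ≡ a × k₂ ≡ b × k₃ ≡ c)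
  cases zero _ _ e₂ e₃ = inj₁ (refl , vanish k₂ b e₂ , vanish k₃ c e₃)
  cases (suc k) k≤a a∣k e₂ e₃ = inj₂ (eq , full k₂ b e₂ , full k₃ c e₃)
    where
    eq : suc k ≡ a
    eq = ℕₚ.≤-antisym k≤a (∣⇒≤ a∣k)
    full : ∀ k′ d → d ℕ.* suc k ≡ a ℕ.* k′ → k′ ≡ d
    full k′ d e = sym (ℕₚ.*-cancelˡ-≡ d k′ a (trans (ℕₚ.*-comm a d) (trans (cong (d ℕ.*_) (sym eq)) e)))

module ThreeVectors (a b c : ℕ) (v₁ v₂ v₃ : Pt) where

  n : ℕ
  n = a ℕ.+ (b ℕ.+ c)

  data Kind : Set where
    first second third : Kind

  kind : ℕ → Kind
  kind t with t ℕ.<? a | t ℕ.<? a ℕ.+ b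
  ... | yes _ | _ = first
  ... | no _ | yes _ = second
  ... | no _ | no _ = third

  kind-first : ∀ t → t ℕ.< a → kind t ≡ first
  kind-first t t<a with t ℕ.<? a
  ... | yes _ = refl
  ... | no t≮a = ⊥-elim (t≮a t<a)

  kind-second : ∀ t → t ℕ.< b → kind (a ℕ.+ t) ≡ second
  kind-second t t<b with a ℕ.+ t ℕ.<? a | a ℕ.+ t ℕ.<? a ℕ.+ b
  ... | yes lt | _ = ⊥-elim (ℕₚ.<⇒≱ lt (ℕₚ.m≤m+n a t))
  ... | no _ | yes _ = refl
  ... | no _ | no t≮ = ⊥-elim (t≮ (ℕₚ.+-monoʳ-< a t<b))

  kind-third : ∀ t → kind (a ℕ.+ (b ℕ.+ t)) ≡ third
  kind-third t with a ℕ.+ (b ℕ.+ t) ℕ.<? a | a ℕ.+ (b ℕ.+ t) ℕ.<? a ℕ.+ b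
  ... | yes lt | _ = ⊥-elim (ℕₚ.<⇒≱ lt (ℕₚ.m≤m+n a _))
  ... | no _ | yes lt = ⊥-elim (ℕₚ.<⇒≱ lt (ℕₚ.+-monoʳ-≤ a (ℕₚ.m≤m+n b t)))
  ... | no _ | no _ = refl

  select : (Kind → ℤ) → Fin n → ℤ
  select g i = g (kind (toℕ i))

  select-sum : ∀ g → sum (select g) ≡ + a * g first + + b * g second + + c * g third
  select-sum g = begin
    sum {n} (λ i → g (kind (toℕ i))) ≡⟨ sum-split a (b ℕ.+ c) (g ∘ kind) ⟩
    sum {a} (λ i → g (kind (toℕ i))) + sum {b ℕ.+ c} (λ i → g (kind (a ℕ.+ toℕ i)))
      ≡⟨ cong (λ z → sum {a} (λ i → g (kind (toℕ i))) + z) (sum-split b c (λ t → g (kind (a ℕ.+ t)))) ⟩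
    sum {a} (λ i → g (kind (toℕ i))) + (sum {b} (λ i → g (kind (a ℕ.+ toℕ i))) + sum {c} (λ i → g (kind (a ℕ.+ (b ℕ.+ toℕ i)))))
      ≡⟨ cong₂ _+_ (block {a} (λ i → kind-first (toℕ i) (Finₚ.toℕ<n i))) (cong₂ _+_ (block {b} (λ i → kind-second (toℕ i) (Finₚ.toℕ<n i))) (block {c} (λ i → kind-third (toℕ i)))) ⟩
    + a * g first + (+ b * g second + + c * g third) ≡⟨ ℤₚ.+-assoc (+ a * g first) (+ b * g second) (+ c * g third) ⟨
    + a * g first + + b * g second + + c * g third ∎
    where
    open ≡-Reasoning
    block : ∀ {k K} {f : Fin k → Kind} → (∀ i → f i ≡ K) → sum (λ i → g (f i)) ≡ + k * g K
    block {k} {K} h = trans (sum-cong-≗ (λ i → cong g (h i))) (sum-const k (g K))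

  isFirst isSecond isThird : Kind → ℤ
  isFirst first = + 1
  isFirst second = + 0
  isFirst third = + 0
  isSecond first = + 0
  isSecond second = + 1
  isSecond third = + 0
  isThird first = + 0
  isThird second = + 0
  isThird third = + 1

  vector : Kind → Pt
  vector first = v₁
  vector second = v₂
  vector third = v₃

  x : Fin n → Pt
  x i = vector (kind (toℕ i))

  -- When `s` is the indicator of a subset, the three sums count the chosen copies of each vector.
  module Weighted (s : Fin n → ℤ) where

    κ₁ κ₂ κ₃ : ℤ
    κ₁ = sum (λ i → s i * select isFirst i)
    κ₂ = sum (λ i → s i * select isSecond i)
    κ₃ = sum (λ i → s i * select isThird i)

    expand : ∀ g → sum (λ i → s i * select g i) ≡ κ₁ * g first + κ₂ * g second + κ₃ * g third
    expand g = begin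
      sum (λ i → s i * select g i) ≡⟨ sum-cong-≗ (λ i → pointwise (s i) (kind (toℕ i))) ⟩
      sum (λ i → s i * select isFirst i * g first + s i * select isSecond i * g second + s i * select isThird i * g third)
        ≡⟨ trans (sum-+₃ (λ i → s i * select isFirst i * g first) (λ i → s i * select isSecond i * g second) (λ i → s i * select isThird i * g third))
             (cong₃ (λ a b c → a + b + c) (*-sumʳ (λ i → s i * select isFirst i) (g first)) (*-sumʳ (λ i → s i * select isSecond i) (g second)) (*-sumʳ (λ i → s i * select isThird i) (g third))) ⟩
      κ₁ * g first + κ₂ * g second + κ₃ * g third ∎
      where
      open ≡-Reasoning
      lem₁ : ∀ s x y z → s * x ≡ s * + 1 * x + s * + 0 * y + s * + 0 * z
      lem₁ = solve-∀
      lem₂ : ∀ s x y z → s * y ≡ s * + 0 * x + s * + 1 * y + s * + 0 * z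
      lem₂ = solve-∀
      lem₃ : ∀ s x y z → s * z ≡ s * + 0 * x + s * + 0 * y + s * + 1 * z
      lem₃ = solve-∀
      pointwise : ∀ s k → s * g k ≡ s * isFirst k * g first + s * isSecond k * g second + s * isThird k * g third
      pointwise s first = lem₁ s (g first) (g second) (g third)
      pointwise s second = lem₂ s (g first) (g second) (g third)
      pointwise s third = lem₃ s (g first) (g second) (g third)

    total-weight : sum s ≡ κ₁ + κ₂ + κ₃
    total-weight = trans (sum-cong-≗ (λ i → sym (ℤₚ.*-identityʳ (s i)))) (trans (expand (λ _ → + 1)) (lem κ₁ κ₂ κ₃))
      where
      lem : ∀ a b c → a * + 1 + b * + 1 + c * + 1 ≡ a + b + c
      lem = solve-∀

  module _ (0<a : 0 ℕ.< a) (gcd≡1 : gcd a (gcd b c) ≡ 1)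
    (total₁ : + a * proj₁ v₁ + + b * proj₁ v₂ + + c * proj₁ v₃ ≡ + 0)
    (total₂ : + a * proj₂ v₁ + + b * proj₂ v₂ + + c * proj₂ v₃ ≡ + 0)
    (cramer : ∀ k₁ k₂ k₃ → k₁ * proj₁ v₁ + k₂ * proj₁ v₂ + k₃ * proj₁ v₃ ≡ + 0 → k₁ * proj₂ v₁ + k₂ * proj₂ v₂ + k₃ * proj₂ v₃ ≡ + 0 →
      + b * k₁ ≡ + a * k₂ × + c * k₁ ≡ + a * k₃) where

    -- The numbers of copies in a zero-sum subset form a relation. By `cramer` it is proportional to
    -- (a , b , c), which is primitive, and the first number lies between 0 and `a`; so no copy or
    -- every copy is chosen.
    minZeroSum : MinZeroSum x
    minZeroSum = trans (subSum-⊤ x) (cong₂ _,_ (trans (select-sum (proj₁ ∘ vector)) total₁) (trans (select-sum (proj₂ ∘ vector)) total₂)) ,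
      λ I ne I≢⊤ eq → no-proper I ne I≢⊤ (trans (sym (subSum-lookup x I)) eq)
      where
      module _ (I : Subset n) where
        s : Fin n → ℤ
        s i = 𝟙 (lookup I i Boolₚ.≟ true)
        open Weighted s
        0≤s : ∀ i → + 0 ≤ s i
        0≤s i = 0≤𝟙 (lookup I i Boolₚ.≟ true)
        s≤1 : ∀ i → s i ≤ + 1
        s≤1 i with lookup I i Boolₚ.≟ true
        ... | yes _ = ℤₚ.≤-refl
        ... | no _ = 0≤+ 1
        0≤isFirst : ∀ k → + 0 ≤ isFirst k
        0≤isFirst first = 0≤+ 1
        0≤isFirst second = 0≤+ 0
        0≤isFirst third = 0≤+ 0
        0≤isSecond : ∀ k → + 0 ≤ isSecond k
        0≤isSecond first = 0≤+ 0
        0≤isSecond second = 0≤+ 1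
        0≤isSecond third = 0≤+ 0
        0≤isThird : ∀ k → + 0 ≤ isThird k
        0≤isThird first = 0≤+ 0
        0≤isThird second = 0≤+ 0
        0≤isThird third = 0≤+ 1
        0≤κ₁ : + 0 ≤ κ₁
        0≤κ₁ = 0≤sum (λ i → 0≤a*b {s i} {select isFirst i} (0≤s i) (0≤isFirst (kind (toℕ i))))
        0≤κ₂ : + 0 ≤ κ₂
        0≤κ₂ = 0≤sum (λ i → 0≤a*b {s i} {select isSecond i} (0≤s i) (0≤isSecond (kind (toℕ i))))
        0≤κ₃ : + 0 ≤ κ₃
        0≤κ₃ = 0≤sum (λ i → 0≤a*b {s i} {select isThird i} (0≤s i) (0≤isThird (kind (toℕ i))))
        κ₁≤a : κ₁ ≤ + a
        κ₁≤a = ℤₚ.≤-trans (sum-mono (λ i → subst (s i * select isFirst i ≤_) (ℤₚ.*-identityˡ (select isFirst i)) (shrink (s≤1 i) (0≤isFirst (kind (toℕ i))))))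
            (ℤₚ.≤-reflexive (trans (select-sum isFirst) (lem (+ a) (+ b) (+ c))))
          where
          shrink : ∀ {s t z} → s ≤ t → + 0 ≤ z → s * z ≤ t * z
          shrink {s} {t} {z} s≤t 0≤z = subst₂ _≤_ (ℤₚ.*-comm z s) (ℤₚ.*-comm z t) (*-monoˡ-≤-0≤ {s} {t} {z} 0≤z s≤t)
          lem : ∀ a b c → a * + 1 + b * + 0 + c * + 0 ≡ a
          lem = solve-∀
        k₁ k₂ k₃ : ℕ
        k₁ = ℤ.∣ κ₁ ∣
        k₂ = ℤ.∣ κ₂ ∣
        k₃ = ℤ.∣ κ₃ ∣
        empty : sum s ≡ + 0 → ¬ Nonempty I
        empty z (i , i∈I) = contradictory (ℤₚ.≤-trans (ℤₚ.≤-reflexive (sym (𝟙-yes (lookup I i Boolₚ.≟ true) (Vecₚ.[]=⇒lookup i∈I)))) (ℤₚ.≤-trans (term≤sum s 0≤s i) (ℤₚ.≤-reflexive z)))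
          where
          contradictory : ¬ + 1 ≤ + 0
          contradictory (+≤+ ())
        full : sum s ≡ + n → I ≡ ⊤
        full eq = trans (sym (Vecₚ.tabulate∘lookup I)) (trans (Vecₚ.tabulate-cong (λ i → trans (chosen i) (sym (Vecₚ.lookup-replicate i true)))) (Vecₚ.tabulate∘lookup ⊤))
          where
          ∑gap : sum (λ i → + 1 - s i) ≡ + 0
          ∑gap = trans (sum-- (λ _ → + 1) s) (trans (cong₂ _-_ (trans (sum-const n (+ 1)) (ℤₚ.*-identityʳ (+ n))) eq) (ℤₚ.+-inverseʳ (+ n)))
          contradictory : ¬ + 1 ≤ + 0
          contradictory (+≤+ ())
          chosen : ∀ i → lookup I i ≡ true
          chosen i = decide (lookup I i Boolₚ.≟ true) (ℤₚ.≤-trans (term≤sum (λ i → + 1 - s i) (λ i → 0≤b-a (s≤1 i)) i) (ℤₚ.≤-reflexive ∑gap))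
            where
            decide : (d : Dec (lookup I i ≡ true)) → + 1 - 𝟙 d ≤ + 0 → lookup I i ≡ true
            decide (yes p) _ = p
            decide (no _) le = ⊥-elim (contradictory le)
        no-proper : Nonempty I → I ≢ ⊤ → ¬ ((sum (λ e → s e * proj₁ (x e)) , sum (λ e → s e * proj₂ (x e))) ≡ 0p)
        no-proper ne I≢⊤ eq = [ (λ (z₁ , z₂ , z₃) → empty (trans total-weight (cong₂ _+_ (cong₂ _+_ (back 0≤κ₁ z₁) (back 0≤κ₂ z₂)) (back 0≤κ₃ z₃))) ne) ,
            (λ (z₁ , z₂ , z₃) → I≢⊤ (full (trans total-weight (trans (cong₂ _+_ (cong₂ _+_ (back 0≤κ₁ z₁) (back 0≤κ₂ z₂)) (back 0≤κ₃ z₃)) (ℤₚ.+-assoc (+ a) (+ b) (+ c)))))) ]′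
            (relation-multiple a b c k₁ k₂ k₃ 0<a gcd≡1 (ℤₚ.drop‿+≤+ (subst (_≤ + a) (sym (forth 0≤κ₁)) κ₁≤a)) (natural b a (proj₁ cr)) (natural c a (proj₂ cr)))
          where
          forth : ∀ {κ} → + 0 ≤ κ → + ℤ.∣ κ ∣ ≡ κ
          forth = ℤₚ.0≤i⇒+∣i∣≡i
          back : ∀ {κ k} → + 0 ≤ κ → ℤ.∣ κ ∣ ≡ k → κ ≡ + k
          back 0≤κ refl = sym (forth 0≤κ)
          cr = cramer (+ k₁) (+ k₂) (+ k₃)
            (trans (cong₂ _+_ (cong₂ _+_ (cong (_* proj₁ v₁) (forth 0≤κ₁)) (cong (_* proj₁ v₂) (forth 0≤κ₂))) (cong (_* proj₁ v₃) (forth 0≤κ₃)))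
              (trans (sym (expand (proj₁ ∘ vector))) (cong proj₁ eq)))
            (trans (cong₂ _+_ (cong₂ _+_ (cong (_* proj₂ v₁) (forth 0≤κ₁)) (cong (_* proj₂ v₂) (forth 0≤κ₂))) (cong (_* proj₂ v₃) (forth 0≤κ₃)))
              (trans (sym (expand (proj₂ ∘ vector))) (cong proj₂ eq)))
          natural : ∀ b a {k l} → + b * + k ≡ + a * + l → b ℕ.* k ≡ a ℕ.* l
          natural b a {k} {l} e = ℤₚ.+-injective (trans (ℤₚ.pos-* b k) (trans e (sym (ℤₚ.pos-* a l))))

-- A common divisor is prime to m, since modulo a divisor of m the first coefficient is - u, and u
-- is prime to m. It therefore divides d = 2m - u and 2m - 1, hence also their difference u - 1,
-- which is prime to 2m - 1.
coprime-coefficients : ∀ m′ u′ d → d ℕ.+ suc u′ ≡ suc m′ ℕ.+ suc m′ → Coprime (suc u′) (suc m′) → Coprime u′ (suc m′ ℕ.+ m′) →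
  gcd (suc m′ ℕ.+ m′ ℕ.* suc u′) (gcd (suc m′ ℕ.* d) (suc m′ ℕ.* (suc m′ ℕ.+ m′))) ≡ 1
coprime-coefficients m′ u′ d d+u≡ u⊥m u′⊥ = u′⊥ (e∣u′ , e∣w)
  where
  m = suc m′
  u = suc u′
  w = m ℕ.+ m′
  e = gcd (m ℕ.+ m′ ℕ.* u) (gcd (m ℕ.* d) (m ℕ.* w))
  e∣a : e ∣ m ℕ.+ m′ ℕ.* u
  e∣a = gcd[m,n]∣m (m ℕ.+ m′ ℕ.* u) (gcd (m ℕ.* d) (m ℕ.* w))
  e∣b : e ∣ m ℕ.* d
  e∣b = ∣-trans (gcd[m,n]∣n (m ℕ.+ m′ ℕ.* u) (gcd (m ℕ.* d) (m ℕ.* w))) (gcd[m,n]∣m (m ℕ.* d) (m ℕ.* w))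
  e∣c : e ∣ m ℕ.* w
  e∣c = ∣-trans (gcd[m,n]∣n (m ℕ.+ m′ ℕ.* u) (gcd (m ℕ.* d) (m ℕ.* w))) (gcd[m,n]∣n (m ℕ.* d) (m ℕ.* w))
  e⊥m : Coprime e m
  e⊥m {t} (t∣e , t∣m) = u⊥m (∣m+n∣m⇒∣n (subst (t ∣_) (ℕₚ.+-comm u (m′ ℕ.* u)) (∣m⇒∣m*n u t∣m)) (∣m+n∣m⇒∣n (∣-trans t∣e e∣a) t∣m) , t∣m)
  e∣d : e ∣ d
  e∣d = coprime-divisor e⊥m e∣b
  e∣w : e ∣ w
  e∣w = coprime-divisor e⊥m e∣c
  d+u′≡w : d ℕ.+ u′ ≡ w
  d+u′≡w = ℕₚ.suc-injective (trans (sym (ℕₚ.+-suc d u′)) (trans d+u≡ (ℕₚ.+-suc m m′)))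
  e∣u′ : e ∣ u′
  e∣u′ = ∣m+n∣m⇒∣n (subst (e ∣_) (sym d+u′≡w) e∣w) e∣d

-- The triangle (-m,-m), (m,1-m), (u-m,m) has doubled area 4m² - u.
long-sequence : ∀ m′ u′ d → d ℕ.+ suc u′ ≡ suc m′ ℕ.+ suc m′ → Coprime (suc u′) (suc m′) → Coprime u′ (suc m′ ℕ.+ m′) →
  ∃[ n ] n ℕ.+ suc u′ ≡ 4 ℕ.* suc m′ ℕ.* suc m′ × (Σ (Fin n → Pt) λ x → (∀ i → Box (suc m′) (x i)) × MinZeroSum x)
long-sequence m′ u′ d d+u≡ u⊥m u′⊥ = n , length , x , box , minZeroSum (s≤s z≤n) (coprime-coefficients m′ u′ d d+u≡ u⊥m u′⊥) total₁ total₂ cramer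
  where
  m = suc m′
  u = suc u′
  -- The coefficients of the relation are the determinants of the second and third, the third and
  -- first, and the first and second vector.
  a = m ℕ.+ m′ ℕ.* u
  b = m ℕ.* d
  c = m ℕ.* (m ℕ.+ m′)
  open ThreeVectors a b c (- + m , - + m) (+ m , + 1 - + m) (+ u - + m , + m)
  D U V : ℤ
  D = + d
  U = + u
  V = + m′
  M : ℤ
  M = + 1 + V
  D≡ : D ≡ M + M - U
  D≡ = trans (lem D U) (cong (_- U) (cong +_ d+u≡))
    where
    lem : ∀ d u → d ≡ d + u - u
    lem = solve-∀
  a≡ : + a ≡ M + V * U
  a≡ = cong (λ z → M + z) (ℤₚ.pos-* m′ u)
  b≡ : + b ≡ M * (M + M - U)
  b≡ = trans (ℤₚ.pos-* m d) (cong (M *_) D≡)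
  c≡ : + c ≡ M * (M + V)
  c≡ = ℤₚ.pos-* m (m ℕ.+ m′)
  length : n ℕ.+ u ≡ 4 ℕ.* m ℕ.* m
  length = ℤₚ.+-injective (trans (cong₂ (λ y z → + a + (y + z) + U) b≡ c≡) (trans (cong (λ z → z + (M * (M + M - U) + M * (M + V)) + U) a≡)
    (trans (lem V U) (sym (trans (ℤₚ.pos-* (4 ℕ.* m) m) (cong (_* M) (ℤₚ.pos-* 4 m)))))))
    where
    lem : ∀ V U → + 1 + V + V * U + ((+ 1 + V) * (+ 1 + V + (+ 1 + V) - U) + (+ 1 + V) * (+ 1 + V + V)) + U ≡ + 4 * (+ 1 + V) * (+ 1 + V)
    lem = solve-∀
  total₁ : + a * - M + + b * M + + c * (U - M) ≡ + 0
  total₁ = trans (cong₂ _+_ (cong₂ (λ y z → y * - M + z * M) a≡ b≡) (cong (_* (U - M)) c≡)) (lem V U)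
    where
    lem : ∀ V U → (+ 1 + V + V * U) * - (+ 1 + V) + (+ 1 + V) * (+ 1 + V + (+ 1 + V) - U) * (+ 1 + V) + (+ 1 + V) * (+ 1 + V + V) * (U - (+ 1 + V)) ≡ + 0
    lem = solve-∀
  total₂ : + a * - M + + b * (+ 1 - M) + + c * M ≡ + 0
  total₂ = trans (cong₂ _+_ (cong₂ (λ y z → y * - M + z * (+ 1 - M)) a≡ b≡) (cong (_* M) c≡)) (lem V U)
    where
    lem : ∀ V U → (+ 1 + V + V * U) * - (+ 1 + V) + (+ 1 + V) * (+ 1 + V + (+ 1 + V) - U) * (+ 1 - (+ 1 + V)) + (+ 1 + V) * (+ 1 + V + V) * (+ 1 + V) ≡ + 0
    lem = solve-∀
  cramer : ∀ k₁ k₂ k₃ → k₁ * - M + k₂ * M + k₃ * (U - M) ≡ + 0 → k₁ * - M + k₂ * (+ 1 - M) + k₃ * M ≡ + 0 →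
    + b * k₁ ≡ + a * k₂ × + c * k₁ ≡ + a * k₃
  cramer k₁ k₂ k₃ e₁ e₂ =
    -- The combination (U - M) `e₂` - M `e₁` eliminates `k₃`; in the second component (1 - M) `e₁` -
    -- M `e₂` eliminates `k₂`.
    trans (cong (_* k₁) b≡) (trans (lem₁ V U k₁ k₂ k₃) (trans (cong₂ (λ y z → (M + V * U) * k₂ + (y * (U - M) - z * M)) e₂ e₁) (trans (lem₃ ((M + V * U) * k₂) (U - M) M) (cong (_* k₂) (sym a≡))))) ,
    trans (cong (_* k₁) c≡) (trans (lem₂ V U k₁ k₂ k₃) (trans (cong₂ (λ y z → (M + V * U) * k₃ + (y * (+ 1 - M) - z * M)) e₁ e₂) (trans (lem₃ ((M + V * U) * k₃) (+ 1 - M) M) (cong (_* k₃) (sym a≡)))))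
    where
    lem₃ : ∀ t p q → t + (+ 0 * p - + 0 * q) ≡ t
    lem₃ = solve-∀
    lem₁ : ∀ V U k₁ k₂ k₃ → (+ 1 + V) * (+ 1 + V + (+ 1 + V) - U) * k₁ ≡ (+ 1 + V + V * U) * k₂ +
      ((k₁ * - (+ 1 + V) + k₂ * (+ 1 - (+ 1 + V)) + k₃ * (+ 1 + V)) * (U - (+ 1 + V)) - (k₁ * - (+ 1 + V) + k₂ * (+ 1 + V) + k₃ * (U - (+ 1 + V))) * (+ 1 + V))
    lem₁ = solve-∀
    lem₂ : ∀ V U k₁ k₂ k₃ → (+ 1 + V) * (+ 1 + V + V) * k₁ ≡ (+ 1 + V + V * U) * k₃ +
      ((k₁ * - (+ 1 + V) + k₂ * (+ 1 + V) + k₃ * (U - (+ 1 + V))) * (+ 1 - (+ 1 + V)) - (k₁ * - (+ 1 + V) + k₂ * (+ 1 - (+ 1 + V)) + k₃ * (+ 1 + V)) * (+ 1 + V))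
    lem₂ = solve-∀
  box : ∀ i → Box m (x i)
  box i = by-kind (kind (toℕ i))
    where
    -m≤m : - M ≤ M
    -m≤m = ℤ.-≤+
    by-kind : ∀ k → Box m (vector k)
    by-kind first = (ℤₚ.≤-refl , -m≤m) , (ℤₚ.≤-refl , -m≤m)
    by-kind second = (-m≤m , ℤₚ.≤-refl) , (≤-from-gap (+ 1) (0≤+ 1) (ℤₚ.+-comm (+ 1) (- M)) , ≤-from-gap (V + M) (0≤+ (m′ ℕ.+ m)) (lem V))
      where
      lem : ∀ V → + 1 + V ≡ + 1 - (+ 1 + V) + (V + (+ 1 + V))
      lem = solve-∀
    by-kind third = (≤-from-gap U (0≤+ u) (ℤₚ.+-comm U (- M)) , ≤-from-gap D (0≤+ d) (trans (lem M U) (cong (λ z → U - M + z) (sym D≡)))) , (-m≤m , ℤₚ.≤-refl)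
      where
      lem : ∀ M U → M ≡ U - M + (M + M - U)
      lem = solve-∀

-- The least integer coprime to m

least : {P : ℕ → Set} → (∀ n → Dec (P n)) → ∀ N → P N → ∃[ u ] P u × u ℕ.≤ N × (∀ t → t ℕ.< u → ¬ P t)
least {P} P? N pN = [ (λ found → found) , (λ none → ⊥-elim (none N ℕₚ.≤-refl pN)) ]′ (search N)
  where
  search : ∀ N → (∃[ u ] P u × u ℕ.≤ N × (∀ t → t ℕ.< u → ¬ P t)) ⊎ (∀ t → t ℕ.≤ N → ¬ P t)
  search zero with P? 0
  ... | yes p = inj₁ (0 , p , z≤n , λ t ())
  ... | no ¬p = inj₂ λ { zero _ → ¬p }
  search (suc N) with search N | P? (suc N)
  ... | inj₁ (u , p , u≤ , min) | _ = inj₁ (u , p , ℕₚ.m≤n⇒m≤1+n u≤ , min)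
  ... | inj₂ none | yes p = inj₁ (suc N , p , ℕₚ.≤-refl , λ t t< → none t (ℕ.s≤s⁻¹ t<))
  ... | inj₂ none | no ¬p = inj₂ λ t t≤ → [ (λ t< → none t (ℕ.s≤s⁻¹ t<)) , (λ { refl → ¬p }) ]′ (ℕₚ.m≤n⇒m<n∨m≡n t≤)

square-root : ∀ x → ∃[ y ] y ℕ.* y ℕ.≤ x × x ℕ.< suc y ℕ.* suc y
square-root x = let y , x< , _ , min = least (λ y → x ℕ.<? suc y ℕ.* suc y) x (ℕₚ.<-≤-trans (ℕₚ.n<1+n x) (ℕₚ.m≤m*n (suc x) (suc x))) in y , below y min , x<
  where
  below : ∀ y → (∀ t → t ℕ.< y → ¬ x ℕ.< suc t ℕ.* suc t) → y ℕ.* y ℕ.≤ x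
  below zero _ = z≤n
  below (suc y) min = ℕₚ.≮⇒≥ (min y ℕₚ.≤-refl)

-- Binomial coefficients and common multiples of 1, ..., n

binomial : ℕ → ℕ → ℕ
binomial n zero = 1
binomial zero (suc k) = 0
binomial (suc n) (suc k) = binomial n k ℕ.+ binomial n (suc k)

binomial-zero : ∀ n k → n ℕ.< k → binomial n k ≡ 0
binomial-zero zero (suc k) _ = refl
binomial-zero (suc n) (suc k) (s≤s n<k) = cong₂ ℕ._+_ (binomial-zero n k n<k) (binomial-zero n (suc k) (ℕₚ.m≤n⇒m≤1+n n<k))

binomial-positive : ∀ n k → k ℕ.≤ n → 0 ℕ.< binomial n k
binomial-positive n zero _ = s≤s z≤n
binomial-positive (suc n) (suc k) (s≤s k≤n) = ℕₚ.<-≤-trans (binomial-positive n k k≤n) (ℕₚ.m≤m+n _ _)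

absorption : ∀ n k → suc k ℕ.* binomial (suc n) (suc k) ≡ suc n ℕ.* binomial n k
absorption zero zero = refl
absorption zero (suc k) = ℕₚ.*-zeroʳ (suc (suc k))
absorption (suc n) zero = cong suc (trans (ℕₚ.+-identityʳ _) (sym (trans (ℕₚ.*-identityʳ (suc n)) (sym (first-column n)))))
  where
  first-column : ∀ n → binomial (suc n) 1 ≡ suc n
  first-column zero = refl
  first-column (suc n) = cong suc (first-column n)
absorption (suc n) (suc k) = begin
  suc (suc k) ℕ.* (binomial (suc n) (suc k) ℕ.+ binomial (suc n) (suc (suc k))) ≡⟨ lem (suc k) (binomial (suc n) (suc k)) (binomial (suc n) (suc (suc k))) ⟩
  binomial (suc n) (suc k) ℕ.+ suc k ℕ.* binomial (suc n) (suc k) ℕ.+ suc (suc k) ℕ.* binomial (suc n) (suc (suc k))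
    ≡⟨ cong₂ (λ y z → binomial (suc n) (suc k) ℕ.+ y ℕ.+ z) (absorption n k) (absorption n (suc k)) ⟩
  binomial (suc n) (suc k) ℕ.+ suc n ℕ.* binomial n k ℕ.+ suc n ℕ.* binomial n (suc k) ≡⟨ lem₂ (binomial n k) (binomial n (suc k)) (suc n) ⟩
  suc (suc n) ℕ.* binomial (suc n) (suc k) ∎
  where
  open ≡-Reasoning
  lem : ∀ k x y → (1 ℕ.+ k) ℕ.* (x ℕ.+ y) ≡ x ℕ.+ k ℕ.* x ℕ.+ (1 ℕ.+ k) ℕ.* y
  lem = ℕR.solve-∀
  lem₂ : ∀ x y n → x ℕ.+ y ℕ.+ n ℕ.* x ℕ.+ n ℕ.* y ≡ (1 ℕ.+ n) ℕ.* (x ℕ.+ y)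
  lem₂ = ℕR.solve-∀

-- Leibniz's triangle: with ℓ n k = (n+1) C(n,k) one has 1/ℓ(n+1,k+1) = 1/ℓ(n,k) - 1/ℓ(n+1,k), so every
-- ℓ n k divides each common multiple of 1, …, n+1.
leibniz-triangle : ∀ M n → (∀ t → t ℕ.≤ n → suc t ∣ M) → ∀ k → k ℕ.≤ n → suc n ℕ.* binomial n k ∣ M
leibniz-triangle M n h zero _ = subst (_∣ M) (sym (ℕₚ.*-identityʳ (suc n))) (h n ℕₚ.≤-refl)
leibniz-triangle M (suc n) h (suc k) (s≤s k≤n) =
  step (leibniz-triangle M n (λ t t≤ → h t (ℕₚ.m≤n⇒m≤1+n t≤)) k k≤n) (leibniz-triangle M (suc n) h k (ℕₚ.m≤n⇒m≤1+n k≤n))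
  where
  X Y p q r : ℕ
  X = binomial (suc n) k
  Y = binomial (suc n) (suc k)
  p = suc n ℕ.* binomial n k
  q = suc (suc n) ℕ.* X
  r = suc (suc n) ℕ.* Y
  -- The relation C(n+1,k) (n+1-k) = C(n+1,k+1) (k+1), written additively.
  neighbours : suc n ℕ.* X ≡ p ℕ.+ k ℕ.* X
  neighbours = sum-row k
    where
    sum-row : ∀ k → suc n ℕ.* binomial (suc n) k ≡ suc n ℕ.* binomial n k ℕ.+ k ℕ.* binomial (suc n) k
    sum-row zero = sym (ℕₚ.+-identityʳ _)
    sum-row (suc k) = trans (ℕₚ.*-distribˡ-+ (suc n) (binomial n k) (binomial n (suc k)))
      (trans (ℕₚ.+-comm (suc n ℕ.* binomial n k) (suc n ℕ.* binomial n (suc k))) (cong (suc n ℕ.* binomial n (suc k) ℕ.+_) (sym (absorption n k))))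
  q≡ : q ≡ p ℕ.+ suc k ℕ.* X
  q≡ = trans (cong (X ℕ.+_) neighbours) (lem X p (k ℕ.* X))
    where
    lem : ∀ X p y → X ℕ.+ (p ℕ.+ y) ≡ p ℕ.+ (X ℕ.+ y)
    lem = ℕR.solve-∀
  -- The relation 1/r = 1/p - 1/q with denominators cleared. For M = α p = β q it yields (α - β) r =
  -- M.
  rq≡ : r ℕ.* q ≡ p ℕ.* q ℕ.+ r ℕ.* p
  rq≡ = trans (cong (r ℕ.*_) q≡) (trans (lem (suc (suc n)) Y p (suc k) X) (cong (λ z → z ℕ.* q ℕ.+ r ℕ.* p) (absorption n k)))
    where
    lem : ∀ n Y p k X → n ℕ.* Y ℕ.* (p ℕ.+ k ℕ.* X) ≡ k ℕ.* Y ℕ.* (n ℕ.* X) ℕ.+ n ℕ.* Y ℕ.* p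
    lem = ℕR.solve-∀
  step : p ∣ M → q ∣ M → r ∣ M
  step (divides α eα) (divides β eβ) = divides (α ∸ β) (sym (begin
    (α ∸ β) ℕ.* r ≡⟨ ℕₚ.*-distribʳ-∸ r α β ⟩
    α ℕ.* r ∸ β ℕ.* r ≡⟨ cong (_∸ β ℕ.* r) αr≡ ⟩
    M ℕ.+ β ℕ.* r ∸ β ℕ.* r ≡⟨ ℕₚ.m+n∸n≡m M (β ℕ.* r) ⟩
    M ∎))
    where
    open ≡-Reasoning
    0<q : 0 ℕ.< q
    0<q = ℕₚ.*-mono-≤ {1} {suc (suc n)} {1} (s≤s z≤n) (binomial-positive (suc n) k (ℕₚ.m≤n⇒m≤1+n k≤n))
    αr≡ : α ℕ.* r ≡ M ℕ.+ β ℕ.* r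
    αr≡ = ℕₚ.*-cancelʳ-≡ (α ℕ.* r) (M ℕ.+ β ℕ.* r) q {{ℕ.>-nonZero 0<q}} (begin
      α ℕ.* r ℕ.* q ≡⟨ ℕₚ.*-assoc α r q ⟩
      α ℕ.* (r ℕ.* q) ≡⟨ cong (α ℕ.*_) rq≡ ⟩
      α ℕ.* (p ℕ.* q ℕ.+ r ℕ.* p) ≡⟨ lem α p q r ⟩
      α ℕ.* p ℕ.* q ℕ.+ α ℕ.* p ℕ.* r ≡⟨ cong₂ (λ y z → y ℕ.* q ℕ.+ z ℕ.* r) (sym eα) (trans (sym eα) eβ) ⟩
      M ℕ.* q ℕ.+ β ℕ.* q ℕ.* r ≡⟨ lem₂ M q β r ⟩
      (M ℕ.+ β ℕ.* r) ℕ.* q ∎)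
      where
      lem : ∀ α p q r → α ℕ.* (p ℕ.* q ℕ.+ r ℕ.* p) ≡ α ℕ.* p ℕ.* q ℕ.+ α ℕ.* p ℕ.* r
      lem = ℕR.solve-∀
      lem₂ : ∀ M q β r → M ℕ.* q ℕ.+ β ℕ.* q ℕ.* r ≡ (M ℕ.+ β ℕ.* r) ℕ.* q
      lem₂ = ℕR.solve-∀

rowSum : ℕ → ℕ → ℕ
rowSum n zero = 0
rowSum n (suc k) = rowSum n k ℕ.+ binomial n k

rowSum-suc : ∀ n k → rowSum (suc n) (suc k) ≡ rowSum n (suc k) ℕ.+ rowSum n k
rowSum-suc n zero = refl
rowSum-suc n (suc k) = trans (cong (ℕ._+ binomial (suc n) (suc k)) (rowSum-suc n k))
  (lem (rowSum n k) (binomial n k) (binomial n (suc k)))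
  where
  lem : ∀ s a b → s ℕ.+ a ℕ.+ s ℕ.+ (a ℕ.+ b) ≡ s ℕ.+ a ℕ.+ b ℕ.+ (s ℕ.+ a)
  lem = ℕR.solve-∀

rowSum-full : ∀ n → rowSum n (suc n) ≡ 2 ^ n
rowSum-full zero = refl
rowSum-full (suc n) = trans (rowSum-suc n (suc n)) (trans (cong (λ z → rowSum n (suc n) ℕ.+ z ℕ.+ rowSum n (suc n)) (binomial-zero n (suc n) ℕₚ.≤-refl))
  (trans (cong (λ z → z ℕ.+ 0 ℕ.+ z) (rowSum-full n)) (lem (2 ^ n))))
  where
  lem : ∀ z → z ℕ.+ 0 ℕ.+ z ≡ z ℕ.+ (z ℕ.+ 0)
  lem = ℕR.solve-∀

-- Each of the n + 1 entries (n+1) C(n,k) divides `M`, so it is at most `M`; the entries add up to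
-- (n+1) 2^n.
common-multiple-≥ : ∀ M n → 0 ℕ.< M → (∀ t → t ℕ.≤ n → suc t ∣ M) → 2 ^ n ℕ.≤ M
common-multiple-≥ M n 0<M h = ℕₚ.*-cancelˡ-≤ (suc n) (subst (λ z → suc n ℕ.* z ℕ.≤ suc n ℕ.* M) (rowSum-full n) (partial (suc n) ℕₚ.≤-refl))
  where
  partial : ∀ k → k ℕ.≤ suc n → suc n ℕ.* rowSum n k ℕ.≤ k ℕ.* M
  partial zero _ = ℕₚ.≤-reflexive (ℕₚ.*-zeroʳ (suc n))
  partial (suc k) (s≤s k≤n) = ℕₚ.≤-trans (ℕₚ.≤-reflexive (ℕₚ.*-distribˡ-+ (suc n) (rowSum n k) (binomial n k)))
    (ℕₚ.≤-trans (ℕₚ.+-mono-≤ (partial k (ℕₚ.m≤n⇒m≤1+n k≤n)) (∣⇒≤ {{ℕ.>-nonZero 0<M}} (leibniz-triangle M n h k k≤n))) (ℕₚ.≤-reflexive (ℕₚ.+-comm (k ℕ.* M) M)))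

-- n = a b² with b maximal; then a divides m, since a common factor e of a / gcd a m and m would
-- give (b e)² ∣ n.
divides-by-square : ∀ m x y → 0 ℕ.< m → x ℕ.< suc y ℕ.* suc y → (∀ t → 2 ℕ.≤ t → t ℕ.≤ x → ¬ Coprime t m) →
  ∀ n → 0 ℕ.< n → n ℕ.≤ x → n ∣ m ℕ.* (y ! ℕ.* y !)
divides-by-square m x y 0<m x< common n 0<n n≤x = result (greatest (λ d → suc d ℕ.* suc d ∣? n) (1∣ n) n)
  where
  result : (∃[ d ] suc d ℕ.* suc d ∣ n × (∀ t → t ℕ.≤ n → suc t ℕ.* suc t ∣ n → t ℕ.≤ d)) → n ∣ m ℕ.* (y ! ℕ.* y !)
  result (d , divides a n≡ , max) = subst (_∣ m ℕ.* (y ! ℕ.* y !)) (sym n≡) (*-pres-∣ a∣m (*-pres-∣ b∣y! b∣y!))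
    where
    b g : ℕ
    b = suc d
    g = gcd a m
    b≤y : b ℕ.≤ y
    b≤y = ℕₚ.≮⇒≥ λ y<b → ℕₚ.<⇒≱ x< (ℕₚ.≤-trans (ℕₚ.*-mono-≤ y<b y<b) (ℕₚ.≤-trans (∣⇒≤ {{ℕ.>-nonZero 0<n}} (divides a n≡)) n≤x))
    b∣y! : b ∣ y !
    b∣y! = ∣-trans (m∣m*n (d !)) (m≤n⇒m!∣n! b≤y)
    a∣n : a ∣ n
    a∣n = divides (b ℕ.* b) (trans n≡ (ℕₚ.*-comm a (b ℕ.* b)))
    from-quotient : ∀ a′ → a ≡ a′ ℕ.* g → a ∣ m
    from-quotient zero eq = ⊥-elim (ℕₚ.<-irrefl (sym (trans n≡ (cong (ℕ._* (b ℕ.* b)) eq))) 0<n)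
    from-quotient (suc zero) eq = subst (_∣ m) (sym (trans eq (ℕₚ.+-identityʳ g))) (gcd[m,n]∣n a m)
    from-quotient a′@(suc (suc _)) eq = ⊥-elim (common a′ (s≤s (s≤s z≤n))
        (ℕₚ.≤-trans (∣⇒≤ {{ℕ.>-nonZero 0<n}} (∣-trans (divides g (trans eq (ℕₚ.*-comm a′ g))) a∣n)) n≤x) coprime)
      where
      coprime : Coprime a′ m
      coprime {zero} (e∣a′ , _) = case (0∣⇒≡0 e∣a′)
        where
        case : a′ ≡ 0 → 0 ≡ 1
        case ()
      coprime {suc zero} _ = refl
      coprime {e@(suc (suc e″))} (e∣a′ , e∣m) = ⊥-elim (ℕₚ.<⇒≱ b<be (ℕₚ.≤-trans (ℕₚ.≤-reflexive be≡) (s≤s (max t t≤n (subst (λ z → z ℕ.* z ∣ n) be≡ be²∣n)))))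
        where
        t : ℕ
        t = ℕ.pred (b ℕ.* e)
        be≡ : b ℕ.* e ≡ suc t
        be≡ = refl
        e∣g : e ∣ g
        e∣g = gcd-greatest (∣-trans e∣a′ (divides g (trans eq (ℕₚ.*-comm a′ g)))) e∣m
        e²∣a : e ℕ.* e ∣ a
        e²∣a = subst (e ℕ.* e ∣_) (sym eq) (*-pres-∣ e∣a′ e∣g)
        be²∣n : b ℕ.* e ℕ.* (b ℕ.* e) ∣ n
        be²∣n = subst₂ _∣_ (lem b e) (sym n≡) (*-pres-∣ e²∣a (∣-refl {b ℕ.* b}))
          where
          lem : ∀ b e → e ℕ.* e ℕ.* (b ℕ.* b) ≡ b ℕ.* e ℕ.* (b ℕ.* e)
          lem = ℕR.solve-∀
        t≤n : t ℕ.≤ n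
        t≤n = ℕₚ.≤-trans (ℕₚ.n≤1+n t) (∣⇒≤ {{ℕ.>-nonZero 0<n}} (∣-trans (m∣m*n (suc t)) (subst (λ z → z ℕ.* z ∣ n) be≡ be²∣n)))
        b<be : b ℕ.< b ℕ.* e
        b<be = ℕₚ.m<m*n b e (s≤s (s≤s z≤n))
    a∣m : a ∣ m
    a∣m = let divides a′ eq = gcd[m,n]∣m a m in from-quotient a′ eq

-- The ratio of the fourth power of y! to 2^(y²) is largest at y = 5, where it lies between 6 and 7;
-- hence the factor 8. From there on the induction step holds, while at y = 4 it would still fail.
factorial-bound : ∀ y → (y !) ^ 4 ℕ.≤ 8 ℕ.* 2 ^ (y ℕ.* y)
factorial-bound 0 = ℕₚ.≤ᵇ⇒≤ 1 8 _
factorial-bound 1 = ℕₚ.≤ᵇ⇒≤ 1 16 _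
factorial-bound 2 = ℕₚ.≤ᵇ⇒≤ 16 128 _
factorial-bound 3 = ℕₚ.≤ᵇ⇒≤ 1296 4096 _
factorial-bound 4 = ℕₚ.≤ᵇ⇒≤ 331776 524288 _
factorial-bound (suc (suc (suc (suc (suc y))))) = go y
  where
  fourth : ∀ a b → (a ℕ.* b) ^ 4 ≡ a ^ 4 ℕ.* b ^ 4
  fourth a b = lem a b
    where
    lem : ∀ a b → a ℕ.* b ℕ.* (a ℕ.* b ℕ.* (a ℕ.* b ℕ.* (a ℕ.* b ℕ.* 1))) ≡ a ℕ.* (a ℕ.* (a ℕ.* (a ℕ.* 1))) ℕ.* (b ℕ.* (b ℕ.* (b ℕ.* (b ℕ.* 1))))
    lem = ℕR.solve-∀
  -- The exponent is the difference of the squares of 6 + y and 5 + y.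
  growth : ∀ y → (6 ℕ.+ y) ^ 4 ℕ.≤ 2 ^ (11 ℕ.+ (y ℕ.+ y))
  growth zero = ℕₚ.≤ᵇ⇒≤ 1296 2048 _
  growth (suc y) = ℕₚ.≤-trans (ratio y) (ℕₚ.≤-trans (ℕₚ.*-monoʳ-≤ 4 (growth y)) (ℕₚ.≤-reflexive (trans (lem (2 ^ (11 ℕ.+ (y ℕ.+ y)))) (cong (2 ^_) (cong (12 ℕ.+_) (sym (ℕₚ.+-suc y y)))))))
    where
    lem : ∀ z → 4 ℕ.* z ≡ 2 ℕ.* (2 ℕ.* z)
    lem = ℕR.solve-∀
    square : ∀ z → z ^ 4 ≡ (z ℕ.* z) ℕ.* (z ℕ.* z)
    square z = lem₂ z
      where
      lem₂ : ∀ z → z ℕ.* (z ℕ.* (z ℕ.* (z ℕ.* 1))) ≡ (z ℕ.* z) ℕ.* (z ℕ.* z)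
      lem₂ = ℕR.solve-∀
    ratio : ∀ y → (7 ℕ.+ y) ^ 4 ℕ.≤ 4 ℕ.* (6 ℕ.+ y) ^ 4
    ratio y = ℕₚ.≤-trans (ℕₚ.≤-reflexive (square (7 ℕ.+ y))) (ℕₚ.≤-trans (ℕₚ.*-mono-≤ step step) (ℕₚ.≤-reflexive (trans (lem₃ (6 ℕ.+ y)) (cong (4 ℕ.*_) (sym (square (6 ℕ.+ y)))))))
      where
      lem₃ : ∀ z → 2 ℕ.* (z ℕ.* z) ℕ.* (2 ℕ.* (z ℕ.* z)) ≡ 4 ℕ.* (z ℕ.* z ℕ.* (z ℕ.* z))
      lem₃ = ℕR.solve-∀
      lem₄ : ∀ y → 2 ℕ.* ((6 ℕ.+ y) ℕ.* (6 ℕ.+ y)) ≡ (7 ℕ.+ y) ℕ.* (7 ℕ.+ y) ℕ.+ (23 ℕ.+ 10 ℕ.* y ℕ.+ y ℕ.* y)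
      lem₄ = ℕR.solve-∀
      step : (7 ℕ.+ y) ℕ.* (7 ℕ.+ y) ℕ.≤ 2 ℕ.* ((6 ℕ.+ y) ℕ.* (6 ℕ.+ y))
      step = ℕₚ.≤-trans (ℕₚ.m≤m+n _ _) (ℕₚ.≤-reflexive (sym (lem₄ y)))
  go : ∀ y → ((5 ℕ.+ y) !) ^ 4 ℕ.≤ 8 ℕ.* 2 ^ ((5 ℕ.+ y) ℕ.* (5 ℕ.+ y))
  go zero = ℕₚ.≤ᵇ⇒≤ 207360000 268435456 _
  go (suc y) = begin
    ((6 ℕ.+ y) ℕ.* (5 ℕ.+ y) !) ^ 4 ≡⟨ fourth (6 ℕ.+ y) ((5 ℕ.+ y) !) ⟩
    (6 ℕ.+ y) ^ 4 ℕ.* ((5 ℕ.+ y) !) ^ 4 ≤⟨ ℕₚ.*-mono-≤ (growth y) (go y) ⟩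
    2 ^ (11 ℕ.+ (y ℕ.+ y)) ℕ.* (8 ℕ.* 2 ^ ((5 ℕ.+ y) ℕ.* (5 ℕ.+ y))) ≡⟨ lem₅ (2 ^ (11 ℕ.+ (y ℕ.+ y))) (2 ^ ((5 ℕ.+ y) ℕ.* (5 ℕ.+ y))) ⟩
    8 ℕ.* (2 ^ (11 ℕ.+ (y ℕ.+ y)) ℕ.* 2 ^ ((5 ℕ.+ y) ℕ.* (5 ℕ.+ y))) ≡⟨ cong (8 ℕ.*_) (sym (ℕₚ.^-distribˡ-+-* 2 (11 ℕ.+ (y ℕ.+ y)) ((5 ℕ.+ y) ℕ.* (5 ℕ.+ y)))) ⟩
    8 ℕ.* 2 ^ (11 ℕ.+ (y ℕ.+ y) ℕ.+ (5 ℕ.+ y) ℕ.* (5 ℕ.+ y)) ≡⟨ cong (λ z → 8 ℕ.* 2 ^ z) (lem₆ y) ⟩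
    8 ℕ.* 2 ^ ((6 ℕ.+ y) ℕ.* (6 ℕ.+ y)) ∎
    where
    open ℕₚ.≤-Reasoning
    lem₅ : ∀ a b → a ℕ.* (8 ℕ.* b) ≡ 8 ℕ.* (a ℕ.* b)
    lem₅ = ℕR.solve-∀
    lem₆ : ∀ y → 11 ℕ.+ (y ℕ.+ y) ℕ.+ (5 ℕ.+ y) ℕ.* (5 ℕ.+ y) ≡ (6 ℕ.+ y) ℕ.* (6 ℕ.+ y)
    lem₆ = ℕR.solve-∀

-- All of 1, ..., x + 1 divide `M`, so 2^x ≤ m (y!)² with y² ≤ x + 1. After squaring, (y!)⁴ costs
-- only 2^(x + 4), so of the exponent 2x about half survives, to be paid for by m².
small-gap : ∀ m x → 2 ℕ.≤ m → (∀ t → 2 ℕ.≤ t → t ℕ.≤ suc x → ¬ Coprime t m) → x ℕ.≤ 6 ℕ.+ 2 ℕ.* ⌊log₂ m ⌋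
small-gap m x 2≤m common = ℕₚ.+-cancelˡ-≤ x x (6 ℕ.+ 2 ℕ.* lg) exponents
  where
  lg y M : ℕ
  lg = ⌊log₂ m ⌋
  y = proj₁ (square-root (suc x))
  M = m ℕ.* (y ! ℕ.* y !)
  y²≤ : y ℕ.* y ℕ.≤ suc x
  y²≤ = proj₁ (proj₂ (square-root (suc x)))
  0<m : 0 ℕ.< m
  0<m = ℕₚ.<-≤-trans (s≤s z≤n) 2≤m
  1≤y! : ∀ y → 1 ℕ.≤ y !
  1≤y! zero = s≤s z≤n
  1≤y! (suc y) = ℕₚ.*-mono-≤ {1} {suc y} {1} (s≤s z≤n) (1≤y! y)
  2^x≤M : 2 ^ x ℕ.≤ M
  2^x≤M = common-multiple-≥ M x (ℕₚ.*-mono-≤ {1} {m} {1} 0<m (ℕₚ.*-mono-≤ {1} {y !} {1} (1≤y! y) (1≤y! y)))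
    (λ t t≤ → divides-by-square m (suc x) y 0<m (proj₂ (proj₂ (square-root (suc x)))) common (suc t) (s≤s z≤n) (s≤s t≤))
  m≤ : m ℕ.≤ 2 ^ suc lg
  m≤ = ℕₚ.≮⇒≥ λ 2^<m → ℕₚ.<-irrefl refl (ℕₚ.≤-trans (ℕₚ.≤-reflexive (sym (⌊log₂[2^n]⌋≡n (suc lg)))) (⌊log₂⌋-mono-≤ (ℕₚ.<⇒≤ 2^<m)))
  power : 2 ^ (x ℕ.+ x) ℕ.≤ 2 ^ (suc lg ℕ.+ suc lg ℕ.+ (3 ℕ.+ suc x))
  power = begin
    2 ^ (x ℕ.+ x) ≡⟨ ℕₚ.^-distribˡ-+-* 2 x x ⟩
    2 ^ x ℕ.* 2 ^ x ≤⟨ ℕₚ.*-mono-≤ 2^x≤M 2^x≤M ⟩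
    M ℕ.* M ≡⟨ lem m (y !) ⟩
    m ℕ.* m ℕ.* (y !) ^ 4 ≤⟨ ℕₚ.*-mono-≤ (ℕₚ.*-mono-≤ m≤ m≤) (ℕₚ.≤-trans (factorial-bound y) (ℕₚ.*-monoʳ-≤ 8 (ℕₚ.^-monoʳ-≤ 2 y²≤))) ⟩
    2 ^ suc lg ℕ.* 2 ^ suc lg ℕ.* (2 ^ 3 ℕ.* 2 ^ suc x) ≡⟨ cong₂ ℕ._*_ (sym (ℕₚ.^-distribˡ-+-* 2 (suc lg) (suc lg))) (sym (ℕₚ.^-distribˡ-+-* 2 3 (suc x))) ⟩
    2 ^ (suc lg ℕ.+ suc lg) ℕ.* 2 ^ (3 ℕ.+ suc x) ≡⟨ sym (ℕₚ.^-distribˡ-+-* 2 (suc lg ℕ.+ suc lg) (3 ℕ.+ suc x)) ⟩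
    2 ^ (suc lg ℕ.+ suc lg ℕ.+ (3 ℕ.+ suc x)) ∎
    where
    open ℕₚ.≤-Reasoning
    lem : ∀ m z → m ℕ.* (z ℕ.* z) ℕ.* (m ℕ.* (z ℕ.* z)) ≡ m ℕ.* m ℕ.* (z ℕ.* (z ℕ.* (z ℕ.* (z ℕ.* 1))))
    lem = ℕR.solve-∀
  exponents : x ℕ.+ x ℕ.≤ x ℕ.+ (6 ℕ.+ 2 ℕ.* lg)
  exponents = subst₂ ℕ._≤_ (⌊log₂[2^n]⌋≡n (x ℕ.+ x)) (trans (⌊log₂[2^n]⌋≡n (suc lg ℕ.+ suc lg ℕ.+ (3 ℕ.+ suc x))) (lem lg x)) (⌊log₂⌋-mono-≤ power)
    where
    lem : ∀ l x → 1 ℕ.+ l ℕ.+ (1 ℕ.+ l) ℕ.+ (3 ℕ.+ (1 ℕ.+ x)) ≡ x ℕ.+ (6 ℕ.+ 2 ℕ.* l)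
    lem = ℕR.solve-∀

long-sequence-exists : ∀ m → 2 ℕ.≤ m →
  ∃[ n ] 4 ℕ.* m ℕ.* m ℕ.≤ n ℕ.+ 10 ℕ.* ⌊log₂ m ⌋ × (Σ (Fin n → Pt) λ x → (∀ i → Box m (x i)) × MinZeroSum x)
long-sequence-exists (suc zero) (s≤s ())
long-sequence-exists m@(suc m′@(suc _)) 2≤m = result (least (λ t → (2 ℕ.≤? t) ×-dec coprime? t m) (suc m) (s≤s (s≤s z≤n) , coprime-suc))
  where
  coprime-suc : Coprime (suc m) m
  coprime-suc {t} (t∣sm , t∣m) = ∣1⇒≡1 (∣m+n∣m⇒∣n (subst (t ∣_) (ℕₚ.+-comm 1 m) t∣sm) t∣m)
  result : (∃[ u ] (2 ℕ.≤ u × Coprime u m) × u ℕ.≤ suc m × (∀ t → t ℕ.< u → ¬ (2 ℕ.≤ t × Coprime t m))) →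
    ∃[ n ] 4 ℕ.* m ℕ.* m ℕ.≤ n ℕ.+ 10 ℕ.* ⌊log₂ m ⌋ × (Σ (Fin n → Pt) λ x → (∀ i → Box m (x i)) × MinZeroSum x)
  result (suc zero , (s≤s () , _) , _)
  result (u@(suc u′@(suc x)) , (2≤u , u⊥m) , u≤ , min) =
    let n , length , seq = long-sequence m′ u′ (m ℕ.+ m ∸ u) (ℕₚ.m∸n+n≡m u≤2m) u⊥m u′⊥ in
    n , ℕₚ.≤-trans (ℕₚ.≤-reflexive (sym length)) (ℕₚ.+-monoʳ-≤ n u≤10lg) , seq
    where
    u≤2m : u ℕ.≤ m ℕ.+ m
    u≤2m = ℕₚ.≤-trans u≤ (ℕₚ.+-monoˡ-≤ m (s≤s (z≤n {m′})))
    u′⊥ : Coprime u′ (m ℕ.+ m′)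
    -- A common divisor of u - 1 and 2m - 1 is prime to m and smaller than u, so by the choice of u
    -- it is 1.
    u′⊥ {zero} (e∣u′ , _) = zero≢ (0∣⇒≡0 e∣u′)
      where
      zero≢ : u′ ≡ 0 → 0 ≡ 1
      zero≢ ()
    u′⊥ {suc zero} _ = refl
    u′⊥ {e@(suc (suc _))} (e∣u′ , e∣w) = ⊥-elim (min e (s≤s (∣⇒≤ e∣u′)) (s≤s (s≤s z≤n) , e⊥m))
      where
      e⊥m : Coprime e m
      e⊥m {t} (t∣e , t∣m) = ∣1⇒≡1 (∣m+n∣m⇒∣n (subst (t ∣_) (ℕₚ.+-comm 1 m′) t∣m) (∣m+n∣m⇒∣n (∣-trans t∣e e∣w) t∣m))
    lg = ⌊log₂ m ⌋
    1≤lg : 1 ℕ.≤ lg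
    1≤lg = subst (ℕ._≤ lg) (⌊log₂[2^n]⌋≡n 1) (⌊log₂⌋-mono-≤ 2≤m)
    u≤10lg : u ℕ.≤ 10 ℕ.* lg
    -- Here u = x + 2 ≤ 8 + 2 lg, and lg ≥ 1 because m ≥ 2; this is the origin of the constant 10.
    u≤10lg = ℕₚ.≤-trans (ℕₚ.+-monoʳ-≤ 2 (small-gap m x 2≤m (λ t 2≤t t≤ t⊥m → min t (s≤s t≤) (2≤t , t⊥m))))
      (ℕₚ.≤-trans (ℕₚ.+-monoˡ-≤ (2 ℕ.* lg) (ℕₚ.*-monoʳ-≤ 8 1≤lg)) (ℕₚ.≤-reflexive (lem lg)))
      where
      lem : ∀ l → 8 ℕ.* l ℕ.+ 2 ℕ.* l ≡ 10 ℕ.* l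
      lem = ℕR.solve-∀

-- Comparison with π

fromℚᵘ-mono-≤ : ∀ {p q} → p ℚᵘ.≤ q → ℚ.fromℚᵘ p ℚ.≤ ℚ.fromℚᵘ q
fromℚᵘ-mono-≤ {p} {q} p≤q = ℚₚ.toℚᵘ-cancel-≤ (ℚᵘₚ.≤-respˡ-≃ (ℚᵘₚ.≃-sym (ℚₚ.toℚᵘ-fromℚᵘ p)) (ℚᵘₚ.≤-respʳ-≃ (ℚᵘₚ.≃-sym (ℚₚ.toℚᵘ-fromℚᵘ q)) p≤q))

reciprocal-antitone : ∀ {a b} → a ℕ.≤ b → + 1 ℚ./ suc b ℚ.≤ + 1 ℚ./ suc a
reciprocal-antitone {a} {b} a≤b = fromℚᵘ-mono-≤ {ℚᵘ.mkℚᵘ (+ 1) b} {ℚᵘ.mkℚᵘ (+ 1) a} (ℚᵘ.*≤* (*-monoˡ-≤-0≤ {+ suc a} {+ suc b} {+ 1} (0≤+ 1) (+≤+ (s≤s a≤b))))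

0≤/ : ∀ n d → 0ℚ ℚ.≤ + n ℚ./ suc d
0≤/ n d = fromℚᵘ-mono-≤ {ℚᵘ.mkℚᵘ (+ 0) 0} {ℚᵘ.mkℚᵘ (+ n) d} (ℚᵘ.*≤* (subst₂ _≤_ (sym (ℤₚ.*-zeroˡ (+ suc d))) (sym (ℤₚ.*-identityʳ (+ n))) (0≤+ n)))

alt-even : ∀ n → alt (n ℕ.+ n) ≡ 1ℚ
alt-even zero = refl
alt-even (suc n) = trans (cong (λ k → ℚ.- alt k) (ℕₚ.+-suc n n)) (cong (λ a → ℚ.- (ℚ.- a)) (alt-even n))

-- The added reciprocal is the size of the next term of the series, the one about to be subtracted;
-- with it the induction closes, starting from 1 = 2/3 + 1/3.
leibniz-lower : ∀ n → (+ 2 ℚ./ 3) ℚ.+ (+ 1 ℚ./ suc (suc (n ℕ.+ n) ℕ.+ suc (n ℕ.+ n))) ℚ.≤ leibniz (suc (n ℕ.+ n))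
leibniz-lower zero = ℚₚ.≤-refl
leibniz-lower (suc n) = subst (λ k → (+ 2 ℚ./ 3) ℚ.+ (+ 1 ℚ./ suc (suc k ℕ.+ suc k)) ℚ.≤ leibniz (suc k)) (sym (cong suc (ℕₚ.+-suc n n)))
  (ℚₚ.≤-trans (ℚₚ.+-monoʳ-≤ t (reciprocal-antitone (ℕₚ.+-mono-≤ (ℕₚ.n≤1+n (suc (suc k))) (ℕₚ.n≤1+n (suc (suc k))))))
    (subst₂ ℚ._≤_ (cancel t a b) (cong (λ e → leibniz (suc k) ℚ.+ (ℚ.- e) ℚ.* a ℚ.+ (ℚ.- (ℚ.- e)) ℚ.* b) (sym (alt-even n)))
      (ℚₚ.+-monoˡ-≤ (1ℚ ℚ.* b) (ℚₚ.+-monoˡ-≤ ((ℚ.- 1ℚ) ℚ.* a) (leibniz-lower n)))))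
  where
  k = n ℕ.+ n
  t = + 2 ℚ./ 3
  a = + 1 ℚ./ suc (suc k ℕ.+ suc k)
  b = + 1 ℚ./ suc (suc (suc k) ℕ.+ suc (suc k))
  open +-*-Solver
  cancel : ∀ t a b → t ℚ.+ a ℚ.+ (ℚ.- 1ℚ) ℚ.* a ℚ.+ 1ℚ ℚ.* b ≡ t ℚ.+ b
  cancel = solve 3 (λ t a b → t :+ a :+ (:- con 1ℚ) :* a :+ con 1ℚ :* b := t :+ b) refl

-- Rationals above π lie above some partial sum of odd length, so a lower bound for these partial
-- sums suffices; 8/3 = 4 (1 - 1/3) is the partial sum with two terms.
π-lower : ∀ q → π< q → + 8 ℚ./ 3 ℚ.≤ q
π-lower q (n , h) = ℚₚ.≤-trans (ℚₚ.*-monoˡ-≤-nonNeg (+ 4 ℚ./ 1) {+ 2 ℚ./ 3} {leibniz (suc (n ℕ.+ n))}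
    (ℚₚ.≤-trans (subst (ℚ._≤ (+ 2 ℚ./ 3) ℚ.+ r) (ℚₚ.+-identityʳ (+ 2 ℚ./ 3)) (ℚₚ.+-monoʳ-≤ (+ 2 ℚ./ 3) (0≤/ 1 (suc (n ℕ.+ n) ℕ.+ suc (n ℕ.+ n))))) (leibniz-lower n))) (ℚₚ.<⇒≤ h)
  where
  r = + 1 ℚ./ suc (suc (n ℕ.+ n) ℕ.+ suc (n ℕ.+ n))

rational-bound : ∀ m d q → 0 ℕ.< m → + 5 * + d ≤ + 32 * + m * + m + + 24 * + m + + 4 → + 8 ℚ./ 3 ℚ.≤ q →
  (+ 2 ℚ./ 1) ℚ.* (+ d ℚ./ 1) ℚ.≤ (+ 5 ℚ./ 1) ℚ.* q ℚ.* (+ (m ℕ.* m) ℚ./ 1) ℚ.+ (+ (2 ℕ.* 10 ℕ.* m) ℚ./ 1)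
rational-bound m d q 0<m 5d≤ 8/3≤q = ℚₚ.≤-trans at-8/3
  (ℚₚ.+-monoˡ-≤ (+ (2 ℕ.* 10 ℕ.* m) ℚ./ 1) (ℚₚ.*-monoʳ-≤-nonNeg (+ (m ℕ.* m) ℚ./ 1) {{ℚ.nonNegative (0≤/ (m ℕ.* m) 0)}}
    {(+ 5 ℚ./ 1) ℚ.* (+ 8 ℚ./ 3)} {(+ 5 ℚ./ 1) ℚ.* q} (ℚₚ.*-monoˡ-≤-nonNeg (+ 5 ℚ./ 1) 8/3≤q)))
  where
  mm k : ℕ
  mm = m ℕ.* m
  k = 2 ℕ.* 10 ℕ.* m
  -- The inequality at q = 8/3 in the cross-multiplied form demanded by unnormalised rationals.
  -- Multiplied by 5 it follows from six times the length bound, as 6 · 32 ≤ 200 and the linear term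
  -- 300 m absorbs 144 m + 24.
  integral : + 2 * + d * + 3 ≤ (+ 40 * + mm * + 1 + + k * + 3) * + 1
  integral = *-cancelˡ-≤-0< {+ 2 * + d * + 3} {(+ 40 * + mm * + 1 + + k * + 3) * + 1} (+ 5) (+<+ (s≤s z≤n))
    (≤-from-gap gap 0≤gap (trans (cong₂ (λ y z → + 5 * ((+ 40 * y * + 1 + z * + 3) * + 1)) (ℤₚ.pos-* m m) (ℤₚ.pos-* 20 m)) (lem (+ m) (+ d))))
    where
    gap = + 6 * (+ 32 * + m * + m + + 24 * + m + + 4 - + 5 * + d) + (+ 8 * (+ m * + m) + + 132 * + m + + 24 * (+ m - + 1))
    0≤gap : + 0 ≤ gap
    0≤gap = 0≤a+b {+ 6 * (+ 32 * + m * + m + + 24 * + m + + 4 - + 5 * + d)} {+ 8 * (+ m * + m) + + 132 * + m + + 24 * (+ m - + 1)}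
      (0≤a*b {+ 6} {+ 32 * + m * + m + + 24 * + m + + 4 - + 5 * + d} (0≤+ 6) (0≤b-a 5d≤))
      (0≤a+b {+ 8 * (+ m * + m) + + 132 * + m} {+ 24 * (+ m - + 1)}
        (0≤a+b {+ 8 * (+ m * + m)} {+ 132 * + m} (0≤a*b {+ 8} {+ m * + m} (0≤+ 8) (0≤a² (+ m))) (0≤a*b {+ 132} {+ m} (0≤+ 132) (0≤+ m)))
        (0≤a*b {+ 24} {+ m - + 1} (0≤+ 24) (0≤b-a (+≤+ 0<m))))
    lem : ∀ m d → + 5 * ((+ 40 * (m * m) * + 1 + + 20 * m * + 3) * + 1) ≡ + 5 * (+ 2 * d * + 3) +
      (+ 6 * (+ 32 * m * m + + 24 * m + + 4 - + 5 * d) + (+ 8 * (m * m) + + 132 * m + + 24 * (m - + 1)))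
    lem = solve-∀
  int : ℕ → ℚᵘ.ℚᵘ
  int n = ℚᵘ.mkℚᵘ (+ n) 0
  eight-thirds : ℚᵘ.ℚᵘ
  eight-thirds = ℚᵘ.mkℚᵘ (+ 8) 2
  homo-* : ∀ p q → ℚ.toℚᵘ (ℚ.fromℚᵘ p ℚ.* ℚ.fromℚᵘ q) ℚᵘ.≃ p ℚᵘ.* q
  homo-* p q = ℚᵘₚ.≃-trans (ℚₚ.toℚᵘ-homo-* (ℚ.fromℚᵘ p) (ℚ.fromℚᵘ q)) (ℚᵘₚ.*-cong (ℚₚ.toℚᵘ-fromℚᵘ p) (ℚₚ.toℚᵘ-fromℚᵘ q))
  right : ℚ.toℚᵘ (ℚ.fromℚᵘ (int 5) ℚ.* ℚ.fromℚᵘ eight-thirds ℚ.* ℚ.fromℚᵘ (int mm) ℚ.+ ℚ.fromℚᵘ (int k)) ℚᵘ.≃ int 5 ℚᵘ.* eight-thirds ℚᵘ.* int mm ℚᵘ.+ int k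
  right = ℚᵘₚ.≃-trans (ℚₚ.toℚᵘ-homo-+ (ℚ.fromℚᵘ (int 5) ℚ.* ℚ.fromℚᵘ eight-thirds ℚ.* ℚ.fromℚᵘ (int mm)) (ℚ.fromℚᵘ (int k)))
    (ℚᵘₚ.+-cong (ℚᵘₚ.≃-trans (ℚₚ.toℚᵘ-homo-* (ℚ.fromℚᵘ (int 5) ℚ.* ℚ.fromℚᵘ eight-thirds) (ℚ.fromℚᵘ (int mm)))
        (ℚᵘₚ.*-cong (homo-* (int 5) eight-thirds) (ℚₚ.toℚᵘ-fromℚᵘ (int mm)))) (ℚₚ.toℚᵘ-fromℚᵘ (int k)))
  at-8/3 : (+ 2 ℚ./ 1) ℚ.* (+ d ℚ./ 1) ℚ.≤ (+ 5 ℚ./ 1) ℚ.* (+ 8 ℚ./ 3) ℚ.* (+ mm ℚ./ 1) ℚ.+ (+ k ℚ./ 1)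
  at-8/3 = ℚₚ.toℚᵘ-cancel-≤ (ℚᵘₚ.≤-respˡ-≃ (ℚᵘₚ.≃-sym (homo-* (int 2) (int d))) (ℚᵘₚ.≤-respʳ-≃ (ℚᵘₚ.≃-sym right) (ℚᵘ.*≤* integral)))

theorem5 : Σ ℕ λ C → ∀ (m : ℕ) → 2 ℕ.≤ m → ∃[ d ] (IsDavenport (Box m) d
             × 4 ℕ.* m ℕ.* m ℕ.≤ d ℕ.+ C ℕ.* ⌊log₂ m ⌋
             × (∀ (q : ℚ) → π< q →
                 (+ 2 ℚ./ 1) ℚ.* (+ d ℚ./ 1)
                   ℚ.≤ (+ 5 ℚ./ 1) ℚ.* q ℚ.* (+ (m ℕ.* m) ℚ./ 1) ℚ.+ (+ (2 ℕ.* C ℕ.* m) ℚ./ 1)))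
theorem5 = 10 , λ m 2≤m →
  let 0<m = ℕₚ.<-≤-trans (s≤s z≤n) 2≤m
      d , davenport , 5d≤ = davenport-exists m 0<m
      n , lower , x , box , mz = long-sequence-exists m 2≤m
  in d , davenport , ℕₚ.≤-trans lower (ℕₚ.+-monoˡ-≤ (10 ℕ.* ⌊log₂ m ⌋) (proj₂ davenport n x box mz)) ,
    λ q π<q → rational-bound m d q 0<m 5d≤ (π-lower q π<q)
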